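{- Let $\delta,\alpha,\lambda\ge0$. Suppose that the Combined Algorithm is given a predicted average load $v'_{avg}$ and predicted interval lengths $\ell'_I$ such that $v'_{avg}\in\left[\frac{v_{avg}}{1+\delta},\,v_{avg}(1+\delta)\right]$ and $\ell'_I\in\left[\frac{\ell_I}{1+\alpha},\,\ell_I(1+\lambda)\right]$ for every interval $I$. Then its total cost is at most (1) $(1+\alpha)(1+\lambda)\cdot\left(\mathrm{OPT}+T\cdot O\left(\sqrt{(1+\delta)v_{avg}\log\mu}\right)\right)$ in the uniform size case (with Next-Fit as the underlying static algorithm); (2) $(1+\alpha)(1+\lambda)\cdot\left(\Pi_k\cdot\mathrm{OPT}+T\cdot k\cdot O\left(\sqrt{(1+\delta)v_{avg}\log\mu}\right)\right)$ in the non-uniform size case (with Harmonic with parameter $k$ as the underlying static algorithm). Here $O(\cdot)$ hides an absolute constant.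
   Context: Dynamic bin packing. Time is discretized into steps $t=1,\dots,T$. An instance is a finite set of intervals $I=[s_I,e_I)$ with integer endpoints and size $w_I\in(0,1]$; $t\in I$ means $s_I\le t<e_I$ ($I$ active at $t$). The length is $\ell_I=e_I-s_I$; the minimum length is $1$ and $\mu$ is the maximum length. At each step at least one interval is active. Each interval is assigned to one machine for its entire duration; at each time the total size of active intervals on a machine is at most $1$. Total cost is the total time machines are active (have an active interval), summed over machines; $\mathrm{OPT}$ is the minimum offline cost. Uniform size case: all sizes equal $1/g$, $g\ge1$ an integer; non-uniform: arbitrary sizes. $v_{avg}=\frac1T\sum_{t=1}^T\lceil\sum_{I\ni t}w_I\rceil$ is the average load. Static algorithms. Next-Fit keeps one active bin; an item that does not fit closes it and opens a new one. Harmonic with parameter $k$ splits items into classes with sizes in $(\frac1{j+1},\frac1j]$ ($1\le j\le k-1$) and $(0,\frac1k]$ and packs each class separately by Next-Fit; $\Pi_k$ is its asymptotic competitive ratio for static bin packing (its number of bins is at most $\Pi_k$ times optimal, plus $k$). Dynamic non-clairvoyant algorithm with underlying bounded-space static algorithm $A$: when an interval $I$ arrives, feed an item of size $w_I$ to $A$; if $A$ opens a new bin, open a new machine associated with it; place $I$ on the machine associated with the bin into which $A$ packs the item. When the last interval on a machine departs, the machine is closed; if its bin is still active in $A$, a new machine is associated with the bin and opened only when a new item is packed into that bin. First-Fit: assign an arriving interval to the machine with the earliest opening time among open machines with enough free capacity; if none, open a new machine. Combined Algorithm, given average load value $V$ (here $V=v'_{avg}$) and lengths (here $\ell'_I$)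 revealed on arrival: let $\epsilon_j=\min\{1,\frac jV\}$ and $q_j=\min\{1,\sqrt{V/j}\}$ for $j\ge1$. Interval $I$ is in class $c^j$ if its given length lies in $[e^{\sum_{i<j}\epsilon_i},e^{\sum_{i\le j}\epsilon_i})$ (a given length below $1$ is treated as $1$). Keep one copy of First-Fit, and for each $j$ a separate copy of the dynamic non-clairvoyant algorithm, all on disjoint sets of machines. When $I\in c^j$ arrives at time $t$, let $v^j_t$ be the total size of class-$c^j$ intervals active at that moment, including $I$; if $v^j_t\le q_j$ schedule $I$ with the First-Fit copy, otherwise with the $j$-th copy of the dynamic non-clairvoyant algorithm. The bounds are understood for $\mu\ge2$. -}

module Defs where

open import Level using (0ℓ)
open import Algebra.Bundles using (CommutativeRing; Semiring)
import Algebra.Construct.NaturalChoice.Max as NaturalMax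
import Algebra.Construct.NaturalChoice.Min as NaturalMin
import Algebra.Definitions.RawSemiring as RawSemiringOps
open import Data.Fin.Base as Fin using (Fin; toℕ)
import Data.Fin.Properties as Fin
open import Data.List.Base
  using (List; []; _∷_; allFin; deduplicate; filter; foldl; foldr; head; length; lookup; map; upTo)
import Data.List.Extrema.Nat as Extrema
open import Data.List.Relation.Unary.All using (All)
import Data.List.Relation.Unary.Any as Any
import Data.Maybe.Base as Maybe
open import Data.Maybe.Base using (Maybe; just; nothing)
import Data.Maybe.Properties as Maybe
open import Data.Nat.Base as ℕ using (ℕ; zero; suc; _∸_; _!)
import Data.Nat.ListAction as ℕ
import Data.Nat.Properties as ℕ
open import Data.Product.Base using (Σ; ∃; ∃-syntax; _×_; _,_; proj₁; proj₂)
import Data.Product.Properties as Product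
open import Function.Base using (_∘_)
open import Relation.Binary.Bundles using (DecTotalOrder)
open import Relation.Binary.Core using (Rel)
open import Relation.Binary.Definitions using (DecidableEquality)
open import Relation.Binary.PropositionalEquality.Core using (_≡_)
open import Relation.Binary.Structures using (IsDecTotalOrder)
import Relation.Binary.Construct.NonStrictToStrict as NonStrictToStrict
open import Relation.Nullary.Decidable using (Dec; yes; no; _×-dec_)
open import Relation.Nullary.Negation using (¬_)

-- The real numbers, characterised (uniquely up to isomorphism) as a
-- Dedekind-complete totally ordered field.  The classical reals are meant:
-- the order is decidable.  Both `sup` and `_⁻¹` are total; nothing is assumed
-- about `sup` of an empty or unbounded set or about `0# ⁻¹`.

record CompleteOrderedField : Set₁ where
  infix  4 _≤_
  infix  8 _⁻¹
  field
    commutativeRing : CommutativeRing 0ℓ 0ℓ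

  open CommutativeRing commutativeRing public

  field
    _≤_             : Rel Carrier 0ℓ
    isDecTotalOrder : IsDecTotalOrder _≈_ _≤_
    +-monoʳ-≤       : ∀ x {y z} → y ≤ z → x + y ≤ x + z
    *-nonNegative   : ∀ {x y} → 0# ≤ x → 0# ≤ y → 0# ≤ x * y
    0≉1             : ¬ 0# ≈ 1#
    _⁻¹             : Carrier → Carrier
    ⁻¹-inverseʳ     : ∀ {x} → ¬ x ≈ 0# → x * x ⁻¹ ≈ 1#

  UpperBound : (Carrier → Set) → Carrier → Set
  UpperBound P b = ∀ x → P x → x ≤ b

  field
    sup       : (Carrier → Set) → Carrier
    sup-upper : ∀ P → ∃ P → ∃ (UpperBound P) → UpperBound P (sup P)
    sup-least : ∀ P → ∃ P → ∀ b → UpperBound P b → sup P ≤ b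

module BinPacking (ℝ : CompleteOrderedField) where

  open CompleteOrderedField ℝ public
    using (Carrier; _≈_; _+_; _*_; -_; 0#; 1#; _≤_; _⁻¹; sup)
  open CompleteOrderedField ℝ using (commutativeRing; isDecTotalOrder)

  private
    order : DecTotalOrder 0ℓ 0ℓ 0ℓ
    order = record { isDecTotalOrder = isDecTotalOrder }

  open DecTotalOrder order using (totalOrder; _≤?_) public
  open NonStrictToStrict _≈_ _≤_ using (_<_) public
  open NaturalMin totalOrder using (_⊓_) public
  open NaturalMax totalOrder using (_⊔_) public
  open RawSemiringOps (Semiring.rawSemiring (CommutativeRing.semiring commutativeRing))
    using (_^_; sum) renaming (_×_ to _times_) public

  infixl 7 _/_

  _/_ : Carrier → Carrier → Carrier
  x / y = x * y ⁻¹

  fromℕ : ℕ → Carrier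
  fromℕ n = n times 1#

  inf : (Carrier → Set) → Carrier
  inf P = - sup (λ x → P (- x))

  ⌈_⌉ : Carrier → Carrier
  ⌈ x ⌉ = inf (λ y → ∃[ m ] (y ≈ fromℕ m × x ≤ y))

  -- `⌈_⌉`, `sqrt` and `exp` are the usual functions on x ≥ 0, and `log` is the
  -- natural logarithm on x ≥ 1; outside these ranges the values mean nothing.

  sqrt : Carrier → Carrier
  sqrt x = sup (λ y → 0# ≤ y × y * y ≤ x)

  exp : Carrier → Carrier
  exp x = sup (λ y → ∃[ m ] y ≈ sum {m} (λ i → x ^ toℕ i / fromℕ (toℕ i !)))

  log : Carrier → Carrier
  log x = sup (λ y → 0# ≤ y × exp y ≤ x)

  total : {A : Set} → (A → Carrier) → List A → Carrier
  total f = foldr (λ a s → f a + s) 0#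

  ----------------------------------------------------------------------
  -- Static bin packing

  -- An online static algorithm: `pack σ w` names the bin receiving an item of
  -- size w.  A bin is opened when its name is used for the first time.
  record StaticAlgorithm : Set₁ where
    field
      State : Set
      Bin   : Set
      _≟_   : DecidableEquality Bin
      init  : State
      pack  : State → Carrier → State × Bin

    packAll : State → List Carrier → List Bin
    packAll σ []       = []
    packAll σ (w ∷ ws) = let σ′ , b = pack σ w in b ∷ packAll σ′ ws

    bins : List Carrier → ℕ
    bins ws = length (deduplicate _≟_ (packAll init ws))

  -- The name and the level of the active bin, once there is one.
  NFState : Set
  NFState = Maybe (ℕ × Carrier)

  nfPack : NFState → Carrier → NFState × ℕ
  nfPack nothing        w = just (0 , w) , 0
  nfPack (just (b , l)) w with l + w ≤? 1#
  ... | yes _ = just (b , l + w) , b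
  ... | no  _ = just (suc b , w) , suc b

  NextFit : StaticAlgorithm
  NextFit = record
    { State = NFState ; Bin = ℕ ; _≟_ = ℕ._≟_ ; init = nothing ; pack = nfPack }

  -- The largest j ≤ k with w ≤ 1/j: for w ∈ (0,1] this is the j < k with
  -- w ∈ (1/(j+1), 1/j], or k when w ∈ (0, 1/k].
  harmonicClass : ℕ → Carrier → ℕ
  harmonicClass zero    w = 0
  harmonicClass (suc k) w with w ≤? 1# / fromℕ (suc k)
  ... | yes _ = suc k
  ... | no  _ = harmonicClass k w

  update : {A : Set} → (ℕ → A) → ℕ → A → ℕ → A
  update f j a i with i ℕ.≟ j
  ... | yes _ = a
  ... | no  _ = f i

  Harmonic : ℕ → StaticAlgorithm
  Harmonic k = record
    { State = ℕ → NFState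
    ; Bin   = ℕ × ℕ
    ; _≟_   = Product.≡-dec ℕ._≟_ ℕ._≟_
    ; init  = λ _ → nothing
    ; pack  = λ σ w →
        let j     = harmonicClass k w
            s , b = nfPack (σ j) w
        in update σ j s , (j , b)
    }

  Packable : List Carrier → ℕ → Set
  Packable ws m = Σ (Fin (length ws) → Fin m) λ f → ∀ b →
    total (lookup ws) (filter (λ i → f i Fin.≟ b) (allFin (length ws))) ≤ 1#

  IsStaticOPT : List Carrier → ℕ → Set
  IsStaticOPT ws m = Packable ws m × (∀ m′ → Packable ws m′ → m ℕ.≤ m′)

  IsAsymptoticBound : StaticAlgorithm → Carrier → Set
  IsAsymptoticBound A ρ = ∃[ c ] (∀ ws → All (λ w → 0# < w × w ≤ 1#) ws →
    ∀ m → IsStaticOPT ws m → fromℕ (StaticAlgorithm.bins A ws) ≤ ρ * fromℕ m + c)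

  -- The least ρ for which some additive constant works.
  asymptoticRatio : StaticAlgorithm → Carrier
  asymptoticRatio A = inf (IsAsymptoticBound A)

  Π : ℕ → Carrier
  Π k = asymptoticRatio (Harmonic k)

  ----------------------------------------------------------------------
  -- Dynamic bin packing

  -- Intervals are numbered in the order in which they arrive; the order of
  -- simultaneous arrivals is arbitrary.
  record Instance : Set where
    field
      n T        : ℕ
      start end  : Fin n → ℕ
      size       : Fin n → Carrier
      start<end  : ∀ i → start i ℕ.< end i
      1≤start    : ∀ i → 1 ℕ.≤ start i
      end≤1+T    : ∀ i → end i ℕ.≤ suc T
      start-mono : ∀ {i j} → i Fin.≤ j → start i ℕ.≤ start j
      0<size     : ∀ i → 0# < size i
      size≤1     : ∀ i → size i ≤ 1#

    ActiveAt : ℕ → Fin n → Set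
    ActiveAt t i = start i ℕ.≤ t × t ℕ.< end i

    activeAt? : ∀ t i → Dec (ActiveAt t i)
    activeAt? t i = start i ℕ.≤? t ×-dec t ℕ.<? end i

    len : Fin n → ℕ
    len i = end i ∸ start i

    field
      busy       : ∀ t → 1 ℕ.≤ t → t ℕ.≤ T → ∃ (ActiveAt t)
      minLength  : ∃[ i ] len i ≡ 1

    steps : List ℕ
    steps = map suc (upTo T)

    μ : ℕ
    μ = Extrema.max 0 (map len (allFin n))

    load : ℕ → Carrier
    load t = total size (filter (activeAt? t) (allFin n))

    vAvg : Carrier
    vAvg = total (λ t → ⌈ load t ⌉) steps / fromℕ T

    -- Each interval paired with the name of its machine.
    Schedule : Set
    Schedule = List (Fin n × ℕ)

    activeTime : Schedule → ℕ → ℕ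
    activeTime S m = length (filter busy? steps)
      where
      busy? : ∀ t → Dec (Any.Any (λ p → proj₂ p ≡ m × ActiveAt t (proj₁ p)) S)
      busy? t = Any.any? (λ p → proj₂ p ℕ.≟ m ×-dec activeAt? t (proj₁ p)) S

    cost : Schedule → ℕ
    cost S = ℕ.sum (map (activeTime S) (deduplicate ℕ._≟_ (map proj₂ S)))

    schedule : (Fin n → ℕ) → Schedule
    schedule f = map (λ i → i , f i) (allFin n)

    Feasible : (Fin n → ℕ) → Set
    Feasible f = ∀ t m →
      total size (filter (λ i → f i ℕ.≟ m ×-dec activeAt? t i) (allFin n)) ≤ 1#

    IsOPT : ℕ → Set
    IsOPT c = (∃[ f ] (Feasible f × cost (schedule f) ≡ c))
            × (∀ f → Feasible f → c ℕ.≤ cost (schedule f))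

  ----------------------------------------------------------------------
  -- The Combined Algorithm

  ε : Carrier → ℕ → Carrier
  ε V j = 1# ⊓ (fromℕ j / V)

  q : Carrier → ℕ → Carrier
  q V j = 1# ⊓ sqrt (V / fromℕ j)

  -- ε V 1 + … + ε V j
  εSum : Carrier → ℕ → Carrier
  εSum V j = sum {j} (λ i → ε V (suc (toℕ i)))

  -- Since the exponents increase with j without bound, exactly one j satisfies
  -- `InClass V ℓ′ j`.
  InClass : Carrier → Carrier → ℕ → Set
  InClass V ℓ′ j = 1 ℕ.≤ j × exp (εSum V (j ∸ 1)) ≤ 1# ⊔ ℓ′ × 1# ⊔ ℓ′ < exp (εSum V j)

  -- V is the given average load; `class i` is the number j
  -- of the class c^j of interval i, as determined by `InClass`.
  module Combined (A : StaticAlgorithm) (I : Instance) (V : Carrier)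
                  (class : Fin (Instance.n I) → ℕ) where

    open Instance I
    open StaticAlgorithm A

    -- Which copy schedules an interval: `nothing` is the First-Fit copy,
    -- `just (j , b)` is the j-th copy of the dynamic non-clairvoyant
    -- algorithm, whose static algorithm packs the item into bin b.
    Origin : Set
    Origin = Maybe (ℕ × Bin)

    _≟ᵒ_ : DecidableEquality Origin
    _≟ᵒ_ = Maybe.≡-dec (Product.≡-dec ℕ._≟_ _≟_)

    -- A machine is named by the number of the interval for which it is
    -- opened.  So the order of names is the order of opening, different copies
    -- never share a machine, and a machine that was closed is never reopened.
    record Placed : Set where
      constructor placed
      field
        job     : Fin n
        origin  : Origin
        machine : ℕ
    open Placed

    record Configuration : Set where
      constructor configuration
      field
        static  : ℕ → State      -- of the j-th copy's static algorithm
        history : List Placed    -- most recent first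
    open Configuration

    step : Configuration → Fin n → Configuration
    step C i = decide (vⱼ ≤? q V j)
      where
      j     = class i
      fresh = toℕ i

      active : List Placed
      active = filter (activeAt? (start i) ∘ job) (history C)

      open-in : Origin → List Placed
      open-in o = filter (λ p → origin p ≟ᵒ o) active

      vⱼ : Carrier
      vⱼ = total (size ∘ job) (filter (λ p → class (job p) ℕ.≟ j) active) + size i

      level : ℕ → Carrier
      level m = total (size ∘ job) (filter (λ p → machine p ℕ.≟ m) active)

      -- `fresh` exceeds every name in use, so it is the minimum only if no
      -- open machine of this copy has enough free capacity.
      firstFit : ℕ
      firstFit = Extrema.min fresh
        (filter (λ m → level m + size i ≤? 1#) (map machine (open-in nothing)))

      -- The machine currently associated with the bin, if it is still open.
      machineOf : Bin → ℕ
      machineOf b = Maybe.fromMaybe fresh (head (map machine (open-in (just (j , b)))))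

      decide : Dec (vⱼ ≤ q V j) → Configuration
      decide (yes _) = configuration (static C) (placed i nothing firstFit ∷ history C)
      decide (no  _) =
        let σ , b = pack (static C j) (size i)
        in configuration (update (static C) j σ)
                         (placed i (just (j , b)) (machineOf b) ∷ history C)

    final : Configuration
    final = foldl step (configuration (λ _ → init) []) (allFin n)

    result : Schedule
    result = map (λ p → job p , machine p) (history final)

    totalCost : ℕ
    totalCost = cost result

  record Predicted (I : Instance) (δ α lam V : Carrier)
                   (ℓ′ : Fin (Instance.n I) → Carrier) : Set where
    open Instance I
    field
      V-lower : vAvg / (1# + δ) ≤ V
      V-upper : V ≤ vAvg * (1# + δ)
      ℓ-lower : ∀ i → fromℕ (len i) / (1# + α) ≤ ℓ′ i
      ℓ-upper : ∀ i → ℓ′ i ≤ fromℕ (len i) * (1# + lam)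

{-# OPTIONS --safe #-}
-- Let a(j) and b(j) be the least and the greatest true length in class j, and
-- B(j) the number of static bins opened by copy j.  A bin costs at most b(j)
-- after its last item arrives, and before that it is the active bin of its slot,
-- so copy j costs at most b(j) B(j) plus one machine per slot while it is busy.
-- The classes are so narrow that b(j) ≤ P (1 + 3 ε_j) a(j), where P is the
-- minimum of R = (1 + α)(1 + λ) and μ.  Offering every item of copy j during
-- a(j) steps of its interval makes each machine of an optimal schedule, at each
-- step, a bin of a static packing of a(j) repetitions of the item sequences of
-- all copies j; hence Σ a(j) B(j) ≤ Π_k OPT up to one bin per slot and
-- repetition.  For uniform sizes all closed bins are full, and comparing volumes
-- gives the factor 1.  First-Fit uses at most 1 + 4 Σ q_j machines at a time.
--
-- With J the largest class, s = ε_1 + … + ε_{J-1} and v the average load, every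
-- remaining term is O(k T P Y) for Y² = 2 (1 + δ) v (s + 1): if J ≤ V because
-- J² ≤ 2 V (s + 1), and otherwise because a class that reaches its copy has load
-- above q_j ≥ v / Y.  Finally e^s ≤ μ (1 + λ) gives P² (s + 1) ≤ 8 R² log μ; it
-- is the minimum with μ in P that absorbs the logarithm of 1 + λ.

module Submission where

open import Defs
open import Level using (0ℓ)
open import Algebra.Bundles using (CommutativeRing)
import Algebra.Properties.Monoid.Mult.TCOptimised as MultTCO
import Algebra.Properties.Ring as RingProperties
import Algebra.Properties.Semiring.Mult as SemiringMult
import Algebra.Solver.Ring.NaturalCoefficients.Default as NaturalSolver
open import Data.Fin.Base as Fin using (Fin; toℕ)
import Data.Fin.Properties as Fin
open import Data.List.Base
  using ( List; []; _∷_; _++_; allFin; applyUpTo; cartesianProduct; concat; concatMap; deduplicate; filter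
        ; foldl; foldr; head; length; lookup; map; replicate; tabulate; upTo)
import Data.List.Extrema.Nat as Extrema
open import Data.List.Membership.Propositional using (_∈_; find; lose)
open import Data.List.Membership.Propositional.Properties
import Data.List.Properties as List
open import Data.List.Relation.Unary.All as All using (All; []; _∷_)
import Data.List.Relation.Unary.All.Properties as All
open import Data.List.Relation.Unary.AllPairs using (AllPairs; []; _∷_)
import Data.List.Relation.Unary.AllPairs.Properties as AllPairs
open import Data.List.Relation.Unary.Any as Any using (Any; here; there)
import Data.List.Relation.Unary.Any.Properties as Any
open import Data.List.Relation.Unary.Unique.Propositional using (Unique)
import Data.List.Relation.Unary.Unique.DecPropositional.Properties as UniqueDec
import Data.List.Relation.Unary.Unique.Propositional.Properties as Unique
open import Data.Maybe.Base using (Maybe; just; nothing; fromMaybe)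
import Data.Maybe.Properties as Maybe
open import Data.Nat.Base as ℕ using (ℕ; zero; suc; _!; _∸_)
open import Data.Nat.Induction using (<-rec)
import Data.Nat.ListAction as ℕ
import Data.Nat.Properties as ℕ
open import Data.Product.Base using (Σ; ∃; ∃-syntax; _×_; _,_; proj₁; proj₂)
import Data.Product.Properties as Product
open import Data.Sum.Base using (_⊎_; inj₁; inj₂)
open import Function.Base using (_∘_; id)
open import Relation.Binary.Bundles using (DecTotalOrder)
open import Relation.Binary.Definitions using (DecidableEquality; tri<; tri≈; tri>)
open import Relation.Binary.PropositionalEquality as ≡ using (_≡_)
import Relation.Binary.Reasoning.PartialOrder as PartialOrderReasoning
open import Relation.Nullary.Decidable using (Dec; yes; no; _×-dec_)
open import Relation.Nullary.Negation using (¬_; contradiction)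

-- The copies cannot be compared with static optima class by class: optimal machines mix the
-- classes, so the optima of the classes may add up to more than OPT and the bound would degrade
-- with the number of classes. Hence one static instance for all copies, in which a class counts in
-- proportion to a(j). Moreover Π_k is an infimum of ratios with unspecified additive constants; a
-- further N repetitions, for arbitrarily large N, remove these.
--
-- The widening 3 ε_j of a class is kept away from OPT, since a product of the two would call for an
-- upper bound on OPT in terms of the load. It is multiplied with a crude count of the bins instead,
-- twice the volume plus one per slot: the volume is at most T v, and ε_J v ≤ Y.
--
-- The order is decidable, but the Archimedean property and the existence of a static optimum are
-- obtained under double negation. They serve only to prove inequalities, which are stable.

-- Arithmetic in a complete ordered field

module OrderedField (ℝ : CompleteOrderedField) where

  open BinPacking ℝ public renaming (q to threshold; ε to rate)
  open CompleteOrderedField ℝ public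
    using ( commutativeRing; isDecTotalOrder; +-monoʳ-≤; *-nonNegative; 0≉1; ⁻¹-inverseʳ
          ; sup-upper; sup-least; UpperBound; refl; sym; trans; reflexive
          ; +-cong; +-congˡ; +-congʳ; *-cong; *-congˡ; *-congʳ; -‿cong; +-comm; *-comm; +-assoc; *-assoc
          ; +-identityˡ; +-identityʳ; *-identityˡ; *-identityʳ; zeroˡ; zeroʳ; distribˡ; distribʳ
          ; -‿inverseˡ; -‿inverseʳ; ring; semiring; commutativeSemiring)

  open RingProperties ring public using (-‿distribˡ-*; -‿distribʳ-*; -‿involutive)

  module S = NaturalSolver commutativeSemiring
  open S public using (con; _:+_; _:*_; _:=_; solve)

  order : DecTotalOrder 0ℓ 0ℓ 0ℓ
  order = record { isDecTotalOrder = isDecTotalOrder }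

  open DecTotalOrder order public using (poset)
    renaming ( refl to ≤-refl; reflexive to ≤-reflexive; trans to ≤-trans
             ; antisym to ≤-antisym; total to ≤-total)

  module ≤R where
    open PartialOrderReasoning poset public hiding (start)

  2# 3# 4# : Carrier
  2# = 1# + 1#
  3# = 2# + 1#
  4# = 3# + 1#

  ≤-resp₂ : ∀ {a b c d} → a ≈ c → b ≈ d → a ≤ b → c ≤ d
  ≤-resp₂ p q r = ≤-trans (≤-reflexive (sym p)) (≤-trans r (≤-reflexive q))

  +-mono-≤ : ∀ {a b c d} → a ≤ b → c ≤ d → a + c ≤ b + d
  +-mono-≤ {a} {b} {c} {d} p q =
    ≤-trans (+-monoʳ-≤ a q) (≤-resp₂ (+-comm d a) (+-comm d b) (+-monoʳ-≤ d p))

  +-cancelˡ-≤ : ∀ x {y z} → x + y ≤ x + z → y ≤ z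
  +-cancelˡ-≤ x {y} {z} p = ≤-resp₂ (lem y) (lem z) (+-monoʳ-≤ (- x) p)
    where
    lem : ∀ y → - x + (x + y) ≈ y
    lem y = trans (sym (+-assoc _ _ _)) (trans (+-congʳ (-‿inverseˡ x)) (+-identityˡ y))

  +-cancelʳ-≤ : ∀ x {y z} → y + x ≤ z + x → y ≤ z
  +-cancelʳ-≤ x p = +-cancelˡ-≤ x (≤-resp₂ (+-comm _ _) (+-comm _ _) p)

  -- Linear arithmetic without subtraction: the hypothesis l ≤ r, transported
  -- along a semiring identity that the solver proves.
  by-adding : ∀ {a b l r} → l ≤ r → a + r ≈ b + l → a ≤ b
  by-adding {a} {b} {l} {r} p e =
    +-cancelʳ-≤ r (≤-trans (≤-reflexive e) (+-monoʳ-≤ b p))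

  0≤-minus : ∀ {x y} → x ≤ y → 0# ≤ y + - x
  0≤-minus {x} p = ≤-resp₂ (-‿inverseʳ x) refl
    (+-mono-≤ p (≤-refl { - x}))

  minus-+ : ∀ x y → (y + - x) + x ≈ y
  minus-+ x y = trans (+-assoc _ _ _) (trans (+-congˡ (-‿inverseˡ x)) (+-identityʳ y))

  *-monoˡ-≤ : ∀ {z x y} → 0# ≤ z → x ≤ y → z * x ≤ z * y
  *-monoˡ-≤ {z} {x} {y} p q = ≤-resp₂ (+-identityˡ _) e
    (+-mono-≤ (*-nonNegative p (0≤-minus q)) (≤-refl {z * x}))
    where
    e : z * (y + - x) + z * x ≈ z * y
    e = trans (sym (distribˡ _ _ _)) (*-congˡ (minus-+ x y))

  *-monoʳ-≤ : ∀ {z x y} → 0# ≤ z → x ≤ y → x * z ≤ y * z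
  *-monoʳ-≤ p q = ≤-resp₂ (*-comm _ _) (*-comm _ _) (*-monoˡ-≤ p q)

  *-mono-≤ : ∀ {a b c d} → 0# ≤ a → a ≤ b → 0# ≤ c → c ≤ d → a * c ≤ b * d
  *-mono-≤ pa p pc q = ≤-trans (*-monoʳ-≤ pc p) (*-monoˡ-≤ (≤-trans pa p) q)

  0≤-sq : ∀ x → 0# ≤ x * x
  0≤-sq x with ≤-total 0# x
  ... | inj₁ p = *-nonNegative p p
  ... | inj₂ p = ≤-resp₂ refl e (*-nonNegative q q)
    where
    q : 0# ≤ - x
    q = ≤-resp₂ refl (+-identityˡ _) (0≤-minus p)
    e : - x * - x ≈ x * x
    e = trans (sym (-‿distribˡ-* x (- x)))
          (trans (-‿cong (sym (-‿distribʳ-* x x))) (-‿involutive _))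

  0≤1 : 0# ≤ 1#
  0≤1 = ≤-resp₂ refl (*-identityˡ 1#) (0≤-sq 1#)

  +-nonNegative : ∀ {x y} → 0# ≤ x → 0# ≤ y → 0# ≤ x + y
  +-nonNegative p q = ≤-resp₂ (+-identityˡ _) refl (+-mono-≤ p q)

  x≤x+y : ∀ {x y} → 0# ≤ y → x ≤ x + y
  x≤x+y p = ≤-resp₂ (+-identityʳ _) refl (+-mono-≤ ≤-refl p)

  x≤y+x : ∀ {x y} → 0# ≤ y → x ≤ y + x
  x≤y+x p = ≤-resp₂ (+-identityˡ _) refl (+-mono-≤ p ≤-refl)

  1≤1+ : ∀ {x} → 0# ≤ x → 1# ≤ 1# + x
  1≤1+ = x≤x+y

  ≰⇒≥ : ∀ {x y} → ¬ x ≤ y → y ≤ x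
  ≰⇒≥ {x} {y} n with ≤-total x y
  ... | inj₁ p = contradiction p n
  ... | inj₂ p = p

  ≤-stable : ∀ {x y} → ¬ ¬ x ≤ y → x ≤ y
  ≤-stable {x} {y} nn with x ≤? y
  ... | yes p = p
  ... | no n = contradiction n nn

  <⇒≱ : ∀ {x y} → x < y → ¬ y ≤ x
  <⇒≱ (p , n) q = n (≤-antisym p q)

  ≰⇒> : ∀ {x y} → ¬ x ≤ y → y < x
  ≰⇒> n = ≰⇒≥ n , λ e → n (≤-reflexive (sym e))

  1≰0 : ¬ 1# ≤ 0#
  1≰0 p = 0≉1 (≤-antisym 0≤1 p)

  -- Strict positivity is expressed throughout as `¬ x ≤ 0#`: it comes directly from a failed
  -- comparison and, by this lemma, licenses division.
  >⇒≉0 : ∀ {x} → ¬ x ≤ 0# → ¬ x ≈ 0#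
  >⇒≉0 n e = n (≤-reflexive e)

  ≥1⇒≰0 : ∀ {x} → 1# ≤ x → ¬ x ≤ 0#
  ≥1⇒≰0 p q = 1≰0 (≤-trans p q)

  +-≰0 : ∀ {x y} → ¬ x ≤ 0# → 0# ≤ y → ¬ x + y ≤ 0#
  +-≰0 n p q = n (≤-trans (x≤x+y p) q)

  *⁻¹ : ∀ {x} → ¬ x ≤ 0# → x * x ⁻¹ ≈ 1#
  *⁻¹ n = ⁻¹-inverseʳ (>⇒≉0 n)

  ⁻¹-nonNegative : ∀ {x} → ¬ x ≤ 0# → 0# ≤ x ⁻¹
  ⁻¹-nonNegative {x} n with ≤-total 0# (x ⁻¹)
  ... | inj₁ p = p
  ... | inj₂ p = contradiction
    (≤-resp₂ (*⁻¹ n) (zeroʳ x) (*-monoˡ-≤ (≰⇒≥ n) p)) 1≰0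

  ⁻¹-≰0 : ∀ {x} → ¬ x ≤ 0# → ¬ x ⁻¹ ≤ 0#
  ⁻¹-≰0 {x} n p = 1≰0 (≤-resp₂ (*⁻¹ n) (zeroʳ x) (*-monoˡ-≤ (≰⇒≥ n) p))

  *-cancelˡ-≤ : ∀ {z x y} → ¬ z ≤ 0# → z * x ≤ z * y → x ≤ y
  *-cancelˡ-≤ {z} {x} {y} n p = ≤-resp₂ (e x) (e y) (*-monoˡ-≤ (⁻¹-nonNegative n) p)
    where
    e : ∀ x → z ⁻¹ * (z * x) ≈ x
    e x = trans (sym (*-assoc _ _ _))
      (trans (*-congʳ (trans (*-comm _ _) (*⁻¹ n))) (*-identityˡ x))

  *-≰0 : ∀ {x y} → ¬ x ≤ 0# → ¬ y ≤ 0# → ¬ x * y ≤ 0#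
  *-≰0 {x} {y} p q r = q (*-cancelˡ-≤ p (≤-resp₂ refl (sym (zeroʳ x)) r))

  /-* : ∀ {y} x → ¬ y ≤ 0# → (x / y) * y ≈ x
  /-* {y} x n = trans (*-assoc _ _ _)
    (trans (*-congˡ (trans (*-comm _ _) (*⁻¹ n))) (*-identityʳ x))

  /-nonNegative : ∀ {x y} → 0# ≤ x → ¬ y ≤ 0# → 0# ≤ x / y
  /-nonNegative p n = *-nonNegative p (⁻¹-nonNegative n)

  ≤/ : ∀ {x y z} → ¬ y ≤ 0# → x * y ≤ z → x ≤ z / y
  ≤/ {x} {y} {z} n p = *-cancelˡ-≤ n
    (≤-resp₂ (*-comm _ _) (trans (sym (/-* z n)) (*-comm _ _)) p)

  /≤ : ∀ {x y z} → ¬ y ≤ 0# → x ≤ z * y → x / y ≤ z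
  /≤ {x} {y} {z} n p = *-cancelˡ-≤ n
    (≤-resp₂ (trans (sym (/-* x n)) (*-comm _ _)) (*-comm _ _) p)

  /≤⁻ : ∀ {x y z} → ¬ y ≤ 0# → x / y ≤ z → x ≤ z * y
  /≤⁻ {x} {y} {z} n p = ≤-resp₂ (/-* x n) refl (*-monoʳ-≤ (≰⇒≥ n) p)

  ≤/⁻ : ∀ {x y z} → ¬ y ≤ 0# → x ≤ z / y → x * y ≤ z
  ≤/⁻ {x} {y} {z} n p = ≤-resp₂ refl (/-* z n) (*-monoʳ-≤ (≰⇒≥ n) p)

  sq-cancel-≤ : ∀ {x y} → 0# ≤ y → x * x ≤ y * y → x ≤ y
  sq-cancel-≤ {x} {y} p q with x ≤? y
  ... | yes r = r
  ... | no n = contradiction d²≤0 (*-≰0 d≰0 d≰0)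
    where
    d = x + - y
    d≰0 : ¬ d ≤ 0#
    d≰0 r = n (≤-resp₂ (minus-+ y x) (+-identityˡ y) (+-mono-≤ r (≤-refl {y})))
    x≈ : x ≈ d + y
    x≈ = sym (minus-+ y x)
    -- With x = d + y the hypothesis reads d² + 2 d y ≤ 0, and 2 d y is nonnegative.
    d²≤0 : d * d ≤ 0#
    d²≤0 = by-adding (+-mono-≤ (≤-resp₂ (*-cong x≈ x≈) refl q)
                  (*-nonNegative (*-nonNegative (≰⇒≥ d≰0) p) (+-nonNegative 0≤1 0≤1)))
        (solve 2 (λ d y → d :* d :+ (y :* y :+ d :* y :* con 2)
           := con 0 :+ ((d :+ y) :* (d :+ y) :+ con 0)) refl d y)

  ⊓≤ˡ : ∀ x y → x ⊓ y ≤ x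
  ⊓≤ˡ x y with ≤-total x y
  ... | inj₁ _ = ≤-refl
  ... | inj₂ p = p

  ⊓≤ʳ : ∀ x y → x ⊓ y ≤ y
  ⊓≤ʳ x y with ≤-total x y
  ... | inj₁ p = p
  ... | inj₂ _ = ≤-refl

  ⊓-glb : ∀ {x y z} → z ≤ x → z ≤ y → z ≤ x ⊓ y
  ⊓-glb {x} {y} p q with ≤-total x y
  ... | inj₁ _ = p
  ... | inj₂ _ = q

  ≤⊔ʳ : ∀ x y → y ≤ x ⊔ y
  ≤⊔ʳ x y with ≤-total y x
  ... | inj₁ p = p
  ... | inj₂ _ = ≤-refl

  ⊔-lub : ∀ {x y z} → x ≤ z → y ≤ z → x ⊔ y ≤ z
  ⊔-lub {x} {y} p q with ≤-total y x
  ... | inj₁ _ = p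
  ... | inj₂ _ = q

  open SemiringMult semiring using (×-homo-+; ×1-homo-*)

  fromℕ-+ : ∀ m n → fromℕ (m ℕ.+ n) ≈ fromℕ m + fromℕ n
  fromℕ-+ m n = ×-homo-+ 1# m n

  fromℕ-* : ∀ m n → fromℕ (m ℕ.* n) ≈ fromℕ m * fromℕ n
  fromℕ-* m n = ×1-homo-* m n

  0≤fromℕ : ∀ n → 0# ≤ fromℕ n
  0≤fromℕ zero    = ≤-refl
  0≤fromℕ (suc n) = +-nonNegative 0≤1 (0≤fromℕ n)

  fromℕ-mono : ∀ {m n} → m ℕ.≤ n → fromℕ m ≤ fromℕ n
  fromℕ-mono {n = n} ℕ.z≤n = 0≤fromℕ n
  fromℕ-mono (ℕ.s≤s p) = +-monoʳ-≤ 1# (fromℕ-mono p)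

  fromℕ-suc≰0 : ∀ n → ¬ fromℕ (suc n) ≤ 0#
  fromℕ-suc≰0 n = ≥1⇒≰0 (1≤1+ (0≤fromℕ n))

  1≤fromℕ : ∀ {n} → 1 ℕ.≤ n → 1# ≤ fromℕ n
  1≤fromℕ p = ≤-resp₂ (+-identityʳ 1#) refl (fromℕ-mono p)

  1≤⇒≰0 : ∀ {n} → 1 ℕ.≤ n → ¬ fromℕ n ≤ 0#
  1≤⇒≰0 p = ≥1⇒≰0 (1≤fromℕ p)

  -- If ℕ were bounded by x, then sup ℕ − 1 would be a smaller upper bound.
  archimedean : ∀ x → ¬ (∀ n → fromℕ n ≤ x)
  archimedean x bnd = 1≰0 (by-adding s+1≤s
      (solve 1 (λ s → con 1 :+ s := con 0 :+ (s :+ con 1)) refl s))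
    where
    N : Carrier → Set
    N y = ∃[ n ] y ≈ fromℕ n
    s = sup N
    up : ∀ n → fromℕ n ≤ s
    up n = sup-upper N (0# , 0 , refl)
      (x , λ { y (m , e) → ≤-trans (≤-reflexive e) (bnd m) }) (fromℕ n) (n , refl)
    s+1≤s : s + 1# ≤ s
    s+1≤s = ≤-resp₂ refl (minus-+ 1# s) (+-mono-≤ (sup-least N (0# , 0 , refl) (s + - 1#) ub) (≤-refl {1#}))
      where
      ub : ∀ y → N y → y ≤ s + - 1#
      ub y (m , e) = by-adding (up (suc m)) (trans (+-congʳ e) (trans
        (+-cong refl (sym (minus-+ 1# s)))
        (solve 2 (λ y z → y :+ (z :+ con 1) := z :+ (con 1 :+ y)) refl (fromℕ m) (s + - 1#))))

  archimedean′ : ∀ x → ¬ ¬ (∃[ n ] x ≤ fromℕ n)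
  archimedean′ x n = archimedean x λ m → ≰⇒≥ λ p → n (m , p)

-- Exponential, logarithm, square root and ceiling

module RealFunctions (ℝ : CompleteOrderedField) where

  open OrderedField ℝ public

  ∑< : ℕ → (ℕ → Carrier) → Carrier
  ∑< n g = sum {n} (λ i → g (toℕ i))

  ∑<-last : ∀ n g → ∑< (suc n) g ≈ ∑< n g + g n
  ∑<-last zero    g = +-comm _ _
  ∑<-last (suc n) g = trans (+-congˡ (∑<-last n (g ∘ suc))) (sym (+-assoc _ _ _))

  ∑<-nonNegative : ∀ n {g} → (∀ i → 0# ≤ g i) → 0# ≤ ∑< n g
  ∑<-nonNegative zero    h = ≤-refl
  ∑<-nonNegative (suc n) h = +-nonNegative (h 0) (∑<-nonNegative n (h ∘ suc))

  ^-nonNegative : ∀ {x} → 0# ≤ x → ∀ n → 0# ≤ x ^ n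
  ^-nonNegative p zero    = 0≤1
  ^-nonNegative p (suc n) = *-nonNegative p (^-nonNegative p n)

  ^-mono : ∀ {x y} → 0# ≤ x → x ≤ y → ∀ n → x ^ n ≤ y ^ n
  ^-mono p q zero    = ≤-refl
  ^-mono p q (suc n) = *-mono-≤ p q (^-nonNegative p n) (^-mono p q n)

  !≰0 : ∀ n → ¬ fromℕ (n !) ≤ 0#
  !≰0 n = 1≤⇒≰0 (ℕ.1≤n! n)

  term : ℕ → Carrier → Carrier
  term i x = x ^ i / fromℕ (i !)

  term-nonNegative : ∀ {x} → 0# ≤ x → ∀ i → 0# ≤ term i x
  term-nonNegative p i = /-nonNegative (^-nonNegative p i) (!≰0 i)

  !⁻¹-suc : ∀ i → fromℕ (suc i) * fromℕ (suc i !) ⁻¹ ≈ fromℕ (i !) ⁻¹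
  !⁻¹-suc i = begin-equality
    c * g                ≈⟨ sym (*-identityʳ _) ⟩
    c * g * 1#           ≈⟨ *-congˡ (sym (*⁻¹ (!≰0 i))) ⟩
    c * g * (d * f)      ≈⟨ solve 4 (λ c g d f → c :* g :* (d :* f) := c :* d :* g :* f) refl c g d f ⟩
    c * d * g * f        ≈⟨ *-congʳ (*-congʳ (sym (fromℕ-* (suc i) (i !)))) ⟩
    fromℕ (suc i !) * g * f ≈⟨ *-congʳ (*⁻¹ (!≰0 (suc i))) ⟩
    1# * f               ≈⟨ *-identityˡ f ⟩
    f ∎
    where
    open ≤R
    c = fromℕ (suc i)
    d = fromℕ (i !)
    f = fromℕ (i !) ⁻¹
    g = fromℕ (suc i !) ⁻¹

  module _ {x e : Carrier} (0≤x : 0# ≤ x) (0≤e : 0# ≤ e) where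

    private
      z = x + e
      x≤z : x ≤ z
      x≤z = x≤x+y 0≤e
      0≤z : 0# ≤ z
      0≤z = +-nonNegative 0≤x 0≤e

    -- Mean value bounds: the increment of a power over a step `e` is at most `e` times the
    -- derivative at the right end and, in `power-lower`, at least `e` times the derivative at the
    -- left end. The growth estimates for `exp` come from these two, in place of the functional
    -- equation.
    power-upper : ∀ i → z ^ suc i ≤ x ^ suc i + fromℕ (suc i) * (e * z ^ i)
    power-upper zero = ≤-reflexive
      (solve 2 (λ x e → (x :+ e) :* con 1 := x :* con 1 :+ (con 1 :+ con 0) :* (e :* con 1)) refl x e)
    power-upper (suc i) = by-adding
      (+-mono-≤ (*-monoˡ-≤ 0≤x (power-upper i))
                (*-monoʳ-≤ (*-nonNegative (0≤fromℕ (suc i)) (*-nonNegative 0≤e (^-nonNegative 0≤z i))) x≤z))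
      (solve 5 (λ x e X W c → (x :+ e) :* ((x :+ e) :* W) :+ (x :* (X :+ c :* (e :* W)) :+ (x :+ e) :* (c :* (e :* W)))
          := (x :* X :+ (con 1 :+ c) :* (e :* ((x :+ e) :* W))) :+ (x :* ((x :+ e) :* W) :+ x :* (c :* (e :* W))))
        refl x e (x ^ suc i) (z ^ i) (fromℕ (suc i)))

    power-lower : ∀ i → x ^ suc i + fromℕ (suc i) * (e * x ^ i) ≤ z ^ suc i
    power-lower zero = ≤-reflexive
      (solve 2 (λ x e → x :* con 1 :+ (con 1 :+ con 0) :* (e :* con 1) := (x :+ e) :* con 1) refl x e)
    power-lower (suc i) = by-adding
      (+-mono-≤ (*-monoˡ-≤ 0≤z (power-lower i))
                (*-nonNegative 0≤e (*-nonNegative (0≤fromℕ (suc i)) (*-nonNegative 0≤e (^-nonNegative 0≤x i)))))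
      (solve 5 (λ x e Z W c → (x :* (x :* W) :+ (con 1 :+ c) :* (e :* (x :* W)))
            :+ ((x :+ e) :* Z :+ e :* (c :* (e :* W)))
          := (x :+ e) :* Z :+ ((x :+ e) :* (x :* W :+ c :* (e :* W)) :+ con 0))
        refl x e (z ^ suc i) (x ^ i) (fromℕ (suc i)))

    private
      scale : ∀ i w → (fromℕ (suc i) * (e * w)) * fromℕ (suc i !) ⁻¹ ≈ e * (w / fromℕ (i !))
      scale i w = trans
        (solve 4 (λ c e w g → (c :* (e :* w)) :* g := e :* (w :* (c :* g))) refl (fromℕ (suc i)) e w (fromℕ (suc i !) ⁻¹))
        (*-congˡ (*-congˡ (!⁻¹-suc i)))

    term-upper : ∀ i → term (suc i) z ≤ term (suc i) x + e * term i z
    term-upper i = ≤-resp₂ refl (trans (distribʳ _ _ _) (+-congˡ (scale i (z ^ i))))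
      (*-monoʳ-≤ (⁻¹-nonNegative (!≰0 (suc i))) (power-upper i))

    term-lower : ∀ i → term (suc i) x + e * term i x ≤ term (suc i) z
    term-lower i = ≤-resp₂ (trans (distribʳ _ _ _) (+-congˡ (scale i (x ^ i)))) refl
      (*-monoʳ-≤ (⁻¹-nonNegative (!≰0 (suc i))) (power-lower i))

  expSum : ℕ → Carrier → Carrier
  expSum m x = ∑< m (λ i → term i x)

  expSum-last : ∀ m x → expSum (suc m) x ≈ expSum m x + term m x
  expSum-last m x = ∑<-last m (λ i → term i x)

  expSum-≤suc : ∀ m {x} → 0# ≤ x → expSum m x ≤ expSum (suc m) x
  expSum-≤suc m {x} p = ≤-resp₂ refl (sym (expSum-last m x)) (x≤x+y (term-nonNegative p m))

  expSum-mono : ∀ m {x y} → 0# ≤ x → x ≤ y → expSum m x ≤ expSum m y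
  expSum-mono zero p q = ≤-refl
  expSum-mono (suc m) {x} {y} p q = ≤-resp₂ (sym (expSum-last m x)) (sym (expSum-last m y))
    (+-mono-≤ (expSum-mono m p q) (*-monoʳ-≤ (⁻¹-nonNegative (!≰0 m)) (^-mono p q m)))

  expSum-1 : ∀ x → expSum 1 x ≈ 1#
  expSum-1 x = trans (+-identityʳ _) (trans (*-congʳ (sym (+-identityʳ 1#))) (*⁻¹ (!≰0 0)))

  module _ {x e : Carrier} (0≤x : 0# ≤ x) (0≤e : 0# ≤ e) where

    expSum-upper : ∀ m → expSum (suc m) (x + e) ≤ expSum (suc m) x + e * expSum m (x + e)
    expSum-upper zero = ≤-reflexive (trans (expSum-1 (x + e)) (trans (sym (expSum-1 x))
      (sym (trans (+-congˡ (zeroʳ e)) (+-identityʳ _)))))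
    expSum-upper (suc m) = ≤-resp₂ (sym (expSum-last (suc m) _))
      (trans (solve 5 (λ A B e C D → (A :+ e :* B) :+ (C :+ e :* D) := (A :+ C) :+ e :* (B :+ D)) refl _ _ _ _ _)
        (sym (+-cong (expSum-last (suc m) _) (*-congˡ (expSum-last m _)))))
      (+-mono-≤ (expSum-upper m) (term-upper 0≤x 0≤e m))

    expSum-lower : ∀ m → expSum (suc m) x + e * expSum m x ≤ expSum (suc m) (x + e)
    expSum-lower zero = ≤-reflexive (trans (trans (+-congˡ (zeroʳ e)) (+-identityʳ _))
      (trans (expSum-1 x) (sym (expSum-1 (x + e)))))
    expSum-lower (suc m) = ≤-resp₂
      (trans (solve 5 (λ A B e C D → (A :+ e :* B) :+ (C :+ e :* D) := (A :+ C) :+ e :* (B :+ D)) refl _ _ _ _ _)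
        (sym (+-cong (expSum-last (suc m) _) (*-congˡ (expSum-last m _)))))
      (sym (expSum-last (suc m) _))
      (+-mono-≤ (expSum-lower m) (term-lower 0≤x 0≤e m))

  6# 8# : Carrier
  6# = 4# + 1# + 1#
  8# = 6# + 1# + 1#

  2≰0 : ¬ 2# ≤ 0#
  2≰0 = ≥1⇒≰0 (x≤x+y 0≤1)

  6≰0 : ¬ 6# ≤ 0#
  6≰0 = +-≰0 (+-≰0 (+-≰0 (+-≰0 2≰0 0≤1) 0≤1) 0≤1) 0≤1

  0≤2 : 0# ≤ 2#
  0≤2 = ≰⇒≥ 2≰0

  0≤3 : 0# ≤ 3#
  0≤3 = +-nonNegative 0≤2 0≤1

  0≤4 : 0# ≤ 4#
  0≤4 = +-nonNegative 0≤3 0≤1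

  0≤6 : 0# ≤ 6#
  0≤6 = ≰⇒≥ 6≰0

  0≤8 : 0# ≤ 8#
  0≤8 = +-nonNegative (+-nonNegative 0≤6 0≤1) 0≤1

  ½ : Carrier
  ½ = 1# / 2#

  0≤½ : 0# ≤ ½
  0≤½ = /-nonNegative 0≤1 2≰0

  ½+½ : ½ + ½ ≈ 1#
  ½+½ = trans (solve 1 (λ h → h :+ h := h :* con 2) refl ½) (/-* 1# 2≰0)

  -- For an increment of one half, `expSum-upper` has half of its left-hand side on the right.
  -- Absorbing it shows that such a step at most doubles a partial sum, which is how
  -- `expSum-bounded` arrives at a power of two.
  expSum-½ : ∀ m {x} → 0# ≤ x → expSum m (x + ½) ≤ 2# * expSum m x
  expSum-½ zero p = ≤-reflexive (sym (zeroʳ _))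
  expSum-½ (suc m) {x} p = by-adding
      (+-mono-≤ h h)
      (trans (solve 3 (λ A B t → A :+ ((B :+ t) :+ (B :+ t)) := (con 2 :* B) :+ (A :+ (t :+ t))) refl A B t)
        (+-congˡ (+-congˡ t+t)))
    where
    A = expSum (suc m) (x + ½)
    B = expSum (suc m) x
    t = ½ * A
    t+t : t + t ≈ A
    t+t = trans (sym (distribʳ A ½ ½)) (trans (*-congʳ ½+½) (*-identityˡ A))
    h : A ≤ B + t
    h = ≤-trans (expSum-upper p 0≤½ m)
      (+-monoʳ-≤ B (*-monoˡ-≤ 0≤½ (expSum-≤suc m (+-nonNegative p 0≤½))))

  expSum-0 : ∀ m → expSum m 0# ≤ 1#
  expSum-0 zero = 0≤1
  expSum-0 (suc zero) = ≤-reflexive (expSum-1 0#)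
  expSum-0 (suc (suc m)) = ≤-trans (≤-reflexive (trans (expSum-last (suc m) 0#)
    (trans (+-congˡ (trans (*-congʳ (zeroˡ _)) (zeroˡ _))) (+-identityʳ _)))) (expSum-0 (suc m))

  expSum-bounded : ∀ N m → expSum m (fromℕ N * ½) ≤ 2# ^ N
  expSum-bounded zero m = ≤-trans (expSum-mono m (≤-reflexive (sym (zeroˡ ½))) (≤-reflexive (zeroˡ ½))) (expSum-0 m)
  expSum-bounded (suc N) m = ≤-trans
    (≤-trans (expSum-mono m (*-nonNegative (0≤fromℕ (suc N)) 0≤½)
        (≤-reflexive (solve 2 (λ n h → (con 1 :+ n) :* h := n :* h :+ h) refl (fromℕ N) ½)))
      (expSum-½ m (*-nonNegative (0≤fromℕ N) 0≤½)))
    (*-monoˡ-≤ 0≤2 (expSum-bounded N m))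

  private
    ExpSet : Carrier → Carrier → Set
    ExpSet x y = ∃[ m ] y ≈ expSum m x

    -- Boundedness of the partial sums needs the Archimedean property, which
    -- is only available up to double negation.
    withBound : ∀ {x a b} → 0# ≤ x → (∃ (UpperBound (ExpSet x)) → a ≤ b) → a ≤ b
    withBound {x} p k = ≤-stable λ n → archimedean′ (x * 2#) λ { (N , r) → n (k (2# ^ N , bound N r)) }
      where
      bound : ∀ N → x * 2# ≤ fromℕ N → UpperBound (ExpSet x) (2# ^ N)
      bound N r y (m , e) = ≤-trans (≤-reflexive e)
        (≤-trans (expSum-mono m p (≤-trans (≤-reflexive x≈) (*-monoʳ-≤ 0≤½ r))) (expSum-bounded N m))
        where
        x≈ : x ≈ x * 2# * ½
        x≈ = trans (sym (*-identityʳ x)) (trans (*-congˡ (trans (sym (*⁻¹ 2≰0))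
          (*-congˡ (sym (*-identityˡ _))))) (sym (*-assoc _ _ _)))

  expSum≤exp : ∀ {x} → 0# ≤ x → ∀ m → expSum m x ≤ exp x
  expSum≤exp {x} p m = withBound p λ b →
    sup-upper (ExpSet x) (expSum 0 x , 0 , refl) b (expSum m x) (m , refl)

  exp-least : ∀ {x b} → (∀ m → expSum m x ≤ b) → exp x ≤ b
  exp-least {x} {b} h = sup-least (ExpSet x) (expSum 0 x , 0 , refl) b
    λ { y (m , e) → ≤-trans (≤-reflexive e) (h m) }

  exp-mono : ∀ {x y} → 0# ≤ x → x ≤ y → exp x ≤ exp y
  exp-mono p r = exp-least λ m → ≤-trans (expSum-mono m p r) (expSum≤exp (≤-trans p r) m)

  1≤exp : ∀ {x} → 0# ≤ x → 1# ≤ exp x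
  1≤exp {x} p = ≤-trans (≤-reflexive (sym (expSum-1 x))) (expSum≤exp p 1)

  0≤exp : ∀ {x} → 0# ≤ x → 0# ≤ exp x
  0≤exp p = ≤-trans 0≤1 (1≤exp p)

  exp-0 : exp 0# ≤ 1#
  exp-0 = exp-least expSum-0

  -- One further term of the series on the right pays for the factor 1 + e on the left; dividing by
  -- that factor lets the supremum be taken.
  exp-+-lower : ∀ {x e} → 0# ≤ x → 0# ≤ e → exp x * (1# + e) ≤ exp (x + e)
  exp-+-lower {x} {e} p r =
    ≤/⁻ n (exp-least λ m → ≤/ n (≤-trans (step m) (expSum≤exp (+-nonNegative p r) (suc m))))
    where
    n : ¬ 1# + e ≤ 0#
    n = ≥1⇒≰0 (1≤1+ r)
    step : ∀ m → expSum m x * (1# + e) ≤ expSum (suc m) (x + e)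
    step m = ≤-trans (≤-trans
      (≤-reflexive (solve 2 (λ A e → A :* (con 1 :+ e) := A :+ e :* A) refl (expSum m x) e))
      (+-mono-≤ (expSum-≤suc m p) ≤-refl)) (expSum-lower p r m)

  1+x≤exp : ∀ {x} → 0# ≤ x → 1# + x ≤ exp x
  1+x≤exp {x} p = ≤-trans (≤-trans (≤-reflexive (sym (*-identityˡ _)))
      (*-monoʳ-≤ (+-nonNegative 0≤1 p) (1≤exp ≤-refl)))
    (≤-trans (exp-+-lower ≤-refl p) (exp-mono (+-nonNegative ≤-refl p) (≤-reflexive (+-identityˡ x))))

  -- `expSum-upper` in the limit. The unknown value stands on both sides; the next lemma solves for
  -- it.
  exp-+-self : ∀ {x e} → 0# ≤ x → 0# ≤ e → exp (x + e) ≤ exp x + e * exp (x + e)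
  exp-+-self {x} {e} p r = exp-least λ m →
    ≤-trans (expSum-≤suc m s) (≤-trans (expSum-upper p r m)
      (+-mono-≤ (expSum≤exp p (suc m)) (*-monoˡ-≤ r (expSum≤exp s m))))
    where s = +-nonNegative p r

  -- (1 - e)(1 + 2e) ≥ 1 when e ≤ 1/2.
  exp-+-upper½ : ∀ {x e} → 0# ≤ x → 0# ≤ e → e ≤ ½ → exp (x + e) ≤ exp x * (1# + 2# * e)
  exp-+-upper½ {x} {e} p r h = by-adding
      (+-mono-≤ (*-monoʳ-≤ (+-nonNegative 0≤1 (+-nonNegative r r)) (exp-+-self p r))
        (*-monoʳ-≤ (*-nonNegative r (0≤exp (+-nonNegative p r))) e+e≤1))
      (solve 3 (λ X Z e → Z :+ ((X :+ e :* Z) :* (con 1 :+ (e :+ e)) :+ con 1 :* (e :* Z))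
        := X :* (con 1 :+ con 2 :* e) :+ (Z :* (con 1 :+ (e :+ e)) :+ (e :+ e) :* (e :* Z))) refl (exp x) (exp (x + e)) e)
    where
    e+e≤1 : e + e ≤ 1#
    e+e≤1 = ≤-resp₂ refl ½+½ (+-mono-≤ h h)

  ½*2 : ∀ x → x * ½ + x * ½ ≈ x
  ½*2 x = trans (sym (distribˡ x ½ ½)) (trans (*-congˡ ½+½) (*-identityʳ x))

  -- Two steps of length h = e / 2, where (1 + 2h)² = 1 + 4h + 4h² ≤ 1 + 6h because h ≤ 1/2. This is
  -- the origin of the 3 in the widening 1 + 3 ε_j.
  exp-+-upper : ∀ {x e} → 0# ≤ x → 0# ≤ e → e ≤ 1# → exp (x + e) ≤ exp x * (1# + 3# * e)
  exp-+-upper {x} {e} p r e≤1 = begin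
      exp (x + e)                 ≤⟨ exp-mono (+-nonNegative p r) (≤-reflexive (trans (+-congˡ (sym (½*2 e))) (sym (+-assoc x h h)))) ⟩
      exp ((x + h) + h)           ≤⟨ exp-+-upper½ (+-nonNegative p 0≤h) 0≤h h≤½ ⟩
      exp (x + h) * (1# + 2# * h) ≤⟨ *-monoʳ-≤ (+-nonNegative 0≤1 (*-nonNegative 0≤2 0≤h)) (exp-+-upper½ p 0≤h h≤½) ⟩
      exp x * (1# + 2# * h) * (1# + 2# * h) ≤⟨ by-adding
          (*-monoˡ-≤ (*-nonNegative (0≤exp p) (+-nonNegative 0≤h 0≤h)) (+-mono-≤ h≤½ h≤½))
          (solve 3 (λ X h k → X :* (con 1 :+ con 2 :* h) :* (con 1 :+ con 2 :* h) :+ X :* (h :+ h) :* k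
            := X :* (con 1 :+ (con 4 :* h :+ (h :+ h) :* k)) :+ X :* (h :+ h) :* (h :+ h)) refl (exp x) h (½ + ½)) ⟩
      exp x * (1# + (4# * h + (h + h) * (½ + ½))) ≈⟨ *-congˡ (+-congˡ (trans (+-congˡ (trans (*-congˡ ½+½) (*-identityʳ _)))
          (trans (solve 1 (λ h → con 4 :* h :+ (h :+ h) := con 3 :* (h :+ h)) refl h) (*-congˡ (½*2 e))))) ⟩
      exp x * (1# + 3# * e) ∎
    where
    open ≤R
    h = e * ½
    0≤h : 0# ≤ h
    0≤h = *-nonNegative r 0≤½
    h≤½ : h ≤ ½
    h≤½ = ≤-trans (*-monoʳ-≤ 0≤½ e≤1) (≤-reflexive (*-identityˡ ½))

  private
    -- A weak form of (exp y)² = exp 2y, built from steps of length e ≤ 1. Each factor on the left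
    -- grows by at most 1 + 3e, while on the right a factor 1 + 3e is gained over a stretch of
    -- length 3e; two of these make 6e.
    exp-sq-step : ∀ {x e} → 0# ≤ x → 0# ≤ e → e ≤ 1# → exp x * exp x ≤ exp (6# * x) →
                  exp (x + e) * exp (x + e) ≤ exp (6# * (x + e))
    exp-sq-step {x} {e} p r e≤1 ih = begin
      exp (x + e) * exp (x + e)             ≤⟨ *-mono-≤ n u n u ⟩
      exp x * c * (exp x * c)               ≈⟨ solve 2 (λ X c → X :* c :* (X :* c) := X :* X :* c :* c) refl (exp x) c ⟩
      exp x * exp x * c * c                 ≤⟨ *-monoʳ-≤ 0≤c (*-monoʳ-≤ 0≤c ih) ⟩
      exp (6# * x) * c * c                  ≤⟨ *-monoʳ-≤ 0≤c (exp-+-lower 0≤6x 0≤3e) ⟩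
      exp (6# * x + 3# * e) * c             ≤⟨ exp-+-lower (+-nonNegative 0≤6x 0≤3e) 0≤3e ⟩
      exp (6# * x + 3# * e + 3# * e)        ≤⟨ exp-mono (+-nonNegative (+-nonNegative 0≤6x 0≤3e) 0≤3e)
        (≤-reflexive (solve 2 (λ x e → con 6 :* x :+ con 3 :* e :+ con 3 :* e := con 6 :* (x :+ e)) refl x e)) ⟩
      exp (6# * (x + e))                    ∎
      where
      open ≤R
      c = 1# + 3# * e
      0≤3e : 0# ≤ 3# * e
      0≤3e = *-nonNegative 0≤3 r
      0≤c : 0# ≤ c
      0≤c = +-nonNegative 0≤1 0≤3e
      0≤6x : 0# ≤ 6# * x
      0≤6x = *-nonNegative 0≤6 p
      n = 0≤exp (+-nonNegative p r)
      u = exp-+-upper p r e≤1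

    exp-sq-bounded : ∀ N {y} → 0# ≤ y → y ≤ fromℕ N → exp y * exp y ≤ exp (6# * y)
    exp-sq-bounded zero {y} p r = begin
      exp y * exp y ≤⟨ *-mono-≤ (0≤exp p) u (0≤exp p) u ⟩
      1# * 1#       ≈⟨ *-identityˡ 1# ⟩
      1#            ≤⟨ 1≤exp (≤-reflexive (sym (trans (*-congˡ (≤-antisym r p)) (zeroʳ 6#)))) ⟩
      exp (6# * y)  ∎
      where
      open ≤R
      u : exp y ≤ 1#
      u = ≤-trans (exp-mono p r) exp-0
    exp-sq-bounded (suc N) {y} p r with y ≤? 1#
    ... | yes y≤1 = ≤-trans (*-mono-≤ (0≤exp p) u (0≤exp p) u)
      (≤-trans (exp-sq-step ≤-refl p y≤1 (exp-sq-bounded zero ≤-refl ≤-refl))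
        (exp-mono (*-nonNegative 0≤6 (+-nonNegative ≤-refl p)) (*-monoˡ-≤ 0≤6 (≤-reflexive (+-identityˡ y)))))
      where
      u : exp y ≤ exp (0# + y)
      u = exp-mono p (≤-reflexive (sym (+-identityˡ y)))
    ... | no y≰1 = ≤-trans (*-mono-≤ (0≤exp p) u (0≤exp p) u)
      (≤-trans (exp-sq-step d 0≤1 ≤-refl (exp-sq-bounded N d d≤))
        (exp-mono (*-nonNegative 0≤6 (+-nonNegative d 0≤1)) (*-monoˡ-≤ 0≤6 (≤-reflexive (minus-+ 1# y)))))
      where
      d : 0# ≤ y + - 1#
      d = 0≤-minus (≰⇒≥ y≰1)
      d≤ : y + - 1# ≤ fromℕ N
      d≤ = +-cancelʳ-≤ 1# (≤-resp₂ (sym (minus-+ 1# y)) (+-comm _ _) r)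
      u : exp y ≤ exp (y + - 1# + 1#)
      u = exp-mono p (≤-reflexive (sym (minus-+ 1# y)))

  exp-sq : ∀ {y} → 0# ≤ y → exp y * exp y ≤ exp (6# * y)
  exp-sq {y} p = ≤-stable λ n → archimedean′ y λ { (N , r) → n (exp-sq-bounded N p r) }

  ≤log : ∀ {x y} → 0# ≤ y → exp y ≤ x → y ≤ log x
  ≤log {x} {y} p r = sup-upper _ (y , p , r)
    (x , λ z (z0 , zx) → ≤-trans (x≤y+x 0≤1) (≤-trans (1+x≤exp z0) zx)) y (p , r)

  ½≤log : ∀ {x} → 2# ≤ x → ½ ≤ log x
  ½≤log {x} r = ≤log 0≤½ (begin
    exp ½                    ≤⟨ exp-mono 0≤½ (≤-reflexive (sym (+-identityˡ ½))) ⟩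
    exp (0# + ½)             ≤⟨ exp-+-upper½ ≤-refl 0≤½ ≤-refl ⟩
    exp 0# * (1# + 2# * ½)   ≤⟨ *-mono-≤ (0≤exp ≤-refl) exp-0 (+-nonNegative 0≤1 (*-nonNegative 0≤2 0≤½)) ≤-refl ⟩
    1# * (1# + 2# * ½)       ≈⟨ trans (*-identityˡ _) (+-congˡ (trans (*-comm 2# ½) (/-* 1# 2≰0))) ⟩
    2#                       ≤⟨ r ⟩
    x                        ∎)
    where open ≤R

  -- With t = s / 6, `exp-sq` gives (exp t)² ≤ exp s ≤ x², and squares can be cancelled.
  log-sq : ∀ {x s} → 0# ≤ x → 0# ≤ s → exp s ≤ x * x → s ≤ 6# * log x
  log-sq {x} {s} 0≤x 0≤s r = ≤-trans (/≤⁻ 6≰0 (≤log 0≤t (sq-cancel-≤ 0≤x (begin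
    exp t * exp t ≤⟨ exp-sq 0≤t ⟩
    exp (6# * t)  ≤⟨ exp-mono (*-nonNegative 0≤6 0≤t) (≤-reflexive (trans (*-comm _ _) (/-* s 6≰0))) ⟩
    exp s         ≤⟨ r ⟩
    x * x         ∎)))) (≤-reflexive (*-comm _ _))
    where
    open ≤R
    t = s / 6#
    0≤t : 0# ≤ t
    0≤t = /-nonNegative 0≤s 6≰0

  -- If x ≤ m this is log-sq; otherwise write x = m (1 + c) and compare with
  -- exp (s - c) ≤ exp s / (1 + c).
  log-product-bound : ∀ {m x R P s} → 2# ≤ m → 1# ≤ x → x ≤ R → 0# ≤ P → P ≤ m → P ≤ R →
    0# ≤ s → exp s ≤ m * x → P * P * (s + 1#) ≤ 8# * (R * R * log m)
  log-product-bound {m} {x} {R} {P} {s} 2≤m 1≤x x≤R 0≤P P≤m P≤R 0≤s es = go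
    where
    open ≤R
    0≤m : 0# ≤ m
    0≤m = ≤-trans 0≤2 2≤m
    0≤x = ≤-trans 0≤1 1≤x
    0≤R = ≤-trans 0≤x x≤R
    l = log m
    ½≤l = ½≤log 2≤m
    1≤2l : 1# ≤ l + l
    1≤2l = ≤-resp₂ ½+½ refl (+-mono-≤ ½≤l ½≤l)
    0≤l : 0# ≤ l
    0≤l = ≤-trans 0≤½ ½≤l
    0≤6l = *-nonNegative 0≤6 0≤l
    m≰0 : ¬ m ≤ 0#
    m≰0 r = 2≰0 (≤-trans 2≤m r)
    final : P * P * (6# * l) + R * R * (l + l) ≤ 8# * (R * R * l)
    final = ≤-trans (+-mono-≤ (*-monoʳ-≤ 0≤6l (*-mono-≤ 0≤P P≤R 0≤P P≤R)) ≤-refl)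
      (≤-reflexive (solve 2 (λ R l → R :* R :* (con 6 :* l) :+ R :* R :* (l :+ l) := con 8 :* (R :* R :* l)) refl R l))
    go : P * P * (s + 1#) ≤ 8# * (R * R * l)
    go with x ≤? m
    ... | yes x≤m = begin
      P * P * (s + 1#)                 ≤⟨ *-monoˡ-≤ (0≤-sq P) (+-mono-≤ (log-sq 0≤m 0≤s (≤-trans es (*-monoˡ-≤ 0≤m x≤m))) 1≤2l) ⟩
      P * P * (6# * l + (l + l))       ≈⟨ distribˡ _ _ _ ⟩
      P * P * (6# * l) + P * P * (l + l) ≤⟨ +-monoʳ-≤ _ (*-monoʳ-≤ (+-nonNegative 0≤l 0≤l) (*-mono-≤ 0≤P P≤R 0≤P P≤R)) ⟩
      P * P * (6# * l) + R * R * (l + l) ≤⟨ final ⟩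
      8# * (R * R * l)                 ∎
    ... | no x≰m = begin
      P * P * (s + 1#)                       ≤⟨ *-monoˡ-≤ (0≤-sq P) s+1 ⟩
      P * P * (6# * l + y)                   ≈⟨ distribˡ _ _ _ ⟩
      P * P * (6# * l) + P * P * y           ≤⟨ +-monoʳ-≤ _ (begin
          -- Here `P ≤ m` enters: m² y = m x, and both factors are at most R since m ≤ x. The
          -- possibly large y, a bound for the part of s beyond log m, is thus paid for by R².
          P * P * y   ≤⟨ *-monoʳ-≤ 0≤y (*-mono-≤ 0≤P P≤m 0≤P P≤m) ⟩
          m * m * y   ≈⟨ trans (*-assoc m m y) (*-congˡ my) ⟩
          m * x       ≤⟨ *-mono-≤ 0≤m (≤-trans m≤x x≤R) 0≤x x≤R ⟩
          R * R       ≈⟨ sym (*-identityʳ _) ⟩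
          R * R * 1#  ≤⟨ *-monoˡ-≤ (0≤-sq R) 1≤2l ⟩
          R * R * (l + l) ∎) ⟩
      P * P * (6# * l) + R * R * (l + l)     ≤⟨ final ⟩
      8# * (R * R * l)                       ∎
      where
      m≤x = ≰⇒≥ x≰m
      y = x / m
      my : m * y ≈ x
      my = trans (*-comm m y) (/-* x m≰0)
      1≤y : 1# ≤ y
      1≤y = ≤/ m≰0 (≤-trans (≤-reflexive (*-identityˡ m)) m≤x)
      0≤y = ≤-trans 0≤1 1≤y
      c = y + - 1#
      0≤c : 0# ≤ c
      0≤c = 0≤-minus 1≤y
      c+1 : c + 1# ≈ y
      c+1 = minus-+ 1# y
      s+1 : s + 1# ≤ 6# * l + y
      s+1 with s ≤? c
      ... | yes s≤c = ≤-trans (+-mono-≤ s≤c ≤-refl) (≤-trans (≤-reflexive c+1) (x≤y+x 0≤6l))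
      ... | no s≰c = ≤-trans (≤-reflexive (trans (+-congʳ (sym (minus-+ c s))) (+-assoc _ _ _)))
              (+-mono-≤ (log-sq 0≤m 0≤d (*-cancelˡ-≤ (≥1⇒≰0 1≤y) (begin
                  y * exp d        ≈⟨ trans (*-comm _ _) (*-congˡ (trans (sym c+1) (+-comm c 1#))) ⟩
                  exp d * (1# + c) ≤⟨ exp-+-lower 0≤d 0≤c ⟩
                  exp (d + c)      ≤⟨ exp-mono (+-nonNegative 0≤d 0≤c) (≤-reflexive (minus-+ c s)) ⟩
                  exp s            ≤⟨ es ⟩
                  m * x            ≈⟨ *-congˡ (sym my) ⟩
                  m * (m * y)      ≈⟨ solve 2 (λ m y → m :* (m :* y) := y :* (m :* m)) refl m y ⟩
                  y * (m * m)      ∎)))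
                (≤-reflexive c+1))
        where
        d = s + - c
        0≤d : 0# ≤ d
        0≤d = 0≤-minus (≰⇒≥ s≰c)

  am-gm : ∀ x y → 2# * (x * y) ≤ x * x + y * y
  am-gm x y with ≤-total x y
  ... | inj₁ p = by-adding (0≤-sq d) (trans (+-congʳ (*-congˡ (*-congˡ y≈)))
        (trans (solve 2 (λ x d → con 2 :* (x :* (d :+ x)) :+ d :* d := x :* x :+ (d :+ x) :* (d :+ x) :+ con 0) refl x d)
          (+-congʳ (+-congˡ (*-cong (sym y≈) (sym y≈))))))
    where
    d = y + - x
    y≈ : y ≈ d + x
    y≈ = sym (minus-+ x y)
  ... | inj₂ p = by-adding (0≤-sq d) (trans (+-congʳ (*-congˡ (*-congʳ x≈)))
        (trans (solve 2 (λ y d → con 2 :* ((d :+ y) :* y) :+ d :* d := (d :+ y) :* (d :+ y) :+ y :* y :+ con 0) refl y d)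
          (+-congʳ (+-congʳ (*-cong (sym x≈) (sym x≈))))))
    where
    d = x + - y
    x≈ : x ≈ d + y
    x≈ = sym (minus-+ y x)

  ≤sqrt : ∀ {x y} → 0# ≤ y → y * y ≤ x → y ≤ sqrt x
  ≤sqrt {x} {y} p r = sup-upper _ (y , p , r) (1# + x , ub) y (p , r)
    where
    0≤x = ≤-trans (0≤-sq y) r
    ub : ∀ z → 0# ≤ z × z * z ≤ x → z ≤ 1# + x
    ub z (_ , h) = sq-cancel-≤ (+-nonNegative 0≤1 0≤x)
      (by-adding (+-mono-≤ h (+-nonNegative (+-nonNegative 0≤1 0≤x) (0≤-sq x)))
        (solve 2 (λ z x → z :* z :+ (x :+ (con 1 :+ x :+ x :* x))
            := (con 1 :+ x) :* (con 1 :+ x) :+ (z :* z :+ con 0)) refl z x))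

  sqrt-least : ∀ {x b} → 0# ≤ x → (∀ y → 0# ≤ y → y * y ≤ x → y ≤ b) → sqrt x ≤ b
  sqrt-least {x} {b} p h = sup-least _ (0# , ≤-refl , ≤-trans (≤-reflexive (zeroˡ 0#)) p) b λ y (y0 , yx) → h y y0 yx

  0≤sqrt : ∀ {x} → 0# ≤ x → 0# ≤ sqrt x
  0≤sqrt p = ≤sqrt ≤-refl (≤-trans (≤-reflexive (zeroˡ 0#)) p)

  -- (x + s²)/2s is an upper bound of {y ≥ 0 | y² ≤ x} by AM-GM.
  sqrt-sq-≤ : ∀ {x} → 0# ≤ x → sqrt x * sqrt x ≤ x
  sqrt-sq-≤ {x} p with sqrt x ≤? 0#
  ... | yes s≤0 = ≤-trans (≤-reflexive (trans (*-congʳ (≤-antisym s≤0 (0≤sqrt p))) (zeroˡ _))) p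
  ... | no s≰0 = by-adding (≤/⁻ 2s≰0 (sqrt-least p λ y y0 yx → ≤/ 2s≰0 (begin
          y * (2# * s)    ≈⟨ solve 2 (λ y s → y :* (con 2 :* s) := con 2 :* (y :* s)) refl y s ⟩
          2# * (y * s)    ≤⟨ am-gm y s ⟩
          y * y + s * s   ≤⟨ +-mono-≤ yx ≤-refl ⟩
          x + s * s       ∎)))
        (solve 2 (λ x s → s :* s :+ (x :+ s :* s) := x :+ s :* (con 2 :* s)) refl x s)
    where
    open ≤R
    s = sqrt x
    2s≰0 : ¬ 2# * s ≤ 0#
    2s≰0 = *-≰0 2≰0 s≰0

  sqrt-sq-≥ : ∀ {x} → 0# ≤ x → x ≤ sqrt x * sqrt x
  sqrt-sq-≥ {x} p with x ≤? sqrt x * sqrt x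
  ... | yes r = r
  ... | no n = contradiction h≤0 h≰0
    where
    open ≤R
    s = sqrt x
    0≤s = 0≤sqrt p
    d = x + - (s * s)
    d≰0 : ¬ d ≤ 0#
    d≰0 r = n (≤-resp₂ (minus-+ (s * s) x) (+-identityˡ _) (+-mono-≤ r (≤-refl {s * s})))
    c = 2# * s + 1#
    0≤2s = *-nonNegative 0≤2 0≤s
    c≰0 : ¬ c ≤ 0#
    c≰0 = ≥1⇒≰0 (x≤y+x 0≤2s)
    -- From h ≤ 1 follows 2s + h ≤ c, and then h ≤ d / c keeps (s + h)² at most s² + d = x, so that
    -- s + h competes in the supremum.
    h = 1# ⊓ (d / c)
    h≰0 : ¬ h ≤ 0#
    h≰0 r with ≤-total 1# (d / c)
    ... | inj₁ _ = 1≰0 r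
    ... | inj₂ _ = *-≰0 d≰0 (⁻¹-≰0 c≰0) r
    0≤h = ≰⇒≥ h≰0
    h≤0 : h ≤ 0#
    h≤0 = +-cancelˡ-≤ s (≤-trans (≤sqrt (+-nonNegative 0≤s 0≤h) (begin
      (s + h) * (s + h)   ≈⟨ solve 2 (λ s h → (s :+ h) :* (s :+ h) := s :* s :+ h :* (con 2 :* s :+ h)) refl s h ⟩
      s * s + h * (2# * s + h) ≤⟨ +-monoʳ-≤ _ (*-monoˡ-≤ 0≤h (+-monoʳ-≤ _ (⊓≤ˡ 1# (d / c)))) ⟩
      s * s + h * c       ≤⟨ +-monoʳ-≤ _ (≤/⁻ c≰0 (⊓≤ʳ 1# (d / c))) ⟩
      s * s + d           ≈⟨ trans (+-comm _ _) (minus-+ (s * s) x) ⟩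
      x                   ∎)) (≤-reflexive (sym (+-identityʳ s))))

  ≤*sqrt : ∀ {x y z} → 0# ≤ x → 0# ≤ z → y * y ≤ z * z * x → y ≤ z * sqrt x
  ≤*sqrt {x} {y} {z} p r h = sq-cancel-≤ (*-nonNegative r (0≤sqrt p)) (begin
    y * y         ≤⟨ h ⟩
    z * z * x     ≤⟨ *-monoˡ-≤ (0≤-sq z) (sqrt-sq-≥ p) ⟩
    z * z * (sqrt x * sqrt x) ≈⟨ solve 2 (λ z s → z :* z :* (s :* s) := z :* s :* (z :* s)) refl z (sqrt x) ⟩
    z * sqrt x * (z * sqrt x) ∎)
    where open ≤R

  neg-antitone : ∀ {x y} → x ≤ y → - y ≤ - x
  neg-antitone {x} {y} p = +-cancelˡ-≤ (x + y) (≤-resp₂ e₁ e₂ p)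
    where
    e₁ : x ≈ x + y + - y
    e₁ = sym (trans (+-assoc _ _ _) (trans (+-congˡ (-‿inverseʳ y)) (+-identityʳ x)))
    e₂ : y ≈ x + y + - x
    e₂ = sym (trans (+-congʳ (+-comm x y)) (trans (+-assoc _ _ _) (trans (+-congˡ (-‿inverseʳ x)) (+-identityʳ y))))

  inf-greatest : ∀ {P : Carrier → Set} {b} → ∃[ y ] P (- y) → (∀ z → P z → b ≤ z) → b ≤ inf P
  inf-greatest {P} {b} ne h = ≤-trans (≤-reflexive (sym (-‿involutive b)))
    (neg-antitone (sup-least _ ne (- b) λ y py →
      ≤-trans (≤-reflexive (sym (-‿involutive y))) (neg-antitone (h (- y) py))))

  -- An infimum is meaningful only over a nonempty set; the Archimedean property supplies a natural
  -- number above `x`.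
  ⌈⌉-greatest : ∀ {x b} → (∀ m → x ≤ fromℕ m → b ≤ fromℕ m) → b ≤ ⌈ x ⌉
  ⌈⌉-greatest {x} {b} h = ≤-stable λ n → archimedean′ x λ { (m , r) →
    n (inf-greatest {λ y → ∃[ k ] (y ≈ fromℕ k × x ≤ y)} (- fromℕ m , m , -‿involutive _ , ≤-trans r (≤-reflexive (sym (-‿involutive _))))
      λ { z (k , e , xz) → ≤-trans (h k (≤-trans xz (≤-reflexive e))) (≤-reflexive (sym e)) }) }

  x≤⌈x⌉ : ∀ x → x ≤ ⌈ x ⌉
  x≤⌈x⌉ x = ⌈⌉-greatest λ m r → r

  1≤⌈x⌉ : ∀ {x} → ¬ x ≤ 0# → 1# ≤ ⌈ x ⌉
  1≤⌈x⌉ {x} n = ⌈⌉-greatest λ { zero r → contradiction r n ; (suc m) _ → 1≤1+ (0≤fromℕ m) }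

-- Sums of class widths and of First-Fit thresholds

module ClassBounds (ℝ : CompleteOrderedField) where

  open RealFunctions ℝ public

  rate-nonNegative : ∀ {V} → ¬ V ≤ 0# → ∀ j → 0# ≤ rate V j
  rate-nonNegative V≰0 j = ⊓-glb 0≤1 (/-nonNegative (0≤fromℕ j) V≰0)

  εSum-nonNegative : ∀ {V} → ¬ V ≤ 0# → ∀ j → 0# ≤ εSum V j
  εSum-nonNegative {V} V≰0 j = ∑<-nonNegative j {λ i → rate V (suc i)} λ i → rate-nonNegative V≰0 (suc i)

  εSum-last : ∀ V j → εSum V (suc j) ≈ εSum V j + rate V (suc j)
  εSum-last V j = ∑<-last j (λ i → rate V (suc i))

  -- For i ≤ K ≤ c and V ≤ c, each min(1, i/V) is at least i/c, and these add up to K (K + 1) / 2c.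
  -- The parameter c covers both regimes: it is V when J ≤ V and J otherwise.
  εSum-lower : ∀ {V c} → ¬ V ≤ 0# → 0# ≤ c → V ≤ c → ∀ K → fromℕ K ≤ c →
               fromℕ K * fromℕ (suc K) ≤ 2# * (c * εSum V K)
  εSum-lower {V} {c} n 0≤c V≤c zero _ = ≤-reflexive (trans (zeroˡ _) (sym (trans (*-congˡ (zeroʳ c)) (zeroʳ 2#))))
  εSum-lower {V} {c} n 0≤c V≤c (suc K) K≤c = begin
    (1# + k) * (1# + (1# + k)) ≈⟨ solve 1 (λ k → (con 1 :+ k) :* (con 1 :+ (con 1 :+ k)) := k :* (con 1 :+ k) :+ con 2 :* (con 1 :+ k)) refl k ⟩
    k * (1# + k) + 2# * (1# + k) ≤⟨ +-mono-≤ (εSum-lower n 0≤c V≤c K (≤-trans (fromℕ-mono (ℕ.n≤1+n K)) K≤c))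
                                              (*-monoˡ-≤ 0≤2 c*rate) ⟩
    2# * (c * e) + 2# * (c * rate V (suc K)) ≈⟨ solve 3 (λ c e r → con 2 :* (c :* e) :+ con 2 :* (c :* r) := con 2 :* (c :* (e :+ r))) refl c e (rate V (suc K)) ⟩
    2# * (c * (e + rate V (suc K))) ≈⟨ *-congˡ (*-congˡ (sym (εSum-last V K))) ⟩
    2# * (c * εSum V (suc K)) ∎
    where
    open ≤R
    k = fromℕ K
    e = εSum V K
    c*rate : fromℕ (suc K) ≤ c * rate V (suc K)
    c*rate with ≤-total 1# (fromℕ (suc K) / V)
    ... | inj₁ _ = ≤-trans K≤c (≤-reflexive (sym (*-identityʳ c)))
    ... | inj₂ _ = ≤-trans (≤-reflexive (trans (sym (/-* _ n)) (*-comm _ _)))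
                     (*-monoʳ-≤ (/-nonNegative (0≤fromℕ (suc K)) n) V≤c)

  threshold-nonNegative : ∀ {V} → ¬ V ≤ 0# → ∀ j → 0# ≤ threshold V (suc j)
  threshold-nonNegative n j = ⊓-glb 0≤1 (0≤sqrt (/-nonNegative (≰⇒≥ n) (fromℕ-suc≰0 j)))

  threshold-sq : ∀ {V} → ¬ V ≤ 0# → ∀ j → threshold V (suc j) * threshold V (suc j) * fromℕ (suc j) ≤ V
  threshold-sq {V} n j = ≤/⁻ (fromℕ-suc≰0 j) (≤-trans (*-mono-≤ t0 t≤ t0 t≤) (sqrt-sq-≤ 0≤V/j))
    where
    0≤V/j : 0# ≤ V / fromℕ (suc j)
    0≤V/j = /-nonNegative (≰⇒≥ n) (fromℕ-suc≰0 j)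
    t0 = threshold-nonNegative n j
    t≤ = ⊓≤ʳ 1# (sqrt (V / fromℕ (suc j)))

  -- Induction on m, with the step brought into the form 2h ≤ w for w = 2h′ - x. Expanding, w² ≥
  -- 4h′² - 4h′x ≥ 4V(m + 1) - 4V = 4Vm, since h′x ≤ V.
  ∑threshold≤sqrt : ∀ {V} → ¬ V ≤ 0# → ∀ m → ∑< m (λ j → threshold V (suc j)) ≤ 2# * sqrt (V * fromℕ m)
  ∑threshold≤sqrt {V} n zero = *-nonNegative 0≤2 (0≤sqrt (≤-reflexive (sym (zeroʳ V))))
  ∑threshold≤sqrt {V} n (suc m) = begin
    ∑< (suc m) (λ j → threshold V (suc j)) ≈⟨ ∑<-last m (λ j → threshold V (suc j)) ⟩
    ∑< m (λ j → threshold V (suc j)) + x   ≤⟨ +-mono-≤ (∑threshold≤sqrt n m) ≤-refl ⟩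
    2# * h + x                             ≤⟨ +-mono-≤ 2h≤w ≤-refl ⟩
    w + x                                  ≈⟨ w+x ⟩
    2# * h′                                ∎
    where
    open ≤R
    0≤V = ≰⇒≥ n
    x = threshold V (suc m)
    h = sqrt (V * fromℕ m)
    h′ = sqrt (V * fromℕ (suc m))
    0≤x = threshold-nonNegative n m
    c = fromℕ (suc m)
    x²c = threshold-sq n m
    0≤Vc : 0# ≤ V * c
    0≤Vc = *-nonNegative 0≤V (0≤fromℕ (suc m))
    0≤h′ = 0≤sqrt 0≤Vc
    h′x≤V : h′ * x ≤ V
    h′x≤V = sq-cancel-≤ 0≤V (begin
      h′ * x * (h′ * x)   ≈⟨ solve 2 (λ h x → h :* x :* (h :* x) := h :* h :* (x :* x)) refl h′ x ⟩
      h′ * h′ * (x * x)   ≤⟨ *-monoʳ-≤ (0≤-sq x) (sqrt-sq-≤ 0≤Vc) ⟩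
      V * c * (x * x)     ≈⟨ solve 3 (λ V c x → V :* c :* (x :* x) := V :* (x :* x :* c)) refl V c x ⟩
      V * (x * x * c)     ≤⟨ *-monoˡ-≤ 0≤V x²c ⟩
      V * V               ∎)
    x≤h′ : x ≤ h′
    x≤h′ = ≤sqrt 0≤x (begin
      x * x         ≤⟨ ≤-trans (≤-reflexive (sym (*-identityʳ _))) (*-monoˡ-≤ (0≤-sq x) (1≤1+ (0≤fromℕ m))) ⟩
      x * x * c     ≤⟨ x²c ⟩
      V             ≤⟨ ≤-trans (≤-reflexive (sym (*-identityʳ _))) (*-monoˡ-≤ 0≤V (1≤1+ (0≤fromℕ m))) ⟩
      V * c         ∎)
    w = 2# * h′ + - x
    w+x : w + x ≈ 2# * h′
    w+x = minus-+ x _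
    0≤w : 0# ≤ w
    0≤w = 0≤-minus (≤-trans x≤h′ (≤-trans (x≤x+y 0≤h′) (≤-reflexive (solve 1 (λ h → h :+ h := con 2 :* h) refl h′))))
    w² : w * w + 4# * (h′ * x) ≈ 4# * (h′ * h′) + x * x
    w² = trans (solve 3 (λ w h x → w :* w :+ con 4 :* (h :* x) := w :* w :+ (con 2 :* h) :* (con 2 :* x)) refl w h′ x)
      (trans (+-congˡ (*-congʳ (sym w+x)))
      (trans (solve 2 (λ w x → w :* w :+ (w :+ x) :* (con 2 :* x) := (w :+ x) :* (w :+ x) :+ x :* x) refl w x)
      (trans (+-congʳ (*-cong w+x w+x))
        (+-congʳ (solve 1 (λ h → (con 2 :* h) :* (con 2 :* h) := con 4 :* (h :* h)) refl h′)))))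
    2h≤w : 2# * h ≤ w
    2h≤w = sq-cancel-≤ 0≤w (by-adding
      (+-mono-≤ (*-monoˡ-≤ 0≤4 (+-mono-≤ (sqrt-sq-≤ (*-nonNegative 0≤V (0≤fromℕ m))) (+-mono-≤ h′x≤V (sqrt-sq-≥ 0≤Vc))))
                (0≤-sq x))
      (trans
        (solve 6 (λ h V m g x p → (con 2 :* h) :* (con 2 :* h) :+ (con 4 :* (V :* m :+ (V :+ g :* g)) :+ x :* x)
          := (con 4 :* (g :* g) :+ x :* x) :+ con 4 :* (h :* h :+ V :* (con 1 :+ m))) refl h V (fromℕ m) h′ x c)
        (trans (+-congʳ (sym w²))
        (solve 6 (λ w h V m g x → (w :* w :+ con 4 :* (g :* x)) :+ con 4 :* (h :* h :+ V :* (con 1 :+ m))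
          := w :* w :+ (con 4 :* (h :* h :+ (g :* x :+ V :* (con 1 :+ m))) :+ con 0)) refl w h V (fromℕ m) h′ x))))

  -- Y bounds every lower-order term.  When the largest class J is at most V
  -- the class count is what matters, and otherwise the thresholds are.
  module LowerOrder {V v D : Carrier} {K : ℕ} (1≤D : 1# ≤ D) (1≤v : 1# ≤ v)
                    (v≤DV : v ≤ D * V) (V≤Dv : V ≤ D * v) where

    open ≤R

    private
      J = suc K
      s = εSum V K

    0≤D : 0# ≤ D
    0≤D = ≤-trans 0≤1 1≤D
    0≤v : 0# ≤ v
    0≤v = ≤-trans 0≤1 1≤v

    V≰0 : ¬ V ≤ 0#
    V≰0 p = 1≰0 (≤-trans 1≤v (≤-trans v≤DV (≤-trans (*-monoˡ-≤ 0≤D p) (≤-reflexive (zeroʳ D)))))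

    0≤V : 0# ≤ V
    0≤V = ≰⇒≥ V≰0

    0≤s : 0# ≤ s
    0≤s = εSum-nonNegative V≰0 K

    private
      S1 = 2# * (s + 1#)
      0≤S1 : 0# ≤ S1
      0≤S1 = *-nonNegative 0≤2 (+-nonNegative 0≤s 0≤1)
      1≤S1 : 1# ≤ S1
      1≤S1 = by-adding (+-mono-≤ 0≤s (+-mono-≤ 0≤s 0≤1))
        (solve 1 (λ s → con 1 :+ (s :+ (s :+ con 1)) := con 2 :* (s :+ con 1) :+ (con 0 :+ (con 0 :+ con 0))) refl s)

    -- The factor 2 in `S1` is what lets it dominate J² / V when J ≤ V and J itself otherwise; `D`
    -- pays for replacing V by v, or v by V.
    Z : Carrier
    Z = D * v * S1

    0≤Dv : 0# ≤ D * v
    0≤Dv = *-nonNegative 0≤D 0≤v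

    0≤Z : 0# ≤ Z
    0≤Z = *-nonNegative 0≤Dv 0≤S1

    Y : Carrier
    Y = sqrt Z

    0≤Y : 0# ≤ Y
    0≤Y = 0≤sqrt 0≤Z

    1≤Y : 1# ≤ Y
    1≤Y = ≤sqrt 0≤1 (*-mono-≤ 0≤1 (≤-trans (≤-reflexive (sym (*-identityˡ 1#))) (*-mono-≤ 0≤1 1≤D 0≤1 1≤v)) 0≤1 1≤S1)

    Y²≤ : Y * Y ≤ Z
    Y²≤ = sqrt-sq-≤ 0≤Z

    private
      x≤Dv·y : ∀ {x y} → 0# ≤ y → x ≤ V * y → y ≤ S1 → x ≤ Z
      x≤Dv·y p q r = ≤-trans q (*-mono-≤ 0≤V V≤Dv p r)

      module Small (J≤V : fromℕ J ≤ V) where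
        J² : fromℕ J * fromℕ J ≤ V * S1
        J² = begin
          (1# + fromℕ K) * fromℕ J ≈⟨ solve 2 (λ k j → (con 1 :+ k) :* j := k :* j :+ j) refl (fromℕ K) (fromℕ J) ⟩
          fromℕ K * fromℕ J + fromℕ J ≤⟨ +-mono-≤ (εSum-lower V≰0 0≤V ≤-refl K (≤-trans (fromℕ-mono (ℕ.n≤1+n K)) J≤V)) J≤V ⟩
          2# * (V * s) + V ≤⟨ x≤x+y 0≤V ⟩
          2# * (V * s) + V + V ≈⟨ solve 2 (λ V s → con 2 :* (V :* s) :+ V :+ V := V :* (con 2 :* (s :+ con 1))) refl V s ⟩
          V * S1 ∎

        J≤Y : fromℕ J ≤ Y
        J≤Y = ≤sqrt (0≤fromℕ J) (x≤Dv·y 0≤S1 J² ≤-refl)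

        ∑q : ∑< J (λ j → threshold V (suc j)) ≤ 2# * Y
        ∑q = begin
          ∑< J (λ j → threshold V (suc j)) ≤⟨ count J ⟩
          fromℕ J ≤⟨ J≤Y ⟩
          Y ≤⟨ x≤x+y 0≤Y ⟩
          Y + Y ≈⟨ solve 1 (λ y → y :+ y := con 2 :* y) refl Y ⟩
          2# * Y ∎
          where
          count : ∀ m → ∑< m (λ j → threshold V (suc j)) ≤ fromℕ m
          count zero = ≤-refl
          count (suc m) = ≤-trans (≤-reflexive (∑<-last m (λ j → threshold V (suc j))))
            (≤-trans (+-mono-≤ (count m) (⊓≤ˡ 1# (sqrt (V / fromℕ (suc m))))) (≤-reflexive (+-comm _ _)))

        -- One of the two factors v in (x v)² is traded for D V; the remaining x² V is at most J² /
        -- V, hence at most `S1`.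
        rate-v : rate V J * v ≤ Y
        rate-v = ≤sqrt (*-nonNegative 0≤x 0≤v) (begin
          x * v * (x * v)      ≈⟨ solve 2 (λ x v → x :* v :* (x :* v) := x :* x :* v :* v) refl x v ⟩
          x * x * v * v        ≤⟨ *-monoˡ-≤ (*-nonNegative (0≤-sq x) 0≤v) v≤DV ⟩
          x * x * v * (D * V)  ≈⟨ solve 4 (λ x v D V → x :* x :* v :* (D :* V) := D :* v :* (x :* x :* V)) refl x v D V ⟩
          D * v * (x * x * V)  ≤⟨ *-monoˡ-≤ 0≤Dv (*-cancelˡ-≤ V≰0 (begin
              V * (x * x * V)  ≈⟨ solve 2 (λ x V → V :* (x :* x :* V) := (x :* V) :* (x :* V)) refl x V ⟩
              x * V * (x * V)  ≤⟨ *-mono-≤ (*-nonNegative 0≤x 0≤V) xV≤J (*-nonNegative 0≤x 0≤V) xV≤J ⟩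
              fromℕ J * fromℕ J ≤⟨ J² ⟩
              V * S1 ∎)) ⟩
          D * v * S1 ∎)
          where
          x = rate V J
          0≤x = rate-nonNegative V≰0 J
          xV≤J : x * V ≤ fromℕ J
          xV≤J = ≤/⁻ V≰0 (⊓≤ʳ 1# (fromℕ J / V))

      module Large (V≤J : V ≤ fromℕ J) where
        J≤S1 : fromℕ J ≤ S1
        J≤S1 = begin
          1# + fromℕ K    ≤⟨ +-monoʳ-≤ 1# (*-cancelˡ-≤ (fromℕ-suc≰0 K) (begin
            fromℕ J * fromℕ K    ≈⟨ *-comm _ _ ⟩
            fromℕ K * fromℕ J    ≤⟨ εSum-lower V≰0 (0≤fromℕ J) V≤J K (fromℕ-mono (ℕ.n≤1+n K)) ⟩
            2# * (fromℕ J * s)   ≈⟨ solve 2 (λ j s → con 2 :* (j :* s) := j :* (con 2 :* s)) refl (fromℕ J) s ⟩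
            fromℕ J * (2# * s)   ∎)) ⟩
          1# + 2# * s     ≤⟨ x≤y+x 0≤1 ⟩
          1# + (1# + 2# * s) ≈⟨ solve 1 (λ s → con 1 :+ (con 1 :+ con 2 :* s) := con 2 :* (s :+ con 1)) refl s ⟩
          S1 ∎

        ∑q : ∑< J (λ j → threshold V (suc j)) ≤ 2# * Y
        ∑q = ≤-trans (∑threshold≤sqrt V≰0 J) (*-monoˡ-≤ 0≤2
          (≤sqrt (0≤sqrt 0≤VJ) (≤-trans (sqrt-sq-≤ 0≤VJ) (x≤Dv·y (0≤fromℕ J) ≤-refl J≤S1))))
          where
          0≤VJ = *-nonNegative 0≤V (0≤fromℕ J)

        v²≤ : ∀ {j} → 0# ≤ j → V ≤ j → j ≤ S1 → v * v ≤ Z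
        v²≤ {j} 0≤j V≤j j≤ = begin
          v * v        ≤⟨ *-monoˡ-≤ 0≤v v≤DV ⟩
          v * (D * V)  ≈⟨ solve 3 (λ v D V → v :* (D :* V) := D :* v :* V) refl v D V ⟩
          D * v * V    ≤⟨ *-monoˡ-≤ 0≤Dv (≤-trans V≤j j≤) ⟩
          D * v * S1   ∎

        v≤Y : v ≤ Y
        v≤Y = ≤sqrt 0≤v (v²≤ (0≤fromℕ J) V≤J J≤S1)

        rate-v : rate V J * v ≤ Y
        rate-v = ≤-trans (≤-trans (*-monoʳ-≤ 0≤v (⊓≤ˡ 1# (fromℕ J / V))) (≤-reflexive (*-identityˡ v))) v≤Y

        -- Both arguments of the minimum that defines the threshold are at least v / Y: the first
        -- because v ≤ Y, the second because v² j ≤ v (D V) S1 = Z V.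
        v≤qY : ∀ j → suc j ℕ.≤ J → v ≤ threshold V (suc j) * Y
        v≤qY j j≤J = /≤⁻ Y≰0 (⊓-glb (/≤ Y≰0 (≤-trans v≤Y (≤-reflexive (sym (*-identityˡ Y)))))
          (≤sqrt (/-nonNegative 0≤v Y≰0) (≤/ j≰0 (*-cancelˡ-≤ (*-≰0 Y≰0 Y≰0) (begin
             Y * Y * (v / Y * (v / Y) * c)   ≈⟨ solve 3 (λ Y u c → Y :* Y :* (u :* u :* c) := (u :* Y) :* (u :* Y) :* c) refl Y (v / Y) c ⟩
             (v / Y * Y) * (v / Y * Y) * c   ≈⟨ *-congʳ (*-cong (/-* v Y≰0) (/-* v Y≰0)) ⟩
             v * v * c                       ≤⟨ *-mono-≤ (0≤-sq v) (*-monoˡ-≤ 0≤v v≤DV) (0≤fromℕ (suc j)) (≤-trans (fromℕ-mono j≤J) J≤S1) ⟩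
             v * (D * V) * S1                ≈⟨ solve 4 (λ v D V S → v :* (D :* V) :* S := (D :* v :* S) :* V) refl v D V S1 ⟩
             Z * V                           ≤⟨ *-monoʳ-≤ 0≤V (sqrt-sq-≥ 0≤Z) ⟩
             Y * Y * V                       ∎)))))
          where
          c = fromℕ (suc j)
          j≰0 = fromℕ-suc≰0 j
          Y≰0 = ≥1⇒≰0 1≤Y

    ∑threshold≤2Y : ∑< J (λ j → threshold V (suc j)) ≤ 2# * Y
    ∑threshold≤2Y with fromℕ J ≤? V
    ... | yes p = Small.∑q p
    ... | no n = Large.∑q (≰⇒≥ n)

    rate*v≤Y : rate V J * v ≤ Y
    rate*v≤Y with fromℕ J ≤? V
    ... | yes p = Small.rate-v p
    ... | no n = Large.rate-v (≰⇒≥ n)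

    -- Two ways of summing over the classes a quantity that is at most T for each: multiply T by the
    -- number of classes, or charge every class that uses its copy to its own volume. `U≤` and
    -- `Act≤` distinguish them.
    few-classes⊎large-thresholds : fromℕ J ≤ Y ⊎ (∀ j → suc j ℕ.≤ J → v ≤ threshold V (suc j) * Y)
    few-classes⊎large-thresholds with fromℕ J ≤? V
    ... | yes p = inj₁ (Small.J≤Y p)
    ... | no n = inj₂ (Large.v≤qY (≰⇒≥ n))

    -- The 4 is the square root of 2 · 8, with the 2 from `Z` and the 8 from `log-product-bound`.
    P*Y≤ : ∀ {P R m x} → 2# ≤ m → 1# ≤ x → x ≤ R → 0# ≤ P → P ≤ m → P ≤ R → exp s ≤ m * x →
           P * Y ≤ 4# * (R * sqrt (D * v * log m))
    P*Y≤ {P} {R} {m} {x} 2≤m 1≤x x≤R 0≤P P≤m P≤R es =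
      ≤-trans (≤*sqrt (*-nonNegative 0≤Dv (≤-trans 0≤½ (½≤log 2≤m))) (*-nonNegative 0≤4 0≤R) (begin
        P * Y * (P * Y)       ≈⟨ solve 2 (λ P Y → P :* Y :* (P :* Y) := P :* P :* (Y :* Y)) refl P Y ⟩
        P * P * (Y * Y)       ≤⟨ *-monoˡ-≤ (0≤-sq P) Y²≤ ⟩
        P * P * Z             ≈⟨ solve 4 (λ P D v s → P :* P :* (D :* v :* (con 2 :* (s :+ con 1)))
                                    := con 2 :* (D :* v) :* (P :* P :* (s :+ con 1))) refl P D v s ⟩
        2# * (D * v) * (P * P * (s + 1#)) ≤⟨ *-monoˡ-≤ (*-nonNegative 0≤2 0≤Dv) (log-product-bound 2≤m 1≤x x≤R 0≤P P≤m P≤R 0≤s es) ⟩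
        2# * (D * v) * (8# * (R * R * log m)) ≈⟨ solve 4 (λ D v R l → con 2 :* (D :* v) :* (con 8 :* (R :* R :* l))
                                    := con 4 :* R :* (con 4 :* R) :* (D :* v :* l)) refl D v R (log m) ⟩
        4# * R * (4# * R) * (D * v * log m) ∎))
      (≤-reflexive (*-assoc _ _ _))
      where
      0≤R = ≤-trans (≤-trans 0≤1 1≤x) x≤R

-- Counting in lists

module Lists where

  -- A pigeonhole principle for relations instead of functions: in `slot-machines` a machine is
  -- related to a bin number only through some job that witnesses it.
  length-injective : ∀ {A B : Set} (R : A → B → Set) {xs : List A} (ys : List B) → Unique xs →
    (∀ {x} → x ∈ xs → ∃[ y ] (y ∈ ys × R x y)) →
    (∀ {x x′ y} → x ∈ xs → x′ ∈ xs → R x y → R x′ y → x ≡ x′) →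
    length xs ℕ.≤ length ys
  length-injective R {[]} ys u f inj = ℕ.z≤n
  length-injective {B = B} R {x ∷ xs} ys (x∉ ∷ u) f inj with f (here ≡.refl)
  ... | y , y∈ , r with ∈-∃++ y∈
  ... | as , bs , ≡.refl = begin
      suc (length xs)               ≤⟨ ℕ.s≤s (length-injective R (as ++ bs) u g (λ p q → inj (there p) (there q))) ⟩
      suc (length (as ++ bs))       ≡⟨ ≡.cong suc (List.length-++ as) ⟩
      suc (length as ℕ.+ length bs) ≡⟨ ≡.sym (ℕ.+-suc _ _) ⟩
      length as ℕ.+ length (y ∷ bs) ≡⟨ ≡.sym (List.length-++ as) ⟩
      length (as ++ y ∷ bs)         ∎
    where
    open ℕ.≤-Reasoning
    g : ∀ {x′} → x′ ∈ xs → ∃[ y′ ] (y′ ∈ as ++ bs × R x′ y′)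
    g {x′} p with f (there p)
    ... | y′ , q , r′ with ∈-++⁻ as q
    ... | inj₁ h = y′ , ∈-++⁺ˡ h , r′
    ... | inj₂ (there h) = y′ , ∈-++⁺ʳ as h , r′
    ... | inj₂ (here ≡.refl) = contradiction (inj (here ≡.refl) (there p) r r′) (All.lookup x∉ p)

  length-⊆ : ∀ {A : Set} {xs ys : List A} → Unique xs → (∀ {x} → x ∈ xs → x ∈ ys) → length xs ℕ.≤ length ys
  length-⊆ {ys = ys} u f = length-injective _≡_ ys u (λ {x} p → x , f p , ≡.refl) λ _ _ e e′ → ≡.trans e (≡.sym e′)

  argmaxℕ : ∀ {A : Set} (f : A → ℕ) x xs → ∃[ y ] (y ∈ x ∷ xs × (∀ {z} → z ∈ x ∷ xs → f z ℕ.≤ f y))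
  argmaxℕ f x [] = x , here ≡.refl , λ { (here ≡.refl) → ℕ.≤-refl }
  argmaxℕ f x (x′ ∷ xs) with argmaxℕ f x′ xs
  ... | y , y∈ , h with ℕ.≤-total (f x) (f y)
  ... | inj₁ p = y , there y∈ , λ { (here ≡.refl) → p ; (there q) → h q }
  ... | inj₂ p = x , here ≡.refl , λ { (here ≡.refl) → ℕ.≤-refl ; (there q) → ℕ.≤-trans (h q) p }

  length-concatMap : ∀ {A B : Set} (g : A → List B) xs → length (concatMap g xs) ≡ ℕ.sum (map (length ∘ g) xs)
  length-concatMap g [] = ≡.refl
  length-concatMap g (x ∷ xs) = ≡.trans (List.length-++ (g x)) (≡.cong (length (g x) ℕ.+_) (length-concatMap g xs))

  concat-concatMap : ∀ {A B : Set} (g : A → List (List B)) xs → concat (concatMap g xs) ≡ concatMap (concat ∘ g) xs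
  concat-concatMap g [] = ≡.refl
  concat-concatMap g (x ∷ xs) = ≡.trans (≡.sym (List.concat-++ (g x) (concatMap g xs))) (≡.cong (concat (g x) ++_) (concat-concatMap g xs))

  map-pairs : ∀ {A B C : Set} (h : B → C) (xs : List A) ys →
    map (h ∘ proj₂) (concatMap (λ x → map (x ,_) ys) xs) ≡ concat (replicate (length xs) (map h ys))
  map-pairs h [] ys = ≡.refl
  map-pairs h (x ∷ xs) ys = ≡.trans (List.map-++ (h ∘ proj₂) (map (x ,_) ys) _)
    (≡.cong₂ _++_ (≡.sym (List.map-∘ ys)) (map-pairs h xs ys))

  map-concatMap : ∀ {A B C : Set} (h : B → C) (g : A → List B) xs → map h (concatMap g xs) ≡ concatMap (map h ∘ g) xs
  map-concatMap h g [] = ≡.refl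
  map-concatMap h g (x ∷ xs) = ≡.trans (List.map-++ h (g x) _) (≡.cong (map h (g x) ++_) (map-concatMap h g xs))

  length-cartesianProduct : ∀ {A B : Set} (xs : List A) (ys : List B) → length (cartesianProduct xs ys) ≡ length xs ℕ.* length ys
  length-cartesianProduct [] ys = ≡.refl
  length-cartesianProduct (x ∷ xs) ys = ≡.trans (List.length-++ (map (x ,_) ys))
    (≡.cong₂ ℕ._+_ (List.length-map (x ,_) ys) (length-cartesianProduct xs ys))

-- Finite sums and indicators

module Totals (ℝ : CompleteOrderedField) where

  open ClassBounds ℝ public
  open Lists public

  private variable
    A B : Set
    P Q : Set

  [_] : Dec P → Carrier
  [ yes _ ] = 1#
  [ no _ ]  = 0#

  0≤[] : (p : Dec P) → 0# ≤ [ p ]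
  0≤[] (yes _) = 0≤1
  0≤[] (no _)  = ≤-refl

  []≤1 : (p : Dec P) → [ p ] ≤ 1#
  []≤1 (yes _) = ≤-refl
  []≤1 (no _)  = 0≤1

  []-mono : (P → Q) → (p : Dec P) (q : Dec Q) → [ p ] ≤ [ q ]
  []-mono f (no _)  q       = 0≤[] q
  []-mono f (yes _) (yes _) = ≤-refl
  []-mono f (yes x) (no n)  = contradiction (f x) n

  []-yes : P → (p : Dec P) → [ p ] ≈ 1#
  []-yes x (yes _) = refl
  []-yes x (no n)  = contradiction x n

  []-no : ¬ P → (p : Dec P) → [ p ] ≈ 0#
  []-no n (yes x) = contradiction x n
  []-no n (no _)  = refl

  []*≤ : (p : Dec P) → ∀ {a b} → (P → a ≤ b) → 0# ≤ b → [ p ] * a ≤ b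
  []*≤ (yes x) h _ = ≤-trans (≤-reflexive (*-identityˡ _)) (h x)
  []*≤ (no _) _ h = ≤-trans (≤-reflexive (zeroˡ _)) h

  []≤ : (p : Dec P) → ∀ {b} → (P → 1# ≤ b) → 0# ≤ b → [ p ] ≤ b
  []≤ (yes x) h _ = h x
  []≤ (no _) _ h = h

  total-mono : ∀ {f g : A → Carrier} xs → (∀ {x} → x ∈ xs → f x ≤ g x) → total f xs ≤ total g xs
  total-mono []       h = ≤-refl
  total-mono (x ∷ xs) h = +-mono-≤ (h (here ≡.refl)) (total-mono xs (h ∘ there))

  total-cong : ∀ {f g : A → Carrier} xs → (∀ {x} → x ∈ xs → f x ≈ g x) → total f xs ≈ total g xs
  total-cong []       h = refl
  total-cong (x ∷ xs) h = +-cong (h (here ≡.refl)) (total-cong xs (h ∘ there))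

  total-nonNegative : ∀ {f : A → Carrier} xs → (∀ {x} → x ∈ xs → 0# ≤ f x) → 0# ≤ total f xs
  total-nonNegative []       h = ≤-refl
  total-nonNegative (x ∷ xs) h = +-nonNegative (h (here ≡.refl)) (total-nonNegative xs (h ∘ there))

  total-+ : ∀ (f g : A → Carrier) xs → total (λ x → f x + g x) xs ≈ total f xs + total g xs
  total-+ f g []       = sym (+-identityʳ 0#)
  total-+ f g (x ∷ xs) = trans (+-congˡ (total-+ f g xs))
    (solve 4 (λ a b c d → (a :+ b) :+ (c :+ d) := (a :+ c) :+ (b :+ d)) refl _ _ _ _)

  total-* : ∀ c (f : A → Carrier) xs → total (λ x → c * f x) xs ≈ c * total f xs
  total-* c f []       = sym (zeroʳ c)
  total-* c f (x ∷ xs) = trans (+-congˡ (total-* c f xs)) (sym (distribˡ _ _ _))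

  total-const : ∀ c (xs : List A) → total (λ _ → c) xs ≈ fromℕ (length xs) * c
  total-const c []       = sym (zeroˡ c)
  total-const c (x ∷ xs) = trans (+-cong (sym (*-identityˡ c)) (total-const c xs)) (sym (distribʳ _ _ _))

  total-0 : (xs : List A) → total (λ _ → 0#) xs ≈ 0#
  total-0 xs = trans (total-const 0# xs) (zeroʳ _)

  total-swap : ∀ (h : A → B → Carrier) xs ys →
    total (λ x → total (h x) ys) xs ≈ total (λ y → total (λ x → h x y) xs) ys
  total-swap h []       ys = sym (total-0 ys)
  total-swap h (x ∷ xs) ys = trans (+-congˡ (total-swap h xs ys))
    (sym (total-+ (h x) (λ y → total (λ x → h x y) xs) ys))

  total-++ : ∀ (f : A → Carrier) xs ys → total f (xs ++ ys) ≈ total f xs + total f ys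
  total-++ f []       ys = sym (+-identityˡ _)
  total-++ f (x ∷ xs) ys = trans (+-congˡ (total-++ f xs ys)) (sym (+-assoc _ _ _))

  total-map : ∀ (f : B → Carrier) (g : A → B) xs → total f (map g xs) ≡ total (f ∘ g) xs
  total-map f g []       = ≡.refl
  total-map f g (x ∷ xs) = ≡.cong (f (g x) +_) (total-map f g xs)

  total-concatMap : ∀ (f : B → Carrier) (g : A → List B) xs →
    total f (concatMap g xs) ≈ total (λ x → total f (g x)) xs
  total-concatMap f g []       = refl
  total-concatMap f g (x ∷ xs) = trans (total-++ f (g x) (concatMap g xs)) (+-congˡ (total-concatMap f g xs))

  total-applyUpTo : ∀ (f : A → Carrier) (g : ℕ → A) n → total f (applyUpTo g n) ≡ ∑< n (f ∘ g)
  total-applyUpTo f g zero    = ≡.refl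
  total-applyUpTo f g (suc n) = ≡.cong (f (g 0) +_) (total-applyUpTo f (g ∘ suc) n)

  total-filter : ∀ {P : A → Set} (P? : ∀ x → Dec (P x)) (f : A → Carrier) xs →
    total f (filter P? xs) ≈ total (λ x → [ P? x ] * f x) xs
  total-filter P? f [] = refl
  total-filter P? f (x ∷ xs) with P? x
  ... | yes _ = +-cong (sym (*-identityˡ _)) (total-filter P? f xs)
  ... | no _  = trans (total-filter P? f xs) (trans (sym (+-identityˡ _)) (+-congʳ (sym (zeroˡ _))))

  length-filter : ∀ {P : A → Set} (P? : ∀ x → Dec (P x)) xs →
    fromℕ (length (filter P? xs)) ≈ total (λ x → [ P? x ]) xs
  length-filter P? [] = refl
  length-filter P? (x ∷ xs) with P? x
  ... | yes _ = +-congˡ (length-filter P? xs)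
  ... | no _  = trans (length-filter P? xs) (sym (+-identityˡ _))

  fromℕ-sum : ∀ (f : A → ℕ) xs → fromℕ (ℕ.sum (map f xs)) ≈ total (fromℕ ∘ f) xs
  fromℕ-sum f []       = refl
  fromℕ-sum f (x ∷ xs) = trans (fromℕ-+ (f x) _) (+-congˡ (fromℕ-sum f xs))

  total-filter-mono : ∀ {P Q : A → Set} (P? : ∀ x → Dec (P x)) (Q? : ∀ x → Dec (Q x)) {f : A → Carrier} xs →
    (∀ {x} → x ∈ xs → 0# ≤ f x) → (∀ {x} → x ∈ xs → P x → Q x) → total f (filter P? xs) ≤ total f (filter Q? xs)
  total-filter-mono P? Q? {f} xs n h = ≤-resp₂ (sym (total-filter P? f xs)) (sym (total-filter Q? f xs))
    (total-mono xs λ {x} p → *-monoʳ-≤ (n p) ([]-mono (h p) (P? x) (Q? x)))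

  ∈-≤total : ∀ {f : A → Carrier} {x xs} → (∀ {y} → y ∈ xs → 0# ≤ f y) → x ∈ xs → f x ≤ total f xs
  ∈-≤total {xs = y ∷ xs} h (here ≡.refl) = x≤x+y (total-nonNegative xs (h ∘ there))
  ∈-≤total {xs = y ∷ xs} h (there p) = ≤-trans (∈-≤total (h ∘ there) p) (x≤y+x (h (here ≡.refl)))

  total-unique-≤1 : ∀ {P : A → Set} (P? : ∀ x → Dec (P x)) xs → Unique xs →
    (∀ {x y} → P x → P y → x ≡ y) → total (λ x → [ P? x ]) xs ≤ 1#
  total-unique-≤1 P? [] u h = 0≤1
  total-unique-≤1 P? (x ∷ xs) (x∉ ∷ u) h with P? x
  ... | no _ = ≤-trans (≤-reflexive (+-identityˡ _)) (total-unique-≤1 P? xs u h)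
  ... | yes p = ≤-reflexive (trans (+-congˡ (trans (total-cong xs λ {y} y∈ →
      []-no (λ py → All.lookup x∉ y∈ (h p py)) (P? y)) (total-0 xs))) (+-identityʳ 1#))

  -- The labels in `ms` are distinct, so nothing is counted twice, but they may miss values of `f`.
  -- `total-cover` is the opposite inequality, for labels that miss nothing.
  total-fibres : ∀ {C : Set} (_≟_ : DecidableEquality C) (f : A → C) {w : A → Carrier} ms xs → Unique ms →
    (∀ {x} → x ∈ xs → 0# ≤ w x) →
    total (λ m → total w (filter (λ x → f x ≟ m) xs)) ms ≤ total w xs
  total-fibres _≟_ f {w} ms xs u h = begin
    total (λ m → total w (filter (λ x → f x ≟ m) xs)) ms     ≈⟨ total-cong ms (λ {m} _ → total-filter (λ x → f x ≟ m) w xs) ⟩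
    total (λ m → total (λ x → [ f x ≟ m ] * w x) xs) ms      ≈⟨ total-swap (λ m x → [ f x ≟ m ] * w x) ms xs ⟩
    total (λ x → total (λ m → [ f x ≟ m ] * w x) ms) xs      ≤⟨ total-mono xs (λ {x} p → begin
      total (λ m → [ f x ≟ m ] * w x) ms    ≈⟨ total-cong ms (λ _ → *-comm _ _) ⟩
      total (λ m → w x * [ f x ≟ m ]) ms    ≈⟨ total-* (w x) (λ m → [ f x ≟ m ]) ms ⟩
      w x * total (λ m → [ f x ≟ m ]) ms    ≤⟨ *-monoˡ-≤ (h p) (total-unique-≤1 (λ m → f x ≟ m) ms u λ a b → ≡.trans (≡.sym a) b) ⟩
      w x * 1#                              ≈⟨ *-identityʳ _ ⟩
      w x ∎) ⟩
    total w xs ∎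
    where open ≤R

-- Next-Fit as a static algorithm

module Static (ℝ : CompleteOrderedField) where

  open Totals ℝ public

  Sizes : List Carrier → Set
  Sizes = All (λ w → 0# < w × w ≤ 1#)

  -- Bins are numbered from 0 in the order of opening, so the number of the active bin determines
  -- the count.
  opened : NFState → ℕ
  opened nothing        = 0
  opened (just (b , _)) = suc b

  nfRun : NFState → List Carrier → NFState
  nfRun = foldl (λ s w → proj₁ (nfPack s w))

  opened-pack : ∀ s w → opened (proj₁ (nfPack s w)) ≡ suc (proj₂ (nfPack s w))
  opened-pack nothing w = ≡.refl
  opened-pack (just (b , l)) w with l + w ≤? 1#
  ... | yes _ = ≡.refl
  ... | no _ = ≡.refl

  opened≤suc : ∀ s w → opened s ℕ.≤ suc (proj₂ (nfPack s w))
  opened≤suc nothing w = ℕ.z≤n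
  opened≤suc (just (b , l)) w with l + w ≤? 1#
  ... | yes _ = ℕ.≤-refl
  ... | no _ = ℕ.n≤1+n _

  bin≤opened : ∀ s w → proj₂ (nfPack s w) ℕ.≤ opened s
  bin≤opened nothing w = ℕ.≤-refl
  bin≤opened (just (b , l)) w with l + w ≤? 1#
  ... | yes _ = ℕ.n≤1+n _
  ... | no _ = ℕ.≤-refl

  opened-mono : ∀ s w → opened s ℕ.≤ opened (proj₁ (nfPack s w))
  opened-mono s w = ≡.subst (opened s ℕ.≤_) (≡.sym (opened-pack s w)) (opened≤suc s w)

  nfRun-mono : ∀ s ws → opened s ℕ.≤ opened (nfRun s ws)
  nfRun-mono s [] = ℕ.≤-refl
  nfRun-mono s (w ∷ ws) = ℕ.≤-trans (opened-mono s w) (nfRun-mono _ ws)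

  private
    -- A run from the empty state never gets ahead of the same run from a state
    -- with d open bins by more than one bin, and then its level is no higher.
    data Behind (d : ℕ) : NFState → NFState → Set where
      strictly : ∀ {u s} → opened u ℕ.+ d ℕ.≤ opened s → Behind d u s
      level    : ∀ {b l b′ l′} → b ℕ.+ d ≡ b′ ℕ.+ 1 → l ≤ l′ → Behind d (just (b , l)) (just (b′ , l′))

    Levels : NFState → Set
    Levels nothing        = 0# ≤ 0#
    Levels (just (_ , l)) = 0# ≤ l

    levels-pack : ∀ s {w} → 0# ≤ w → Levels s → Levels (proj₁ (nfPack s w))
    levels-pack nothing p h = p
    levels-pack (just (b , l)) {w} p h with l + w ≤? 1#
    ... | yes _ = +-nonNegative h p
    ... | no _ = p

    behind-pack : ∀ {d u s w} → 0# ≤ w → Levels u → Levels s → Behind d u s →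
                  Behind d (proj₁ (nfPack u w)) (proj₁ (nfPack s w))
    behind-pack {d} {nothing} {nothing} p hu hs (strictly h) with ℕ.n≤0⇒n≡0 h
    ... | ≡.refl = strictly ℕ.≤-refl
    behind-pack {d} {nothing} {just (b , l)} {w} p hu hs (strictly h) with l + w ≤? 1#
    behind-pack {d} {nothing} {just (b , l)} {w} p hu hs (strictly h) | no _ = strictly (ℕ.s≤s h)
    behind-pack {d} {nothing} {just (b , l)} {w} p hu hs (strictly h) | yes _ with ℕ.m≤n⇒m<n∨m≡n h
    ... | inj₁ d<  = strictly d<
    -- The moment at which the run from the empty state gets one bin ahead: the other run has put
    -- the same item on top of its active bin, so its level is at least `w`.
    ... | inj₂ ≡.refl = level (ℕ.+-comm 1 b) (x≤y+x hs)
    behind-pack {d} {just (b , l)} {nothing} p hu hs (strictly ())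
    behind-pack {d} {just (b , l)} {just (b′ , l′)} {w} p hu hs (strictly h) with l + w ≤? 1# | l′ + w ≤? 1#
    ... | yes _ | yes _ = strictly h
    ... | yes _ | no _ = strictly (ℕ.m≤n⇒m≤1+n h)
    ... | no _ | no _ = strictly (ℕ.s≤s h)
    ... | no _ | yes _ with ℕ.m≤n⇒m<n∨m≡n h
    ... | inj₁ lt = strictly lt
    ... | inj₂ e = level (≡.trans e (ℕ.+-comm 1 b′)) (x≤y+x hs)
    behind-pack {d} {just (b , l)} {just (b′ , l′)} {w} p hu hs (level e q) with l + w ≤? 1# | l′ + w ≤? 1#
    ... | yes _ | yes _ = level e (+-mono-≤ q ≤-refl)
    ... | yes _ | no _ = strictly (ℕ.≤-reflexive (≡.trans (≡.cong suc e) (≡.cong suc (ℕ.+-comm b′ 1))))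
    ... | no _ | no _ = level (≡.cong suc e) ≤-refl
    -- A run that is one bin ahead never gets two ahead: its level is the lower one, so whatever it
    -- refuses the other run refuses too.
    ... | no n | yes h = contradiction (≤-trans (+-mono-≤ q ≤-refl) h) n

    behind-run : ∀ {d u s} ws → All (0# ≤_) ws → Levels u → Levels s → Behind d u s → Behind d (nfRun u ws) (nfRun s ws)
    behind-run [] _ hu hs h = h
    behind-run {u = u} {s} (w ∷ ws) (p ∷ ps) hu hs h =
      behind-run ws ps (levels-pack u p hu) (levels-pack s p hs) (behind-pack p hu hs h)

    behind⇒≤ : ∀ {d u s} → Behind d u s → opened u ℕ.+ d ℕ.≤ suc (opened s)
    behind⇒≤ (strictly h) = ℕ.m≤n⇒m≤1+n h
    behind⇒≤ {d} (level {b} {l} {b′} e _) = ℕ.≤-reflexive (≡.cong suc (≡.trans e (ℕ.+-comm b′ 1)))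

    levels-run : ∀ s ws → All (0# ≤_) ws → Levels s → Levels (nfRun s ws)
    levels-run s [] _ h = h
    levels-run s (w ∷ ws) (p ∷ ps) h = levels-run _ ws ps (levels-pack s p h)

  nonempty : List Carrier → ℕ
  nonempty []      = 0
  nonempty (_ ∷ _) = 1

  nonempty≤1 : ∀ ws → nonempty ws ℕ.≤ 1
  nonempty≤1 [] = ℕ.z≤n
  nonempty≤1 (_ ∷ _) = ℕ.≤-refl

  -- A block that starts in the state left by its predecessors saves at most one bin over a fresh
  -- start, by `behind⇒≤`; an empty block saves none. Thus cutting a sequence into blocks costs at
  -- most one bin per nonempty block.
  nfRun-concat : ∀ s bs → Levels s → All (All (0# ≤_)) bs →
    ℕ.sum (map (λ b → opened (nfRun nothing b)) bs) ℕ.+ opened s ℕ.≤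
    opened (nfRun s (concat bs)) ℕ.+ ℕ.sum (map nonempty bs)
  nfRun-concat s [] hs h = ℕ.≤-reflexive (ℕ.+-comm 0 _)
  nfRun-concat s (b ∷ bs) hs (h ∷ hs′) = begin
      (o ℕ.+ r) ℕ.+ opened s                   ≡⟨ ≡.trans (≡.cong (ℕ._+ opened s) (ℕ.+-comm o r)) (ℕ.+-assoc r o _) ⟩
      r ℕ.+ (o ℕ.+ opened s)                   ≤⟨ ℕ.+-monoʳ-≤ r (one b h) ⟩
      r ℕ.+ (opened (nfRun s b) ℕ.+ nonempty b) ≡⟨ ≡.sym (ℕ.+-assoc r _ _) ⟩
      (r ℕ.+ opened (nfRun s b)) ℕ.+ nonempty b ≤⟨ ℕ.+-monoˡ-≤ (nonempty b) (nfRun-concat (nfRun s b) bs (levels-run s b h hs) hs′) ⟩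
      (opened (nfRun (nfRun s b) (concat bs)) ℕ.+ z) ℕ.+ nonempty b ≡⟨ ≡.cong (λ x → (opened x ℕ.+ z) ℕ.+ nonempty b) (≡.sym (List.foldl-++ _ s b (concat bs))) ⟩
      (opened (nfRun s (concat (b ∷ bs))) ℕ.+ z) ℕ.+ nonempty b ≡⟨ ℕ.+-assoc (opened (nfRun s (concat (b ∷ bs)))) z _ ⟩
      opened (nfRun s (concat (b ∷ bs))) ℕ.+ (z ℕ.+ nonempty b) ≡⟨ ≡.cong (opened (nfRun s (concat (b ∷ bs))) ℕ.+_) (ℕ.+-comm z _) ⟩
      opened (nfRun s (concat (b ∷ bs))) ℕ.+ (nonempty b ℕ.+ z) ∎
    where
    open ℕ.≤-Reasoning
    o = opened (nfRun nothing b)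
    r = ℕ.sum (map (λ b → opened (nfRun nothing b)) bs)
    z = ℕ.sum (map nonempty bs)
    one : ∀ b → All (0# ≤_) b → opened (nfRun nothing b) ℕ.+ opened s ℕ.≤ opened (nfRun s b) ℕ.+ nonempty b
    one [] h = ℕ.≤-reflexive (≡.sym (ℕ.+-identityʳ _))
    one (w ∷ ws) h = ℕ.≤-trans (behind⇒≤ (behind-run {u = nothing} {s} (w ∷ ws) h ≤-refl hs (strictly ℕ.≤-refl)))
      (ℕ.≤-reflexive (ℕ.+-comm 1 _))

  sizes : List Carrier → Carrier
  sizes = total (λ w → w)

  private
    -- Two consecutive bins together exceed level one.
    TwiceFull : Carrier → NFState → Set
    TwiceFull W nothing        = 0# ≤ W
    TwiceFull W (just (b , l)) = fromℕ b + l ≤ 2# * W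

    twiceFull-pack : ∀ {W} s {w} → 0# ≤ w → TwiceFull W s → TwiceFull (W + w) (proj₁ (nfPack s w))
    twiceFull-pack {W} nothing {w} p h = by-adding (+-mono-≤ (+-mono-≤ h h) p)
      (solve 2 (λ W w → (con 0 :+ w) :+ ((W :+ W) :+ w) := con 2 :* (W :+ w) :+ ((con 0 :+ con 0) :+ con 0)) refl W w)
    twiceFull-pack {W} (just (b , l)) {w} p h with l + w ≤? 1#
    ... | yes _ = by-adding (+-mono-≤ h p)
      (solve 4 (λ b l w W → (b :+ (l :+ w)) :+ (con 2 :* W :+ w) := con 2 :* (W :+ w) :+ ((b :+ l) :+ con 0)) refl (fromℕ b) l w W)
    ... | no n = by-adding (+-mono-≤ h (≰⇒≥ n))
      (solve 4 (λ b l w W → ((con 1 :+ b) :+ w) :+ (con 2 :* W :+ (l :+ w)) := con 2 :* (W :+ w) :+ ((b :+ l) :+ con 1)) refl (fromℕ b) l w W)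

    twiceFull-run : ∀ {W} s ws → All (0# ≤_) ws → Levels s → TwiceFull W s → TwiceFull (W + sizes ws) (nfRun s ws) × Levels (nfRun s ws)
    twiceFull-run {W} nothing [] _ hl h = ≤-trans h (≤-reflexive (sym (+-identityʳ W))) , hl
    twiceFull-run {W} (just _) [] _ hl h = ≤-trans h (≤-reflexive (*-congˡ (sym (+-identityʳ W)))) , hl
    twiceFull-run {W} s (w ∷ ws) (p ∷ ps) hl h with twiceFull-run (proj₁ (nfPack s w)) ws ps (levels-pack s p hl) (twiceFull-pack s p h)
    ... | t , l = tf-resp (nfRun s (w ∷ ws)) (+-assoc W w (sizes ws)) t , l
      where
      tf-resp : ∀ s {W W′} → W ≈ W′ → TwiceFull W s → TwiceFull W′ s
      tf-resp nothing e h = ≤-trans h (≤-reflexive e)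
      tf-resp (just _) e h = ≤-trans h (≤-reflexive (*-congˡ e))

  opened≤2size : ∀ ws → All (0# ≤_) ws → fromℕ (opened (nfRun nothing ws)) ≤ 2# * sizes ws + fromℕ (nonempty ws)
  opened≤2size [] _ = ≤-reflexive (sym (trans (+-identityʳ _) (zeroʳ 2#)))
  opened≤2size ws@(_ ∷ _) ps with nfRun nothing ws | twiceFull-run {0#} nothing ws ps ≤-refl ≤-refl
  ... | nothing | t , _ = +-nonNegative (*-nonNegative 0≤2 (≤-trans t (≤-reflexive (+-identityˡ _)))) (0≤fromℕ 1)
  ... | just (b , l) | t , l0 = by-adding (+-mono-≤ t l0)
    (solve 4 (λ b l W s → (con 1 :+ b) :+ (con 2 :* (con 0 :+ W) :+ l) := (con 2 :* W :+ (con 1 :+ con 0)) :+ ((b :+ l) :+ con 0)) refl (fromℕ b) l (sizes ws) 0#)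

  private
    -- Levels are recorded as multiples of 1/g because then a bin that refuses an item has level at
    -- least 1. Closed bins are therefore paid for by volume at factor 1, where `TwiceFull` gives
    -- factor 2.
    Full : ℕ → Carrier → NFState → Set
    Full g W nothing        = 0# ≤ W
    Full g W (just (b , l)) = fromℕ b + l ≤ W × ∃[ m ] l ≈ fromℕ m / fromℕ g

    module _ {g : ℕ} (1≤g : 1 ℕ.≤ g) where
      g≰0 = 1≤⇒≰0 1≤g

      full-pack : ∀ {W} s {w} → w ≈ 1# / fromℕ g → Full g W s → Full g (W + w) (proj₁ (nfPack s w))
      full-pack {W} nothing {w} e h = +-mono-≤ h ≤-refl , 1 , trans e (*-congʳ (sym (+-identityʳ 1#)))
      full-pack {W} (just (b , l)) {w} e (h , m , l≈) with l + w ≤? 1#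
      ... | yes _ = ≤-trans (≤-reflexive (sym (+-assoc _ _ _))) (+-mono-≤ h ≤-refl) , suc m ,
        trans (+-comm l w) (trans (+-cong e l≈) (sym (distribʳ _ _ _)))
      ... | no n = ≤-trans (≤-trans (+-mono-≤ (≤-reflexive (+-comm 1# _)) ≤-refl) (+-mono-≤ (+-mono-≤ ≤-refl 1≤l) ≤-refl))
           (+-mono-≤ h ≤-refl) , 1 , trans e (*-congʳ (sym (+-identityʳ 1#)))
        where
        -- Otherwise m + 1 ≤ g and the item would have fit.
        g≤m : g ℕ.≤ m
        g≤m with g ℕ.≤? m
        ... | yes p = p
        ... | no ¬p = contradiction (≤-trans (≤-reflexive (trans (+-comm l w) (trans (+-cong e l≈) (sym (distribʳ _ _ _)))))
                 (/≤ g≰0 (≤-trans (fromℕ-mono (ℕ.≰⇒> ¬p)) (≤-reflexive (sym (*-identityˡ _)))))) n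
        1≤l : 1# ≤ l
        1≤l = ≤-trans (≤/ g≰0 (≤-trans (≤-reflexive (*-identityˡ _)) (fromℕ-mono g≤m))) (≤-reflexive (sym l≈))

      full-run : ∀ {W} s ws → All (λ w → w ≈ 1# / fromℕ g) ws → Full g W s → Full g (W + sizes ws) (nfRun s ws)
      full-run {W} nothing [] _ h = ≤-trans h (≤-reflexive (sym (+-identityʳ W)))
      full-run {W} (just _) [] _ (h , r) = ≤-trans h (≤-reflexive (sym (+-identityʳ W))) , r
      full-run {W} s (w ∷ ws) (p ∷ ps) h = f-resp (nfRun s (w ∷ ws)) (+-assoc W w (sizes ws)) (full-run _ ws ps (full-pack s p h))
        where
        f-resp : ∀ s {W W′} → W ≈ W′ → Full g W s → Full g W′ s
        f-resp nothing e h = ≤-trans h (≤-reflexive e)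
        f-resp (just _) e (h , r) = ≤-trans h (≤-reflexive e) , r

  opened≤size : ∀ {g} → 1 ℕ.≤ g → ∀ ws → All (λ w → w ≈ 1# / fromℕ g) ws →
    fromℕ (opened (nfRun nothing ws)) ≤ sizes ws + fromℕ (nonempty ws)
  opened≤size 1≤g [] _ = ≤-reflexive (sym (+-identityʳ _))
  opened≤size {g} 1≤g ws@(_ ∷ _) ps with nfRun nothing ws | full-run 1≤g {0#} nothing ws ps ≤-refl
  ... | nothing | t = +-nonNegative (≤-trans t (≤-reflexive (+-identityˡ _))) (0≤fromℕ 1)
  ... | just (b , l) | t , m , e = by-adding (+-mono-≤ t (≤-trans (/-nonNegative (0≤fromℕ m) (1≤⇒≰0 1≤g)) (≤-reflexive (sym e))))
    (solve 3 (λ b l W → (con 1 :+ b) :+ ((con 0 :+ W) :+ l) := (W :+ (con 1 :+ con 0)) :+ ((b :+ l) :+ con 0)) refl (fromℕ b) l (sizes ws))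

-- Static packings, Harmonic and its asymptotic ratio

module HarmonicStatic (ℝ : CompleteOrderedField) where

  open Static ℝ public

  total-1 : ∀ {A : Set} (xs : List A) → total (λ _ → 1#) xs ≈ fromℕ (length xs)
  total-1 xs = trans (total-const 1# xs) (*-identityʳ _)

  total-replicate : ∀ {A : Set} (f : A → Carrier) m x → total f (replicate m x) ≈ fromℕ m * f x
  total-replicate f zero x = sym (zeroˡ _)
  total-replicate f (suc m) x = trans (+-congˡ (total-replicate f m x))
    (solve 2 (λ a m → a :+ m :* a := (con 1 :+ m) :* a) refl (f x) (fromℕ m))

  total-cover : ∀ {A C : Set} (_≟_ : DecidableEquality C) (f : A → C) {w : A → Carrier} ms xs →
    (∀ {x} → x ∈ xs → 0# ≤ w x) → (∀ {x} → x ∈ xs → f x ∈ ms) →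
    total w xs ≤ total (λ m → total w (filter (λ x → f x ≟ m) xs)) ms
  total-cover _≟_ f {w} ms xs n h = begin
    total w xs                                            ≤⟨ total-mono xs (λ {x} p → begin
      w x                                  ≈⟨ sym (trans (*-congʳ ([]-yes ≡.refl (f x ≟ f x))) (*-identityˡ _)) ⟩
      [ f x ≟ f x ] * w x                  ≤⟨ ∈-≤total {f = λ m → [ f x ≟ m ] * w x} (λ {m} _ → *-nonNegative (0≤[] (f x ≟ m)) (n p)) (h p) ⟩
      total (λ m → [ f x ≟ m ] * w x) ms   ∎) ⟩
    total (λ x → total (λ m → [ f x ≟ m ] * w x) ms) xs   ≈⟨ total-swap (λ x m → [ f x ≟ m ] * w x) xs ms ⟩
    total (λ m → total (λ x → [ f x ≟ m ] * w x) xs) ms   ≈⟨ total-cong ms (λ {m} _ → sym (total-filter (λ x → f x ≟ m) w xs)) ⟩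
    total (λ m → total w (filter (λ x → f x ≟ m) xs)) ms  ∎
    where open ≤R

  -- Removes an additive constant that does not depend on N: a positive difference d = x - y would
  -- bound all N by c / d.
  archimedean-≤ : ∀ {x y c} → (∀ N → fromℕ N * x ≤ fromℕ N * y + c) → x ≤ y
  archimedean-≤ {x} {y} {c} h with x ≤? y
  ... | yes p = p
  ... | no n = contradiction (λ N → ≤/ d≰0 (by-adding (h N)
        (trans (+-congˡ (+-congʳ refl)) (trans (solve 4 (λ N d y c → N :* d :+ (N :* y :+ c) := c :+ N :* (d :+ y)) refl (fromℕ N) d y c)
          (+-congˡ (*-congˡ (minus-+ y x))))))) (archimedean (c / d))
    where
    d = x + - y
    d≰0 : ¬ d ≤ 0#
    d≰0 r = n (≤-resp₂ (minus-+ y x) (+-identityˡ y) (+-mono-≤ r (≤-refl {y})))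

  total-lookup : ∀ (ws : List Carrier) → total (lookup ws) (allFin (length ws)) ≡ sizes ws
  total-lookup ws = ≡.trans (≡.sym (total-map (λ w → w) (lookup ws) (allFin (length ws))))
    (≡.cong sizes (≡.trans (List.map-tabulate id (lookup ws)) (List.tabulate-lookup ws)))

  All-lookup : ∀ {P : Carrier → Set} {ws} → All P ws → ∀ i → P (lookup ws i)
  All-lookup (p ∷ ps) Fin.zero = p
  All-lookup (p ∷ ps) (Fin.suc i) = All-lookup ps i

  sizes≤packable : ∀ {ws m} → All (0# ≤_) ws → Packable ws m → sizes ws ≤ fromℕ m
  sizes≤packable {ws} {m} h (f , fits) = begin
    sizes ws                                 ≡⟨ ≡.sym (total-lookup ws) ⟩
    total (lookup ws) (allFin (length ws))   ≤⟨ total-cover Fin._≟_ f {lookup ws} (allFin m) (allFin (length ws)) (λ {i} _ → All-lookup h i) (λ {i} _ → ∈-allFin (f i)) ⟩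
    total (λ b → total (lookup ws) (filter (λ i → f i Fin.≟ b) (allFin (length ws)))) (allFin m) ≤⟨ total-mono (allFin m) (λ {b} _ → fits b) ⟩
    total (λ _ → 1#) (allFin m)              ≈⟨ total-1 (allFin m) ⟩
    fromℕ (length (allFin m))                ≡⟨ ≡.cong fromℕ (List.length-tabulate {n = m} id) ⟩
    fromℕ m                                  ∎
    where open ≤R

  -- Excluded middle is not available for Packable, hence the double negation.
  staticOPT-exists : ∀ {ws m} → Packable ws m → ¬ ¬ (∃[ m′ ] (IsStaticOPT ws m′ × m′ ℕ.≤ m))
  staticOPT-exists {ws} {m} p none = <-rec (λ m′ → m′ ℕ.≤ m → ¬ Packable ws m′) least m ℕ.≤-refl p
    where
    least : ∀ m′ → (∀ {l} → l ℕ.< m′ → l ℕ.≤ m → ¬ Packable ws l) → m′ ℕ.≤ m → ¬ Packable ws m′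
    least m′ smaller m′≤m q = none (m′ , (q , λ l r → ℕ.≮⇒≥ λ l<m′ → smaller l<m′ (ℕ.<⇒≤ (ℕ.<-≤-trans l<m′ m′≤m)) r) , m′≤m)

  -- Lets bins be named by arbitrary labels. The number of an item's bin is the position at which
  -- its label is found in the list; items at one position share a label, so no bin holds more than
  -- its label allows.
  packable-labelled : ∀ {X L : Set} (_≟_ : DecidableEquality L) (size : X → Carrier) (label : X → L)
    (xs : List X) (labels : List L) → (∀ {x} → x ∈ xs → 0# ≤ size x) → (∀ {x} → x ∈ xs → label x ∈ labels) →
    (∀ l → total size (filter (λ x → label x ≟ l) xs) ≤ 1#) → Packable (map size xs) (length labels)
  packable-labelled {X} {L} _≟_ size label xs labels n h fits = bin xs h , λ b →
      ≤-trans (fibre xs n h b) (fits (lookup labels b))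
    where
    open ≤R
    bin : ∀ xs → (∀ {x} → x ∈ xs → label x ∈ labels) → Fin (length (map size xs)) → Fin (length labels)
    bin (x ∷ xs) h Fin.zero = Any.index (h (here ≡.refl))
    bin (x ∷ xs) h (Fin.suc i) = bin xs (h ∘ there) i
    index-lookup : ∀ {l} {ls : List L} (p : l ∈ ls) → l ≡ lookup ls (Any.index p)
    index-lookup (here ≡.refl) = ≡.refl
    index-lookup (there p) = index-lookup p
    fibre : ∀ xs → (∀ {x} → x ∈ xs → 0# ≤ size x) → (h : ∀ {x} → x ∈ xs → label x ∈ labels) → ∀ b →
      total (lookup (map size xs)) (filter (λ i → bin xs h i Fin.≟ b) (allFin (length (map size xs))))
        ≤ total size (filter (λ x → label x ≟ lookup labels b) xs)
    fibre xs n h b = ≤-resp₂ (sym (total-filter (λ i → bin xs h i Fin.≟ b) (lookup (map size xs)) (allFin _)))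
        (sym (total-filter (λ x → label x ≟ lookup labels b) size xs)) (go xs n h)
      where
      go : ∀ xs → (∀ {x} → x ∈ xs → 0# ≤ size x) → (h : ∀ {x} → x ∈ xs → label x ∈ labels) →
        total (λ i → [ bin xs h i Fin.≟ b ] * lookup (map size xs) i) (allFin (length (map size xs)))
          ≤ total (λ x → [ label x ≟ lookup labels b ] * size x) xs
      go [] n h = ≤-refl
      go (x ∷ xs) n h = +-mono-≤
        (*-monoʳ-≤ (n (here ≡.refl)) ([]-mono
          (λ e → ≡.trans (index-lookup (h (here ≡.refl))) (≡.cong (lookup labels) e))
          (Any.index (h (here ≡.refl)) Fin.≟ b) (label x ≟ lookup labels b)))
        (≤-trans (≤-reflexive (reflexive (≡.trans
            (≡.cong (total F) (≡.sym (List.map-tabulate id Fin.suc)))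
            (total-map F Fin.suc (allFin (length (map size xs)))))))
          (go xs (n ∘ there) (h ∘ there)))
        where
        F : Fin (suc (length (map size xs))) → Carrier
        F i = [ bin (x ∷ xs) h i Fin.≟ b ] * lookup (map size (x ∷ xs)) i

  -- A static algorithm that numbers the bins it opens in each of finitely many
  -- slots and whose only active bin in a slot is the last one.
  record BoundedSpace (A : StaticAlgorithm) : Set₁ where
    open StaticAlgorithm A
    field
      slots          : List ℕ
      slot index     : Bin → ℕ
      count          : State → ℕ → ℕ
      bin-injective  : ∀ {b b′} → slot b ≡ slot b′ → index b ≡ index b′ → b ≡ b′
      count-init     : ∀ c → count init c ≡ 0
      count-pack     : ∀ σ w → let σ′ , b = pack σ w in count σ′ (slot b) ≡ suc (index b)
      count-≤        : ∀ σ w → let σ′ , b = pack σ w in count σ (slot b) ℕ.≤ suc (index b)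
      count-mono     : ∀ σ w c → count σ c ℕ.≤ count (proj₁ (pack σ w)) c
      slot-∈         : ∀ σ {w} → 0# < w → w ≤ 1# → slot (proj₂ (pack σ w)) ∈ slots

    run : State → List Carrier → State
    run = foldl (λ σ w → proj₁ (pack σ w))

  nextFit-boundedSpace : BoundedSpace NextFit
  nextFit-boundedSpace = record
    { slots = 0 ∷ [] ; slot = λ _ → 0 ; index = id ; count = λ s _ → opened s
    ; bin-injective = λ _ e → e ; count-init = λ _ → ≡.refl ; count-pack = opened-pack
    ; count-≤ = opened≤suc ; count-mono = λ s w _ → opened-mono s w ; slot-∈ = λ _ _ _ → here ≡.refl }

  update-same : ∀ {A : Set} (f : ℕ → A) j {a} → update f j a j ≡ a
  update-same f j with j ℕ.≟ j
  ... | yes _ = ≡.refl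
  ... | no n = contradiction ≡.refl n

  update-other : ∀ {A : Set} (f : ℕ → A) {i j} {a} → ¬ i ≡ j → update f j a i ≡ f i
  update-other f {i} {j} n with i ℕ.≟ j
  ... | yes e = contradiction e n
  ... | no _ = ≡.refl

  slotsOf : ℕ → List ℕ
  slotsOf k = applyUpTo suc k

  harmonicClass-≤ : ∀ k w → harmonicClass k w ℕ.≤ k
  harmonicClass-≤ zero w = ℕ.z≤n
  harmonicClass-≤ (suc k) w with w ≤? 1# / fromℕ (suc k)
  ... | yes _ = ℕ.≤-refl
  ... | no _ = ℕ.m≤n⇒m≤1+n (harmonicClass-≤ k w)

  1≤harmonicClass : ∀ {k} → 1 ℕ.≤ k → ∀ {w} → w ≤ 1# → 1 ℕ.≤ harmonicClass k w
  1≤harmonicClass {suc k} _ {w} h = go k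
    where
    go : ∀ k → 1 ℕ.≤ harmonicClass (suc k) w
    go zero with w ≤? 1# / fromℕ 1
    ... | yes _ = ℕ.≤-refl
    ... | no n = contradiction (≤/ (fromℕ-suc≰0 0) (≤-trans (≤-reflexive (trans (*-congˡ (+-identityʳ 1#)) (*-identityʳ w))) h)) n
    go (suc k) with w ≤? 1# / fromℕ (suc (suc k))
    ... | yes _ = ℕ.s≤s ℕ.z≤n
    ... | no _ = go k

  harmonicClass-∈ : ∀ {k} → 1 ℕ.≤ k → ∀ {w} → w ≤ 1# → harmonicClass k w ∈ slotsOf k
  harmonicClass-∈ {k} 1≤k {w} h with harmonicClass k w | harmonicClass-≤ k w | 1≤harmonicClass 1≤k h
  ... | suc c | c<k | _ = ∈-applyUpTo⁺ suc c<k

  slotsOf-unique : ∀ k → Unique (slotsOf k)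
  slotsOf-unique k = Unique.applyUpTo⁺₁ suc k λ i<j _ e → ℕ.<⇒≢ i<j (ℕ.suc-injective e)

  harmonic-boundedSpace : ∀ {k} → 1 ℕ.≤ k → BoundedSpace (Harmonic k)
  harmonic-boundedSpace {k} 1≤k = record
    { slots = slotsOf k ; slot = proj₁ ; index = proj₂ ; count = λ σ c → opened (σ c)
    ; bin-injective = λ { ≡.refl ≡.refl → ≡.refl }
    ; count-init = λ _ → ≡.refl
    ; count-pack = λ σ w → ≡.trans (≡.cong opened (update-same σ (harmonicClass k w))) (opened-pack (σ (harmonicClass k w)) w)
    ; count-≤ = λ σ w → opened≤suc (σ (harmonicClass k w)) w
    ; count-mono = mono
    ; slot-∈ = λ σ _ h → harmonicClass-∈ 1≤k h }
    where
    mono : ∀ σ w c → opened (σ c) ℕ.≤ opened (update σ (harmonicClass k w) (proj₁ (nfPack (σ (harmonicClass k w)) w)) c)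
    mono σ w c with c ℕ.≟ harmonicClass k w
    ... | yes ≡.refl = opened-mono (σ c) w
    ... | no _ = ℕ.≤-refl

  module _ (k : ℕ) where

    private
      module H = StaticAlgorithm (Harmonic k)
      hRun : H.State → List Carrier → H.State
      hRun = foldl (λ σ w → proj₁ (H.pack σ w))

    inClass : ℕ → List Carrier → List Carrier
    inClass c = filter (λ w → harmonicClass k w ℕ.≟ c)

    harmonic-run : ∀ σ ws c → hRun σ ws c ≡ nfRun (σ c) (inClass c ws)
    harmonic-run σ [] c = ≡.refl
    harmonic-run σ (w ∷ ws) c = go (harmonicClass k w ℕ.≟ c)
      where
      j = harmonicClass k w
      σ′ = proj₁ (H.pack σ w)
      go : Dec (j ≡ c) → hRun σ′ ws c ≡ nfRun (σ c) (inClass c (w ∷ ws))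
      go (yes e) = ≡.trans (harmonic-run σ′ ws c)
        (≡.trans (≡.cong (λ s → nfRun s (inClass c ws)) (≡.subst (λ c → σ′ c ≡ proj₁ (nfPack (σ c) w)) e (update-same σ j)))
                 (≡.cong (nfRun (σ c)) (≡.sym (List.filter-accept (λ w → harmonicClass k w ℕ.≟ c) e))))
      go (no n) = ≡.trans (harmonic-run σ′ ws c)
        (≡.trans (≡.cong (λ s → nfRun s (inClass c ws)) (update-other σ λ e → n (≡.sym e)))
                 (≡.cong (nfRun (σ c)) (≡.sym (List.filter-reject (λ w → harmonicClass k w ℕ.≟ c) n))))

    private
      packed-upper : ∀ σ ws {c b} → (c , b) ∈ H.packAll σ ws → b ℕ.< opened (hRun σ ws c)
      packed-upper σ (w ∷ ws) {c} (here ≡.refl) = ℕ.≤-trans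
        (ℕ.≤-reflexive (≡.sym (≡.trans (≡.cong opened (update-same σ c)) (opened-pack (σ c) w))))
        (ℕ.≤-trans (nfRun-mono _ (inClass c ws)) (ℕ.≤-reflexive (≡.cong opened (≡.sym (harmonic-run _ ws c)))))
      packed-upper σ (w ∷ ws) (there p) = packed-upper _ ws p

      packed-class : 1 ℕ.≤ k → ∀ σ ws {c b} → Sizes ws → (c , b) ∈ H.packAll σ ws → c ∈ slotsOf k
      packed-class 1≤k σ (w ∷ ws) (h ∷ hs) (here ≡.refl) = harmonicClass-∈ 1≤k (proj₂ h)
      packed-class 1≤k σ (w ∷ ws) (h ∷ hs) (there p) = packed-class 1≤k _ ws hs p

      -- Next-Fit numbers its bins without gaps, so every number that the count passes during the
      -- run names a bin that has received an item.
      packed-lower : ∀ σ ws c b → opened (σ c) ℕ.≤ b → b ℕ.< opened (hRun σ ws c) → (c , b) ∈ H.packAll σ ws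
      packed-lower σ [] c b p r = contradiction p (ℕ.<⇒≱ r)
      packed-lower σ (w ∷ ws) c b p r = go (c ℕ.≟ harmonicClass k w)
        where
        σ′ = proj₁ (H.pack σ w)
        go : Dec (c ≡ harmonicClass k w) → (c , b) ∈ H.packAll σ (w ∷ ws)
        go (no n) = there (packed-lower σ′ ws c b (≡.subst (λ s → opened s ℕ.≤ b) (≡.sym (update-other σ n)) p) r)
        go (yes ≡.refl) with b ℕ.<? opened (σ′ c)
        ... | no b≮ = there (packed-lower σ′ ws c b (ℕ.≮⇒≥ b≮) r)
        ... | yes b< = here (≡.cong (c ,_) (ℕ.≤-antisym
              (ℕ.s≤s⁻¹ (ℕ.≤-trans b< (ℕ.≤-reflexive (≡.trans (≡.cong opened (update-same σ c)) (opened-pack (σ c) w)))))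
              (ℕ.≤-trans (bin≤opened (σ c) w) p)))

    -- The number of bins as a sum over the size classes, a form to which `nfRun-concat` applies.
    -- `opened∑≤bins` and `bins≤opened∑` relate it to the official count.
    opened∑ : List Carrier → Carrier
    opened∑ ws = total (λ c → fromℕ (opened (nfRun nothing (inClass c ws)))) (slotsOf k)

    private
      _≟ᵇ_ = Product.≡-dec ℕ._≟_ ℕ._≟_

    opened∑≤bins : ∀ ws → opened∑ ws ≤ fromℕ (H.bins ws)
    opened∑≤bins ws = begin
      opened∑ ws ≤⟨ total-mono (slotsOf k) (λ {c} _ → begin
        fromℕ (opened (nfRun nothing (inClass c ws)))  ≡⟨ ≡.cong (fromℕ ∘ opened) (≡.sym (harmonic-run H.init ws c)) ⟩
        fromℕ (opened (hRun H.init ws c))                ≤⟨ fromℕ-mono (count c) ⟩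
        fromℕ (length (filter (λ x → proj₁ x ℕ.≟ c) bs)) ≈⟨ sym (total-1 (filter (λ x → proj₁ x ℕ.≟ c) bs)) ⟩
        total (λ _ → 1#) (filter (λ x → proj₁ x ℕ.≟ c) bs) ∎) ⟩
      total (λ c → total (λ _ → 1#) (filter (λ x → proj₁ x ℕ.≟ c) bs)) (slotsOf k) ≤⟨ total-fibres ℕ._≟_ proj₁ (slotsOf k) bs (slotsOf-unique k) (λ _ → 0≤1) ⟩
      total (λ _ → 1#) bs ≈⟨ total-1 bs ⟩
      fromℕ (H.bins ws) ∎
      where
      open ≤R
      bs = deduplicate _≟ᵇ_ (H.packAll H.init ws)
      count : ∀ c → opened (hRun H.init ws c) ℕ.≤ length (filter (λ x → proj₁ x ℕ.≟ c) bs)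
      count c = ≡.subst (ℕ._≤ length (filter (λ x → proj₁ x ℕ.≟ c) bs)) (≡.trans (List.length-map (c ,_) (upTo (opened (hRun H.init ws c)))) (List.length-upTo _))
        (length-⊆ (Unique.map⁺ (λ e → Product.,-injectiveʳ e) (Unique.upTo⁺ (opened (hRun H.init ws c)))) λ p →
          let b , b∈ , e = ∈-map⁻ (c ,_) p in
          ≡.subst (_∈ _) (≡.sym e) (∈-filter⁺ (λ x → proj₁ x ℕ.≟ c)
            (∈-deduplicate⁺ _≟ᵇ_ (packed-lower H.init ws c b ℕ.z≤n (∈-upTo⁻ b∈))) ≡.refl))

    bins≤opened∑ : 1 ℕ.≤ k → ∀ {ws} → Sizes ws → fromℕ (H.bins ws) ≤ opened∑ ws
    bins≤opened∑ 1≤k {ws} h = begin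
      fromℕ (H.bins ws)         ≤⟨ fromℕ-mono (length-⊆ (UniqueDec.deduplicate-! _≟ᵇ_ (H.packAll H.init ws)) sub) ⟩
      fromℕ (length codes)      ≈⟨ sym (total-1 codes) ⟩
      total (λ _ → 1#) codes    ≈⟨ total-concatMap (λ _ → 1#) row (slotsOf k) ⟩
      total (λ c → total (λ _ → 1#) (row c)) (slotsOf k) ≈⟨ total-cong (slotsOf k) (λ {c} _ → trans (total-1 (row c))
        (reflexive (≡.cong fromℕ (≡.trans (List.length-map (c ,_) (upTo (cnt c))) (List.length-upTo (cnt c)))))) ⟩
      opened∑ ws ∎
      where
      open ≤R
      cnt : ℕ → ℕ
      cnt c = opened (nfRun nothing (inClass c ws))
      row : ℕ → List (ℕ × ℕ)
      row c = map (c ,_) (upTo (cnt c))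
      codes = concatMap row (slotsOf k)
      sub : ∀ {x} → x ∈ deduplicate _≟ᵇ_ (H.packAll H.init ws) → x ∈ codes
      sub {c , b} p = ∈-concatMap⁺ row (lose (packed-class 1≤k H.init ws h q)
          (∈-map⁺ (c ,_) (∈-upTo⁺ (≡.subst (b ℕ.<_) (≡.cong opened (harmonic-run H.init ws c)) (packed-upper H.init ws q)))))
        where
        q = ∈-deduplicate⁻ _≟ᵇ_ (H.packAll H.init ws) p

    harmonic-opened≤ : ∀ ws → Sizes ws → opened∑ ws ≤ 2# * sizes ws + fromℕ k * fromℕ (nonempty ws)
    harmonic-opened≤ [] _ = ≤-reflexive (trans (total-0 (slotsOf k)) (sym (trans (+-cong (zeroʳ _) (zeroʳ _)) (+-identityʳ 0#))))
    harmonic-opened≤ ws@(_ ∷ _) h = begin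
      opened∑ ws ≤⟨ total-mono (slotsOf k) (λ {c} _ → ≤-trans (opened≤2size (inClass c ws) (All.filter⁺ (λ w → harmonicClass k w ℕ.≟ c) h′))
                     (+-monoʳ-≤ _ (fromℕ-mono (nonempty≤1 (inClass c ws))))) ⟩
      total (λ c → 2# * sizes (inClass c ws) + fromℕ 1) (slotsOf k) ≈⟨ total-+ _ (λ _ → fromℕ 1) (slotsOf k) ⟩
      total (λ c → 2# * sizes (inClass c ws)) (slotsOf k) + total (λ _ → fromℕ 1) (slotsOf k)
        ≈⟨ +-cong (total-* 2# (λ c → sizes (inClass c ws)) (slotsOf k)) (trans (total-const (fromℕ 1) (slotsOf k)) (*-congʳ (reflexive (≡.cong fromℕ (List.length-applyUpTo suc k))))) ⟩
      2# * total (λ c → sizes (inClass c ws)) (slotsOf k) + fromℕ k * fromℕ 1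
        ≤⟨ +-mono-≤ (*-monoˡ-≤ 0≤2 (total-fibres ℕ._≟_ (harmonicClass k) (slotsOf k) ws (slotsOf-unique k) (All.lookup h′))) ≤-refl ⟩
      2# * sizes ws + fromℕ k * fromℕ 1 ∎
      where
      open ≤R
      h′ : All (0# ≤_) ws
      h′ = All.map (proj₁ ∘ proj₁) h

    -- N items of size one fill N bins, so a negative ratio would eventually make the bound
    -- negative. Nonnegativity allows upper bounds on the optimum to be multiplied by ρ.
    bound-nonNegative : ∀ {ρ} → IsAsymptoticBound (Harmonic k) ρ → 0# ≤ ρ
    bound-nonNegative {ρ} (c , h) with 0# ≤? ρ
    ... | yes p = p
    ... | no n = archimedean-≤ {0#} {ρ} {c} λ N → ≤-stable λ ¬p →
        staticOPT-exists {replicate N 1#} {N} (packable N) λ { (m , opt , m≤N) → ¬p (begin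
          fromℕ N * 0#                     ≈⟨ zeroʳ _ ⟩
          0#                               ≤⟨ 0≤fromℕ (H.bins (replicate N 1#)) ⟩
          fromℕ (H.bins (replicate N 1#))  ≤⟨ h (replicate N 1#) (All.replicate⁺ N ((0≤1 , 0≉1) , ≤-refl)) m opt ⟩
          ρ * fromℕ m + c                  ≤⟨ +-mono-≤ (neg-mono (≰⇒≥ n) (begin
             fromℕ N                         ≈⟨ sym (trans (total-replicate (λ w → w) N 1#) (*-identityʳ _)) ⟩
             sizes (replicate N 1#)          ≤⟨ sizes≤packable (All.replicate⁺ N 0≤1) (proj₁ opt) ⟩
             fromℕ m                         ∎)) ≤-refl ⟩
          ρ * fromℕ N + c                  ≈⟨ +-congʳ (*-comm _ _) ⟩
          fromℕ N * ρ + c                  ∎) }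
      where
      open ≤R
      packable : ∀ N → Packable (replicate N 1#) N
      packable N = ≡.subst₂ Packable (≡.trans (map-const (upTo N)) (≡.cong (λ n → replicate n 1#) (List.length-upTo N))) (List.length-upTo N)
        (packable-labelled ℕ._≟_ (λ _ → 1#) id (upTo N) (upTo N) (λ _ → 0≤1) id
          λ l → ≤-trans (≤-reflexive (trans (total-filter (λ x → x ℕ.≟ l) (λ _ → 1#) (upTo N)) (total-cong (upTo N) λ _ → *-identityʳ _)))
            (total-unique-≤1 (λ x → x ℕ.≟ l) (upTo N) (Unique.upTo⁺ N) λ { ≡.refl ≡.refl → ≡.refl }))
        where
        map-const : ∀ (xs : List ℕ) → map (λ _ → 1#) xs ≡ replicate (length xs) 1#
        map-const [] = ≡.refl
        map-const (x ∷ xs) = ≡.cong (1# ∷_) (map-const xs)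
      neg-mono : ∀ {x y} → ρ ≤ 0# → x ≤ y → ρ * y ≤ ρ * x
      neg-mono {x} {y} r≤ xy = by-adding (*-monoʳ-≤ (0≤-minus xy) r≤)
        (trans (+-congˡ (zeroˡ _)) (trans (+-identityʳ _) (trans (*-congˡ (trans (sym (minus-+ x y)) (+-comm _ _))) (distribˡ _ _ _))))

    -- Some asymptotic bound has to exist for the infimum `Π k` to be meaningful. Two consecutive
    -- bins of a class exceed level one; the constant k pays for the last bin of every class.
    2-bound : 1 ℕ.≤ k → IsAsymptoticBound (Harmonic k) 2#
    2-bound 1≤k = fromℕ k , λ ws h m opt → begin
      fromℕ (H.bins ws)  ≤⟨ bins≤opened∑ 1≤k h ⟩
      opened∑ ws         ≤⟨ harmonic-opened≤ ws h ⟩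
      2# * sizes ws + fromℕ k * fromℕ (nonempty ws) ≤⟨ +-mono-≤
         (*-monoˡ-≤ 0≤2 (sizes≤packable (All.map (proj₁ ∘ proj₁) h) (proj₁ opt)))
         (≤-trans (*-monoˡ-≤ (0≤fromℕ k) (≤-trans (fromℕ-mono (nonempty≤1 ws)) (≤-reflexive (+-identityʳ 1#)))) (≤-reflexive (*-identityʳ _))) ⟩
      2# * fromℕ m + fromℕ k ∎
      where
      open ≤R

    ≤Π : ∀ {x} → 1 ℕ.≤ k → (∀ ρ → IsAsymptoticBound (Harmonic k) ρ → x ≤ ρ) → x ≤ Π k
    ≤Π 1≤k h = inf-greatest {IsAsymptoticBound (Harmonic k)} (- 2# , respects (sym (-‿involutive 2#)) (2-bound 1≤k)) h
      where
      respects : ∀ {ρ ρ′} → ρ ≈ ρ′ → IsAsymptoticBound (Harmonic k) ρ → IsAsymptoticBound (Harmonic k) ρ′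
      respects e (c , f) = c , λ ws hs m o → ≤-trans (f ws hs m o) (≤-reflexive (+-congʳ (*-congʳ e)))

    0≤Π : 1 ℕ.≤ k → 0# ≤ Π k
    0≤Π 1≤k = ≤Π 1≤k λ ρ → bound-nonNegative

    inClass-concat : ∀ c bs → inClass c (concat bs) ≡ concat (map (inClass c) bs)
    inClass-concat c [] = ≡.refl
    inClass-concat c (b ∷ bs) = ≡.trans (List.filter-++ _ b (concat bs)) (≡.cong (inClass c b ++_) (inClass-concat c bs))

    -- An instance of `nfRun-concat` in each of the k slots, each losing at most one bin per
    -- nonempty block.
    opened∑-blocks : ∀ bs → All Sizes bs →
      total opened∑ bs ≤ fromℕ (H.bins (concat bs)) + fromℕ k * total (λ b → fromℕ (nonempty b)) bs
    opened∑-blocks bs hs = begin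
      total opened∑ bs ≈⟨ total-swap (λ b c → fromℕ (opened (nfRun nothing (inClass c b)))) bs (slotsOf k) ⟩
      total (λ c → total (λ b → fromℕ (opened (nfRun nothing (inClass c b)))) bs) (slotsOf k) ≤⟨ total-mono (slotsOf k) (λ {c} _ → slotwise c) ⟩
      total (λ c → fromℕ (opened (nfRun nothing (inClass c (concat bs)))) + N) (slotsOf k)
        ≈⟨ trans (total-+ _ (λ _ → N) (slotsOf k)) (+-congˡ (trans (total-const N (slotsOf k)) (*-congʳ (reflexive (≡.cong fromℕ (List.length-applyUpTo suc k)))))) ⟩
      opened∑ (concat bs) + fromℕ k * N ≤⟨ +-mono-≤ (opened∑≤bins (concat bs)) ≤-refl ⟩
      fromℕ (H.bins (concat bs)) + fromℕ k * N ∎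
      where
      open ≤R
      N = total (λ b → fromℕ (nonempty b)) bs
      nonempty-filter : ∀ c b → nonempty (inClass c b) ℕ.≤ nonempty b
      nonempty-filter c [] = ℕ.z≤n
      nonempty-filter c b@(_ ∷ _) with inClass c b
      ... | [] = ℕ.z≤n
      ... | _ ∷ _ = ℕ.≤-refl
      slotwise : ∀ c → total (λ b → fromℕ (opened (nfRun nothing (inClass c b)))) bs
        ≤ fromℕ (opened (nfRun nothing (inClass c (concat bs)))) + N
      slotwise c = begin
        total (λ b → fromℕ (opened (nfRun nothing (inClass c b)))) bs
          ≡⟨ ≡.sym (total-map (λ b → fromℕ (opened (nfRun nothing b))) (inClass c) bs) ⟩
        total (λ b → fromℕ (opened (nfRun nothing b))) bs′ ≈⟨ sym (fromℕ-sum (λ b → opened (nfRun nothing b)) bs′) ⟩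
        fromℕ (ℕ.sum (map (λ b → opened (nfRun nothing b)) bs′)) ≤⟨ fromℕ-mono (ℕ.≤-trans (ℕ.m≤m+n _ 0) (nfRun-concat nothing bs′ ≤-refl
           (All.map⁺ (All.map (λ h → All.filter⁺ _ (All.map (proj₁ ∘ proj₁) h)) hs)))) ⟩
        fromℕ (opened (nfRun nothing (concat bs′)) ℕ.+ ℕ.sum (map nonempty bs′)) ≈⟨ trans (fromℕ-+ (opened (nfRun nothing (concat bs′))) _) (+-congˡ (fromℕ-sum nonempty bs′)) ⟩
        fromℕ (opened (nfRun nothing (concat bs′))) + total (λ b → fromℕ (nonempty b)) bs′
          ≡⟨ ≡.cong₂ (λ ws t → fromℕ (opened (nfRun nothing ws)) + t) (≡.sym (inClass-concat c bs)) (total-map (λ b → fromℕ (nonempty b)) (inClass c) bs) ⟩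
        fromℕ (opened (nfRun nothing (inClass c (concat bs)))) + total (λ b → fromℕ (nonempty (inClass c b))) bs
          ≤⟨ +-monoʳ-≤ _ (total-mono bs λ {b} _ → fromℕ-mono (nonempty-filter c b)) ⟩
        fromℕ (opened (nfRun nothing (inClass c (concat bs)))) + N ∎
        where bs′ = map (inClass c) bs

    blocks : ℕ → (ℕ → ℕ) → (ℕ → List Carrier) → List ℕ → List (List Carrier)
    blocks N a s = concatMap (λ j → replicate (N ℕ.* a j) (s j))

    total-blocks : ∀ f N a s js → total f (blocks N a s js) ≈ fromℕ N * total (λ j → fromℕ (a j) * f (s j)) js
    total-blocks f N a s js = trans (total-concatMap f (λ j → replicate (N ℕ.* a j) (s j)) js)
      (trans (total-cong js λ {j} _ → trans (total-replicate f (N ℕ.* a j) (s j)) (trans (*-congʳ (fromℕ-* N (a j))) (*-assoc _ _ _)))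
        (total-* (fromℕ N) (λ j → fromℕ (a j) * f (s j)) js))

    -- Each block is repeated N a(j) times; as N grows, the additive constant of
    -- an asymptotic bound disappears.
    harmonic-amortized : 1 ℕ.≤ k → ∀ js a s O → (∀ {j} → j ∈ js → Sizes (s j)) →
      (∀ N → Packable (concat (blocks N a s js)) (N ℕ.* O)) →
      total (λ j → fromℕ (a j) * opened∑ (s j)) js
        ≤ Π k * fromℕ O + fromℕ k * total (λ j → fromℕ (a j) * fromℕ (nonempty (s j))) js
    harmonic-amortized 1≤k js a s O hs pk = finish O (λ ρ b → bound ρ b)
      where
      open ≤R
      X = total (λ j → fromℕ (a j) * opened∑ (s j)) js
      U = total (λ j → fromℕ (a j) * fromℕ (nonempty (s j))) js
      bsizes : ∀ N → All Sizes (blocks N a s js)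
      bsizes N = All.concat⁺ (All.map⁺ (All.tabulate λ {j} p → All.replicate⁺ (N ℕ.* a j) (hs p)))
      bound : ∀ ρ → IsAsymptoticBound (Harmonic k) ρ → X ≤ ρ * fromℕ O + fromℕ k * U
      bound ρ (c , h) = archimedean-≤ {c = c} λ N → ≤-stable λ ¬p → staticOPT-exists {concat (blocks N a s js)} (pk N) λ { (m , opt , m≤) → ¬p (begin
          fromℕ N * X                                      ≈⟨ sym (total-blocks opened∑ N a s js) ⟩
          total opened∑ (blocks N a s js)                  ≤⟨ opened∑-blocks (blocks N a s js) (bsizes N) ⟩
          fromℕ (H.bins (concat (blocks N a s js))) + fromℕ k * total (λ b → fromℕ (nonempty b)) (blocks N a s js)
            ≤⟨ +-mono-≤ (h (concat (blocks N a s js)) (All.concat⁺ (bsizes N)) m opt) (≤-reflexive (*-congˡ (total-blocks (λ b → fromℕ (nonempty b)) N a s js))) ⟩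
          ρ * fromℕ m + c + fromℕ k * (fromℕ N * U)
            ≤⟨ +-mono-≤ (+-mono-≤ (*-monoˡ-≤ (bound-nonNegative (c , h)) (≤-trans (fromℕ-mono m≤) (≤-reflexive (fromℕ-* N O)))) ≤-refl) ≤-refl ⟩
          ρ * (fromℕ N * fromℕ O) + c + fromℕ k * (fromℕ N * U)
            ≈⟨ solve 6 (λ r N O c k U → r :* (N :* O) :+ c :+ k :* (N :* U) := N :* (r :* O :+ k :* U) :+ c) refl ρ (fromℕ N) (fromℕ O) c (fromℕ k) U ⟩
          fromℕ N * (ρ * fromℕ O + fromℕ k * U) + c        ∎) }
      -- Passing from all ρ to their infimum divides by `fromℕ O`. For O = 0 the term with ρ
      -- vanishes, and any single bound, here 2, will do.
      finish : ∀ O → (∀ ρ → IsAsymptoticBound (Harmonic k) ρ → X ≤ ρ * fromℕ O + fromℕ k * U) → X ≤ Π k * fromℕ O + fromℕ k * U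
      finish zero b = ≤-trans (b 2# (2-bound 1≤k)) (≤-reflexive (+-congʳ (trans (zeroʳ _) (sym (zeroʳ _)))))
      finish (suc O) b = begin
        X                      ≈⟨ sym (minus-+ (fromℕ k * U) X) ⟩
        (X + - (fromℕ k * U)) + fromℕ k * U ≤⟨ +-mono-≤ (/≤⁻ n (≤Π 1≤k λ ρ r → /≤ n
             (+-cancelʳ-≤ (fromℕ k * U) (≤-trans (≤-reflexive (minus-+ (fromℕ k * U) X)) (b ρ r))))) ≤-refl ⟩
        Π k * fromℕ (suc O) + fromℕ k * U ∎
        where n = fromℕ-suc≰0 O

-- Runs of the Combined Algorithm and the machines of First-Fit

module Trace (ℝ : CompleteOrderedField) (A : BinPacking.StaticAlgorithm ℝ) (bs : HarmonicStatic.BoundedSpace ℝ A)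
  (I : BinPacking.Instance ℝ) (V : CompleteOrderedField.Carrier ℝ) (class : Fin (BinPacking.Instance.n I) → ℕ) where

  open HarmonicStatic ℝ
  open Instance I public
  open StaticAlgorithm A
  open BoundedSpace bs
  open Combined A I V class
  open Placed public
  open Configuration

  Alive : ℕ → Placed → Set
  Alive t p = ActiveAt t (job p)

  alive : ℕ → List Placed → List Placed
  alive t = filter (activeAt? t ∘ job)

  weight : List Placed → Carrier
  weight = total (size ∘ job)

  0≤size : ∀ i → 0# ≤ size i
  0≤size i = proj₁ (0<size i)

  openIn : List Placed → Fin n → Origin → List Placed
  openIn H i o = filter (λ p → origin p ≟ᵒ o) (alive (start i) H)

  classLoad : List Placed → Fin n → Carrier
  classLoad H i = weight (filter (λ p → class (job p) ℕ.≟ class i) (alive (start i) H)) + size i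

  machineLevel : List Placed → Fin n → ℕ → Carrier
  machineLevel H i m = weight (filter (λ p → machine p ℕ.≟ m) (alive (start i) H))

  firstFitMachine : List Placed → Fin n → ℕ
  firstFitMachine H i = Extrema.min (toℕ i)
    (filter (λ m → machineLevel H i m + size i ≤? 1#) (map machine (openIn H i nothing)))

  binMachine : List Placed → Fin n → Origin → ℕ
  binMachine H i o = fromMaybe (toℕ i) (head (map machine (openIn H i o)))

  -- The reachable configurations as an inductive relation, so that invariants are proved by
  -- induction over arrivals. The bound on earlier job numbers records the arrival order.
  data Run : (ℕ → State) → List Placed → Set where
    empty : Run (λ _ → init) []
    firstFit : ∀ {S H} → Run S H → ∀ i → (∀ {p} → p ∈ H → job p Fin.< i) →
      classLoad H i ≤ threshold V (class i) →
      Run S (placed i nothing (firstFitMachine H i) ∷ H)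
    byCopy : ∀ {S H} → Run S H → ∀ i → (∀ {p} → p ∈ H → job p Fin.< i) →
      ¬ classLoad H i ≤ threshold V (class i) →
      let σ , b = pack (S (class i)) (size i)
          o = just (class i , b) in
      Run (update S (class i) σ) (placed i o (binMachine H i o) ∷ H)

  private
    run-step : ∀ C i → Run (static C) (history C) → (∀ {p} → p ∈ history C → job p Fin.< i) →
      Run (static (step C i)) (history (step C i)) × (map job (history (step C i)) ≡ i ∷ map job (history C))
    run-step C i r h with classLoad (history C) i ≤? threshold V (class i)
    ... | yes q = firstFit r i h q , ≡.refl
    ... | no n = byCopy r i h n , ≡.refl

    run-steps : ∀ C xs → Run (static C) (history C) → AllPairs Fin._<_ xs →
      (∀ {p x} → p ∈ history C → x ∈ xs → job p Fin.< x) →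
      Run (static (foldl step C xs)) (history (foldl step C xs))
        × (∀ f → total f (map job (history (foldl step C xs))) ≈ total f (map job (history C)) + total f xs)
    run-steps C [] r _ h = r , λ f → sym (+-identityʳ _)
    run-steps C (x ∷ xs) r (x< ∷ s) h with run-step C x r (λ p → h p (here ≡.refl))
    ... | r′ , e with run-steps (step C x) xs r′ s later
      where
      later : ∀ {p y} → p ∈ history (step C x) → y ∈ xs → job p Fin.< y
      later {p} q y∈ with ≡.subst (job p ∈_) e (∈-map⁺ job q)
      ... | here eq = ≡.subst (Fin._< _) (≡.sym eq) (All.lookup x< y∈)
      ... | there q′ = let p′ , p′∈ , eq = ∈-map⁻ job q′ in ≡.subst (Fin._< _) (≡.sym eq) (h p′∈ (there y∈))
    ... | r″ , tot = r″ , λ f → trans (tot f) (trans (+-congʳ (reflexive (≡.cong (total f) e)))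
        (solve 3 (λ a b c → (a :+ b) :+ c := b :+ (a :+ c)) refl _ _ _))

    run-all = run-steps (configuration (λ _ → init) []) (allFin n) empty (AllPairs.tabulate⁺-< λ i<j → i<j) λ ()

  run-final : Run (static final) (history final)
  run-final = proj₁ run-all

  -- Expresses, in the form in which it is used, that every interval is placed exactly once.
  total-history : ∀ f → total (f ∘ job) (history final) ≈ total f (allFin n)
  total-history f = trans (reflexive (≡.sym (total-map f job (history final)))) (trans (proj₂ run-all f) (+-identityˡ _))

  -- Earlier jobs start no later than `i`. This carries whatever was tested when `i` arrived over to
  -- every later time at which the jobs concerned are still active.
  alive-earlier : ∀ {H i t p} → (∀ {p} → p ∈ H → job p Fin.< i) → p ∈ H → start i ℕ.≤ t → Alive t p → Alive (start i) p
  alive-earlier h p∈ s≤t (_ , t<e) = start-mono (ℕ.<⇒≤ (h p∈)) , ℕ.≤-<-trans s≤t t<e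

  private
    ∈-alive : ∀ {t p H} → p ∈ H → Alive t p → p ∈ alive t H
    ∈-alive {t} p∈ a = ∈-filter⁺ (activeAt? t ∘ job) p∈ a

    alive⁻ : ∀ {t p} H → p ∈ alive t H → p ∈ H × Alive t p
    alive⁻ {t} H = ∈-filter⁻ (activeAt? t ∘ job) {xs = H}

    openIn⁻ : ∀ {H i o p} → p ∈ openIn H i o → p ∈ H × Alive (start i) p × origin p ≡ o
    openIn⁻ {H} {i} {o} p∈ with ∈-filter⁻ (λ p → origin p ≟ᵒ o) {xs = alive (start i) H} p∈
    ... | q , e with alive⁻ H q
    ... | r , a = r , a , e

    openIn⁺ : ∀ {H i o p} → p ∈ H → Alive (start i) p → origin p ≡ o → p ∈ openIn H i o
    openIn⁺ {H} {i} {o} p∈ a e = ∈-filter⁺ (λ p → origin p ≟ᵒ o) (∈-alive p∈ a) e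

  firstFitMachine-cases : ∀ H i → firstFitMachine H i ≡ toℕ i ⊎
    ∃[ p ] (p ∈ H × Alive (start i) p × origin p ≡ nothing × machine p ≡ firstFitMachine H i)
  firstFitMachine-cases H i with Extrema.argmin-sel id (toℕ i)
    (filter (λ m → machineLevel H i m + size i ≤? 1#) (map machine (openIn H i nothing)))
  ... | inj₁ e = inj₁ e
  ... | inj₂ m∈ with ∈-map⁻ machine (proj₁ (∈-filter⁻ (λ m → machineLevel H i m + size i ≤? 1#) {xs = map machine (openIn H i nothing)} m∈))
  ... | p , p∈ , e with openIn⁻ p∈
  ... | q , a , o = inj₂ (p , q , a , o , ≡.sym e)

  firstFitMachine-first : ∀ {H i p} → p ∈ H → Alive (start i) p → origin p ≡ nothing →
    machine p ℕ.< firstFitMachine H i → ¬ machineLevel H i (machine p) + size i ≤ 1#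
  firstFitMachine-first {H} {i} {p} p∈ a o lt fits = ℕ.<⇒≱ lt
    (All.lookup (Extrema.min≤xs (toℕ i) (filter (λ m → machineLevel H i m + size i ≤? 1#) (map machine (openIn H i nothing))))
      (∈-filter⁺ (λ m → machineLevel H i m + size i ≤? 1#) (∈-map⁺ machine (openIn⁺ p∈ a o)) fits))

  binMachine-cases : ∀ H i o → (binMachine H i o ≡ toℕ i × (∀ {p} → p ∈ H → Alive (start i) p → ¬ origin p ≡ o)) ⊎
    ∃[ p ] (p ∈ H × Alive (start i) p × origin p ≡ o × machine p ≡ binMachine H i o)
  binMachine-cases H i o with openIn H i o in eq
  ... | [] = inj₁ (≡.refl , λ {p} p∈ a e → contradiction (≡.subst (p ∈_) eq (openIn⁺ p∈ a e)) λ ())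
  ... | p ∷ ps with openIn⁻ (≡.subst (p ∈_) (≡.sym eq) (here ≡.refl))
  ... | q , a , e = inj₂ (p , q , a , e , ≡.refl)

  -- A machine bears the number of the job that opened it; consequently the number of an arriving
  -- job is a name not yet in use.
  machine≤job : ∀ {S H} → Run S H → ∀ {p} → p ∈ H → machine p ℕ.≤ toℕ (job p)
  machine≤job (firstFit {H = H} r i h _) (here ≡.refl) with firstFitMachine-cases H i
  ... | inj₁ e = ℕ.≤-reflexive e
  ... | inj₂ (p , p∈ , _ , _ , e) = ℕ.≤-trans (≡.subst (ℕ._≤ _) e (machine≤job r p∈)) (ℕ.<⇒≤ (h p∈))
  machine≤job (firstFit r i h _) (there p∈) = machine≤job r p∈
  machine≤job (byCopy {S} {H} r i h _) (here ≡.refl) with binMachine-cases H i (just (class i , proj₂ (pack (S (class i)) (size i))))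
  ... | inj₁ (e , _) = ℕ.≤-reflexive e
  ... | inj₂ (p , p∈ , _ , _ , e) = ℕ.≤-trans (≡.subst (ℕ._≤ _) e (machine≤job r p∈)) (ℕ.<⇒≤ (h p∈))
  machine≤job (byCopy r i h _) (there p∈) = machine≤job r p∈

  private
    SameOrigin : List Placed → Set
    SameOrigin H = ∀ {p p′} → p ∈ H → p′ ∈ H → machine p ≡ machine p′ → origin p ≡ origin p′

    sameOrigin-cons : ∀ {S H} → Run S H → ∀ {i m o} → (∀ {p} → p ∈ H → job p Fin.< i) → SameOrigin H →
      (m ≡ toℕ i ⊎ ∃[ p ] (p ∈ H × origin p ≡ o × machine p ≡ m)) → SameOrigin (placed i o m ∷ H)
    sameOrigin-cons r {i} {m} {o} h same c = go
      where
      new : ∀ {p′} → p′ ∈ _ → m ≡ machine p′ → o ≡ origin p′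
      new p′∈ e = new′ p′∈ e c
        where
        new′ : ∀ {p′} → p′ ∈ _ → m ≡ machine p′ → (m ≡ toℕ i ⊎ ∃[ p ] (p ∈ _ × origin p ≡ o × machine p ≡ m)) → o ≡ origin p′
        new′ p′∈ e (inj₁ e′) = contradiction (≡.trans (≡.sym e) e′) (ℕ.<⇒≢ (ℕ.≤-<-trans (machine≤job r p′∈) (h p′∈)))
        new′ p′∈ e (inj₂ (p , p∈ , op , mp)) = ≡.trans (≡.sym op) (same p∈ p′∈ (≡.trans mp e))
      go : SameOrigin (placed i o m ∷ _)
      go (here ≡.refl) (here ≡.refl) e = ≡.refl
      go (here ≡.refl) (there q) e = new q e
      go (there q) (here ≡.refl) e = ≡.sym (new q (≡.sym e))
      go (there q) (there q′) e = same q q′ e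

  same-machine⇒same-origin : ∀ {S H} → Run S H → SameOrigin H
  same-machine⇒same-origin empty ()
  same-machine⇒same-origin (firstFit {H = H} r i h _) = sameOrigin-cons r h (same-machine⇒same-origin r) (c (firstFitMachine-cases H i))
    where
    c : _ → _
    c (inj₁ e) = inj₁ e
    c (inj₂ (p , p∈ , _ , o , e)) = inj₂ (p , p∈ , o , e)
  same-machine⇒same-origin (byCopy {H = H} r i h _) = sameOrigin-cons r h (same-machine⇒same-origin r) (c (binMachine-cases H i _))
    where
    c : _ → _
    c (inj₁ (e , _)) = inj₁ e
    c (inj₂ (p , p∈ , _ , o , e)) = inj₂ (p , p∈ , o , e)

  private
    SameBin : List Placed → Set
    SameBin H = ∀ {p p′ x t} → p ∈ H → p′ ∈ H → origin p ≡ just x → origin p′ ≡ just x → Alive t p → Alive t p′ → machine p ≡ machine p′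

  -- `head` picks just one open job of the bin, but by induction all jobs of the bin that are active
  -- when `i` arrives share a machine, so the choice is immaterial.
  same-bin⇒same-machine : ∀ {S H} → Run S H → SameBin H
  same-bin⇒same-machine empty ()
  same-bin⇒same-machine (firstFit r i h _) (there q) (there q′) = same-bin⇒same-machine r q q′
  same-bin⇒same-machine (firstFit r i h _) (here ≡.refl) q′ ()
  same-bin⇒same-machine (firstFit r i h _) (there q) (here ≡.refl) e ()
  same-bin⇒same-machine (byCopy r i h _) (here ≡.refl) (here ≡.refl) e e′ a a′ = ≡.refl
  same-bin⇒same-machine (byCopy r i h _) (there q) (there q′) = same-bin⇒same-machine r q q′
  same-bin⇒same-machine (byCopy {S} {H} r i h _) {t = t} = λ
      { (here ≡.refl) (there q) ≡.refl e (s≤t , _) a → new q e s≤t a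
      ; (there q) (here ≡.refl) e ≡.refl a (s≤t , _) → ≡.sym (new q e s≤t a)
      ; (here ≡.refl) (here ≡.refl) _ _ _ _ → ≡.refl
      ; (there q) (there q′) → same-bin⇒same-machine r q q′ }
    where
    o = just (class i , proj₂ (pack (S (class i)) (size i)))
    new : ∀ {p} → p ∈ H → origin p ≡ o → start i ℕ.≤ t → Alive t p → binMachine H i o ≡ machine p
    new p∈ e s≤t a with binMachine-cases H i o | alive-earlier h p∈ s≤t a
    ... | inj₁ (_ , none) | a′ = contradiction e (none p∈ a′)
    ... | inj₂ (p′ , p′∈ , b , op , mp) | a′ = ≡.trans (≡.sym mp) (same-bin⇒same-machine r p′∈ p∈ op e b a′)

  isFirstFit? : ∀ p → Dec (origin p ≡ nothing)
  isFirstFit? p = origin p ≟ᵒ nothing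

  firstFitClass : ℕ → ℕ → List Placed → List Placed
  firstFitClass j t = filter (λ p → isFirstFit? p ×-dec (class (job p) ℕ.≟ j ×-dec activeAt? t (job p)))

  weight-filter-mono : ∀ {P Q : Placed → Set} (P? : ∀ p → Dec (P p)) (Q? : ∀ p → Dec (Q p)) H →
    (∀ {p} → p ∈ H → P p → Q p) → weight (filter P? H) ≤ weight (filter Q? H)
  weight-filter-mono P? Q? H = total-filter-mono P? Q? H (λ {p} _ → 0≤size (job p))

  weight-cons : ∀ {P : Placed → Set} (P? : ∀ p → Dec (P p)) p H → weight (filter P? (p ∷ H)) ≈ [ P? p ] * size (job p) + weight (filter P? H)
  weight-cons P? p H = trans (total-filter P? (size ∘ job) (p ∷ H)) (+-congˡ (sym (total-filter P? (size ∘ job) H)))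

  total-filter-filter : ∀ {A : Set} {P Q : A → Set} (P? : ∀ x → Dec (P x)) (Q? : ∀ x → Dec (Q x)) (f : A → Carrier) xs →
    total f (filter P? (filter Q? xs)) ≈ total f (filter (λ x → P? x ×-dec Q? x) xs)
  total-filter-filter P? Q? f [] = refl
  total-filter-filter P? Q? f (x ∷ xs) with Q? x
  total-filter-filter P? Q? f (x ∷ xs) | yes _ with P? x
  ... | yes _ = +-congˡ (total-filter-filter P? Q? f xs)
  ... | no _ = total-filter-filter P? Q? f xs
  total-filter-filter P? Q? f (x ∷ xs) | no _ with P? x
  ... | yes _ = total-filter-filter P? Q? f xs
  ... | no _ = total-filter-filter P? Q? f xs

  -- When the last First-Fit job of the class arrives, all the others in
  -- question are active and count towards the load tested then.
  firstFitClass≤threshold : ¬ V ≤ 0# → ∀ {S H} → Run S H → ∀ j t →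
    weight (firstFitClass (suc j) t H) ≤ threshold V (suc j)
  firstFitClass≤threshold V≰0 empty j t = threshold-nonNegative V≰0 j
  firstFitClass≤threshold V≰0 (byCopy r i h _) j t = firstFitClass≤threshold V≰0 r j t
  firstFitClass≤threshold V≰0 (firstFit {H = H} r i h le) j t = go (class i ℕ.≟ suc j ×-dec activeAt? t i)
    where
    P? : ∀ p → Dec (origin p ≡ nothing × class (job p) ≡ suc j × Alive t p)
    P? p = isFirstFit? p ×-dec (class (job p) ℕ.≟ suc j ×-dec activeAt? t (job p))
    new = placed i nothing (firstFitMachine H i)
    go : Dec (class i ≡ suc j × ActiveAt t i) → weight (filter P? (new ∷ H)) ≤ threshold V (suc j)
    go (no n) = ≤-trans (≤-reflexive (trans (weight-cons P? new H)
        (trans (+-congʳ (trans (*-congʳ ([]-no (λ (_ , x) → n x) (P? new))) (zeroˡ _))) (+-identityˡ _))))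
      (firstFitClass≤threshold V≰0 r j t)
    go (yes (c , s≤t , t<e)) = ≤-trans (≤-trans (≤-reflexive (weight-cons P? new H))
        (≤-trans (≤-reflexive (trans (+-comm _ _) (+-congˡ (trans (*-congʳ ([]-yes (≡.refl , c , s≤t , t<e) (P? new))) (*-identityˡ _)))))
          (+-mono-≤ (≤-trans
            (weight-filter-mono P? (λ p → class (job p) ℕ.≟ class i ×-dec activeAt? (start i) (job p)) H
               λ p∈ (_ , c′ , a) → ≡.trans c′ (≡.sym c) , alive-earlier h p∈ s≤t a)
            (≤-reflexive (sym (total-filter-filter (λ p → class (job p) ℕ.≟ class i) (activeAt? (start i) ∘ job) (size ∘ job) H)))) ≤-refl)))
      (≡.subst (λ c → classLoad H i ≤ threshold V c) c le)

  -- The level that `x` met on arrival, recovered from a history that has grown since: only jobs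
  -- numbered below `x` count.
  machineLevelBefore : List Placed → Fin n → ℕ → Carrier
  machineLevelBefore H x m = weight (filter (λ p → machine p ℕ.≟ m ×-dec (job p Fin.<? x ×-dec activeAt? (start x) (job p))) H)

  private
    levelBefore-cons : ∀ H p {x m} → ¬ job p Fin.< x → machineLevelBefore (p ∷ H) x m ≈ machineLevelBefore H x m
    levelBefore-cons H p {x} {m} n = trans (weight-cons P? p H)
        (trans (+-congʳ (trans (*-congʳ ([]-no (λ (_ , l , _) → n l) (P? p))) (zeroˡ _))) (+-identityˡ _))
      where
      P? : ∀ p → Dec (machine p ≡ m × job p Fin.< x × Alive (start x) p)
      P? p = machine p ℕ.≟ m ×-dec (job p Fin.<? x ×-dec activeAt? (start x) (job p))

    levelBefore-here : ∀ H p {x m} → (∀ {p} → p ∈ H → job p Fin.< x) → job p ≡ x → machineLevel H x m ≤ machineLevelBefore (p ∷ H) x m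
    levelBefore-here H p {x} {m} h e = ≤-trans
      (≤-reflexive (total-filter-filter (λ p → machine p ℕ.≟ m) (activeAt? (start x) ∘ job) (size ∘ job) H))
      (≤-trans (weight-filter-mono _ (λ p → machine p ℕ.≟ m ×-dec (job p Fin.<? x ×-dec activeAt? (start x) (job p))) H λ p∈ (a , b) → a , h p∈ , b)
        (≤-reflexive (sym (levelBefore-cons H p (λ l → ℕ.<-irrefl (≡.cong toℕ e) l)))))

    -- The common time `t` ensures that the lower machine was already open when `p` arrived, even if
    -- `p′` itself came later.
    FirstFitOrder : List Placed → Set
    FirstFitOrder H = ∀ {p p′ t} → p ∈ H → p′ ∈ H → origin p ≡ nothing → origin p′ ≡ nothing → Alive t p → Alive t p′ →
      machine p′ ℕ.< machine p → ¬ machineLevelBefore H (job p) (machine p′) + size (job p) ≤ 1#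

    order-cons : ∀ {S H} → Run S H → ∀ {i o m} → (∀ {p} → p ∈ H → job p Fin.< i) → FirstFitOrder H →
      (o ≡ nothing → m ≡ firstFitMachine H i) → FirstFitOrder (placed i o m ∷ H)
    order-cons {H = H} r {i} {o} {m} h ih e = λ
      { (here ≡.refl) (here ≡.refl) _ _ _ _ lt → contradiction lt (ℕ.<-irrefl ≡.refl)
      ; (here ≡.refl) (there q) o₁ o₂ (s≤t , _) a lt fits →
          firstFitMachine-first q (alive-earlier h q s≤t a) o₂ (≡.subst (_ ℕ.<_) (e o₁) lt)
            (≤-trans (+-mono-≤ (levelBefore-here H (placed i o m) h ≡.refl) ≤-refl) fits)
      ; (there q) (here ≡.refl) o₁ o₂ a (s≤t , _) lt fits → later q o₁ (e o₂) (alive-earlier h q s≤t a) lt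
          (≤-trans (≤-reflexive (+-congʳ (sym (old q)))) fits)
      ; (there q) (there q′) o₁ o₂ a a′ lt fits → ih q q′ o₁ o₂ a a′ lt (≤-trans (≤-reflexive (+-congʳ (sym (old q)))) fits) }
      where
      old : ∀ {p m′} → p ∈ H → machineLevelBefore (placed i o m ∷ H) (job p) m′ ≈ machineLevelBefore H (job p) m′
      old q = levelBefore-cons H (placed i o m) (ℕ.<-asym (h q))
      -- Here the newcomer `i` joins a machine with a smaller number than that of the older `p`.
      -- This machine was not opened for `i`, so it carries an older job active at the arrival of
      -- `i`, as `p` is, and the induction hypothesis applies to that job in place of `i`.
      later : ∀ {p} → p ∈ H → origin p ≡ nothing → m ≡ firstFitMachine H i → Alive (start i) p → m ℕ.< machine p →
        ¬ machineLevelBefore H (job p) m + size (job p) ≤ 1#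
      later q o₁ ≡.refl a lt with firstFitMachine-cases H i
      ... | inj₁ e′ = contradiction (≡.subst (ℕ._< _) e′ lt) (ℕ.<-asym (ℕ.≤-<-trans (machine≤job r q) (h q)))
      ... | inj₂ (p″ , q″ , a″ , o″ , e″) = ≡.subst (λ m → ¬ machineLevelBefore H _ m + _ ≤ 1#) e″
              (ih q q″ o₁ o″ a a″ (≡.subst (ℕ._< _) (≡.sym e″) lt))

  firstFitOrder : ∀ {S H} → Run S H → FirstFitOrder H
  firstFitOrder empty ()
  firstFitOrder (firstFit r i h _) = order-cons r h (firstFitOrder r) λ _ → ≡.refl
  firstFitOrder (byCopy r i h _) = order-cons r h (firstFitOrder r) λ ()

  classes : ℕ → List ℕ
  classes J = applyUpTo suc J

  private
    FF? : ∀ t p → Dec (origin p ≡ nothing × Alive t p)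
    FF? t p = isFirstFit? p ×-dec activeAt? t (job p)

  firstFitLoad≤ : ¬ V ≤ 0# → ∀ {S H} J → Run S H → (∀ i → class i ∈ classes J) → ∀ t →
    weight (filter (FF? t) H) ≤ ∑< J (λ j → threshold V (suc j))
  firstFitLoad≤ V≰0 {H = H} J r c∈ t = begin
    weight (filter (FF? t) H) ≤⟨ total-cover ℕ._≟_ (class ∘ job) (classes J) (filter (FF? t) H) (λ {p} _ → 0≤size (job p)) (λ {p} _ → c∈ (job p)) ⟩
    total (λ c → weight (filter (λ p → class (job p) ℕ.≟ c) (filter (FF? t) H))) (classes J) ≤⟨ total-mono (classes J) (λ {c} c∈ → per c (∈-applyUpTo⁻ suc c∈)) ⟩
    total (threshold V) (classes J) ≡⟨ total-applyUpTo (threshold V) suc J ⟩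
    ∑< J (λ j → threshold V (suc j)) ∎
    where
    open ≤R
    per : ∀ c → ∃[ j ] (j ℕ.< J × c ≡ suc j) → weight (filter (λ p → class (job p) ℕ.≟ c) (filter (FF? t) H)) ≤ threshold V c
    per .(suc j) (j , _ , ≡.refl) = ≤-trans
      (≤-reflexive (total-filter-filter (λ p → class (job p) ℕ.≟ suc j) (FF? t) (size ∘ job) H))
      (≤-trans (weight-filter-mono _ (λ p → isFirstFit? p ×-dec (class (job p) ℕ.≟ suc j ×-dec activeAt? t (job p))) H
                  λ _ (c , o , a) → o , c , a)
        (firstFitClass≤threshold V≰0 r j t))

  onFirstFit? : ∀ t m p → Dec (origin p ≡ nothing × machine p ≡ m × Alive t p)
  onFirstFit? t m p = isFirstFit? p ×-dec (machine p ℕ.≟ m ×-dec activeAt? t (job p))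

  -- Let x be the job of size at most 1/2 on the last-opened machine carrying
  -- such a job.  Earlier machines were more than half full when x arrived,
  -- and the jobs on later machines are larger than 1/2.
  firstFit-machines : ¬ V ≤ 0# → ∀ {S H} J → Run S H → (∀ i → class i ∈ classes J) → ∀ ms → Unique ms → ∀ t →
    total (λ m → [ Any.any? (onFirstFit? t m) H ]) ms ≤ 1# + 4# * ∑< J (λ j → threshold V (suc j))
  firstFit-machines V≰0 {S} {H} J r c∈ ms ums t = go small ≡.refl
    where
    open ≤R
    L = ∑< J (λ j → threshold V (suc j))
    Small? : ∀ p → Dec ((origin p ≡ nothing × Alive t p) × size (job p) ≤ ½)
    Small? p = FF? t p ×-dec size (job p) ≤? ½
    small = filter Small? H
    levelAt : ℕ → ℕ → Carrier
    levelAt s m = weight (filter (λ p → machine p ℕ.≟ m) (filter (FF? s) H))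
    0≤levelAt : ∀ s m → 0# ≤ levelAt s m
    0≤levelAt s m = total-nonNegative (filter (λ p → machine p ℕ.≟ m) (filter (FF? s) H)) λ {p} _ → 0≤size (job p)
    ∑levelAt : ∀ s → total (levelAt s) ms ≤ L
    ∑levelAt s = ≤-trans (total-fibres ℕ._≟_ machine ms (filter (FF? s) H) ums λ {p} _ → 0≤size (job p)) (firstFitLoad≤ V≰0 J r c∈ s)
    0≤2* : ∀ {x} → 0# ≤ x → 0# ≤ 2# * x
    0≤2* = *-nonNegative 0≤2
    0≤L : 0# ≤ L
    0≤L = ∑<-nonNegative J λ j → threshold-nonNegative V≰0 j
    double : ∀ {x} → ½ ≤ x → 1# ≤ 2# * x
    double {x} h = ≤-trans (≤-reflexive (sym ½+½)) (≤-trans (+-mono-≤ h h) (≤-reflexive (solve 1 (λ x → x :+ x := con 2 :* x) refl x)))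
    big : ∀ {p m} → p ∈ H → origin p ≡ nothing → machine p ≡ m → Alive t p → ¬ size (job p) ≤ ½ → 1# ≤ 2# * levelAt t m
    big {p} {m} p∈ o e a n = double (≤-trans (≰⇒≥ n) (∈-≤total {f = size ∘ job} (λ {p} _ → 0≤size (job p))
      (∈-filter⁺ (λ p → machine p ℕ.≟ m) (∈-filter⁺ (FF? t) p∈ (o , a)) e)))
    go : ∀ xs → small ≡ xs → total (λ m → [ Any.any? (onFirstFit? t m) H ]) ms ≤ 1# + 4# * L
    go [] eq = begin
      total (λ m → [ Any.any? (onFirstFit? t m) H ]) ms ≤⟨ total-mono ms (λ {m} _ → []≤ (Any.any? (onFirstFit? t m) H)
          (λ any → let p , p∈ , o , e , a = find any in big p∈ o e a λ h →
             contradiction (≡.subst (p ∈_) eq (∈-filter⁺ Small? p∈ ((o , a) , h))) λ ())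
          (0≤2* (0≤levelAt t m))) ⟩
      total (λ m → 2# * levelAt t m) ms ≈⟨ total-* 2# (levelAt t) ms ⟩
      2# * total (levelAt t) ms  ≤⟨ *-monoˡ-≤ 0≤2 (∑levelAt t) ⟩
      2# * L                     ≤⟨ x≤y+x (+-nonNegative 0≤1 (0≤2* 0≤L)) ⟩
      1# + 2# * L + 2# * L       ≈⟨ solve 1 (λ L → con 1 :+ con 2 :* L :+ con 2 :* L := con 1 :+ con 4 :* L) refl L ⟩
      1# + 4# * L ∎
    go (y ∷ ys) eq with argmaxℕ machine y ys
    ... | x , x∈ , largest = begin
      total (λ m → [ Any.any? (onFirstFit? t m) H ]) ms ≤⟨ total-mono ms (λ {m} _ → []≤ (Any.any? (onFirstFit? t m) H) (found m)
          (+-nonNegative (+-nonNegative (0≤[] (m ℕ.≟ machine x)) (0≤2* (0≤levelAt s m))) (0≤2* (0≤levelAt t m)))) ⟩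
      total (λ m → [ m ℕ.≟ machine x ] + 2# * levelAt s m + 2# * levelAt t m) ms
        ≈⟨ trans (total-+ _ (λ m → 2# * levelAt t m) ms) (+-cong (trans (total-+ (λ m → [ m ℕ.≟ machine x ]) (λ m → 2# * levelAt s m) ms)
             (+-congˡ (total-* 2# (levelAt s) ms))) (total-* 2# (levelAt t) ms)) ⟩
      total (λ m → [ m ℕ.≟ machine x ]) ms + 2# * total (levelAt s) ms + 2# * total (levelAt t) ms
        ≤⟨ +-mono-≤ (+-mono-≤ (total-unique-≤1 (λ m → m ℕ.≟ machine x) ms ums λ e e′ → ≡.trans e (≡.sym e′))
             (*-monoˡ-≤ 0≤2 (∑levelAt s))) (*-monoˡ-≤ 0≤2 (∑levelAt t)) ⟩
      1# + 2# * L + 2# * L       ≈⟨ solve 1 (λ L → con 1 :+ con 2 :* L :+ con 2 :* L := con 1 :+ con 4 :* L) refl L ⟩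
      1# + 4# * L ∎
      where
      s = start (job x)
      xs = ∈-filter⁻ Small? {xs = H} (≡.subst (x ∈_) (≡.sym eq) x∈)
      x∈H = proj₁ xs
      found : ∀ m → Any (λ p → origin p ≡ nothing × machine p ≡ m × Alive t p) H →
        1# ≤ [ m ℕ.≟ machine x ] + 2# * levelAt s m + 2# * levelAt t m
      found m any with find any
      ... | p , p∈ , o , ≡.refl , a with ℕ.<-cmp (machine p) (machine x)
      ... | tri≈ _ e _ = ≤-trans (≤-reflexive (sym ([]-yes e (machine p ℕ.≟ machine x))))
            (≤-trans (x≤x+y (0≤2* (0≤levelAt s (machine p)))) (x≤x+y (0≤2* (0≤levelAt t (machine p)))))
      ... | tri> _ _ gt = ≤-trans (big p∈ o ≡.refl a λ h → ℕ.<⇒≱ gt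
              (largest (≡.subst (p ∈_) eq (∈-filter⁺ Small? p∈ ((o , a) , h)))))
            (x≤y+x (+-nonNegative (0≤[] (machine p ℕ.≟ machine x)) (0≤2* (0≤levelAt s (machine p)))))
      ... | tri< lt _ _ = ≤-trans (double ½≤)
            (≤-trans (x≤y+x (0≤[] (machine p ℕ.≟ machine x))) (x≤x+y (0≤2* (0≤levelAt t (machine p)))))
        where
        -- A machine of First-Fit carries jobs of First-Fit only, so the level met by x is part of
        -- the First-Fit load at time s.
        before≤ : machineLevelBefore H (job x) (machine p) ≤ levelAt s (machine p)
        before≤ = ≤-trans (weight-filter-mono _ (λ p′ → machine p′ ℕ.≟ machine p ×-dec FF? s p′) H
            λ p′∈ (e , _ , b) → e , ≡.trans (same-machine⇒same-origin r p′∈ p∈ e) o , b)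
          (≤-reflexive (sym (total-filter-filter (λ p′ → machine p′ ℕ.≟ machine p) (FF? s) (size ∘ job) H)))
        ½≤ : ½ ≤ levelAt s (machine p)
        ½≤ with ½ ≤? levelAt s (machine p)
        ... | yes h = h
        ... | no n = contradiction (≤-trans (+-mono-≤ (≤-trans before≤ (≰⇒≥ n)) (proj₂ (proj₂ xs))) (≤-reflexive ½+½))
                (firstFitOrder r x∈H p∈ (proj₁ (proj₁ (proj₂ xs))) o (proj₂ (proj₁ (proj₂ xs))) a lt)

-- Machines of the non-clairvoyant copies

module Copies (ℝ : CompleteOrderedField) (A : BinPacking.StaticAlgorithm ℝ) (bs : HarmonicStatic.BoundedSpace ℝ A)
  (I : BinPacking.Instance ℝ) (V : CompleteOrderedField.Carrier ℝ) (class : Fin (BinPacking.Instance.n I) → ℕ) where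

  open HarmonicStatic ℝ
  open Trace ℝ A bs I V class public
  open StaticAlgorithm A
  open BoundedSpace bs
  open Combined A I V class

  copyOf : Origin → Maybe ℕ
  copyOf nothing        = nothing
  copyOf (just (j , _)) = just j

  slotOf : Origin → Maybe (ℕ × ℕ)
  slotOf nothing        = nothing
  slotOf (just (j , b)) = just (j , slot b)

  indexOf : Origin → ℕ
  indexOf nothing        = 0
  indexOf (just (_ , b)) = index b

  slotOf⇒copyOf : ∀ o {j c} → slotOf o ≡ just (j , c) → copyOf o ≡ just j
  slotOf⇒copyOf (just _) ≡.refl = ≡.refl

  slot-index-injective : ∀ {o o′ j c} → slotOf o ≡ just (j , c) → slotOf o′ ≡ just (j , c) → indexOf o ≡ indexOf o′ → o ≡ o′
  slot-index-injective {just (j , b)} {just (j′ , b′)} ≡.refl e e′ with Maybe.just-injective e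
  ... | es with ≡.cong proj₁ es
  ... | ≡.refl = ≡.cong (λ b → just (j , b)) (bin-injective (≡.sym (≡.cong proj₂ es)) e′)

  copy-class : ∀ {S H} → Run S H → ∀ {p j} → p ∈ H → copyOf (origin p) ≡ just j → class (job p) ≡ j
  copy-class (firstFit r i h _) (there q) e = copy-class r q e
  copy-class (firstFit r i h _) (here ≡.refl) ()
  copy-class (byCopy r i h _) (here ≡.refl) ≡.refl = ≡.refl
  copy-class (byCopy r i h _) (there q) e = copy-class r q e

  slot-listed : ∀ {S H} → Run S H → ∀ {p j c} → p ∈ H → slotOf (origin p) ≡ just (j , c) → c ∈ slots
  slot-listed (firstFit r i h _) (there q) e = slot-listed r q e
  slot-listed (firstFit r i h _) (here ≡.refl) ()
  slot-listed (byCopy {S} r i h _) (here ≡.refl) ≡.refl = slot-∈ (S (class i)) (0<size i) (size≤1 i)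
  slot-listed (byCopy r i h _) (there q) e = slot-listed r q e

  private
    update-count : ∀ S i j c → count (S j) c ℕ.≤ count (update S (class i) (proj₁ (pack (S (class i)) (size i))) j) c
    update-count S i j c with j ℕ.≟ class i
    ... | yes ≡.refl = count-mono (S j) (size i) c
    ... | no _ = ℕ.≤-refl

  index<count : ∀ {S H} → Run S H → ∀ {p j c} → p ∈ H → slotOf (origin p) ≡ just (j , c) → indexOf (origin p) ℕ.< count (S j) c
  index<count (firstFit r i h _) (there q) e = index<count r q e
  index<count (firstFit r i h _) (here ≡.refl) ()
  index<count (byCopy {S} r i h _) (here ≡.refl) ≡.refl = ℕ.≤-reflexive (≡.trans (≡.sym (count-pack (S (class i)) (size i)))
    (≡.cong (λ s → count s (slot (proj₂ (pack (S (class i)) (size i))))) (≡.sym (update-same S (class i)))))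
  index<count (byCopy {S} r i h _) {j = j} {c} (there q) e = ℕ.≤-trans (index<count r q e) (update-count S i j c)

  index-mono : ∀ {S H} → Run S H → ∀ {p p′ j c} → p ∈ H → p′ ∈ H → slotOf (origin p) ≡ just (j , c) → slotOf (origin p′) ≡ just (j , c) →
    job p Fin.≤ job p′ → indexOf (origin p) ℕ.≤ indexOf (origin p′)
  index-mono r@(firstFit r′ i h _) (here ≡.refl) _ ()
  index-mono (firstFit r i h _) (there q) (here ≡.refl) _ ()
  index-mono (firstFit r i h _) (there q) (there q′) e e′ l = index-mono r q q′ e e′ l
  index-mono (byCopy r i h _) (here ≡.refl) (here ≡.refl) _ _ _ = ℕ.≤-refl
  index-mono (byCopy r i h _) (here ≡.refl) (there q′) _ _ l = contradiction (h q′) (ℕ.≤⇒≯ l)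
  index-mono (byCopy {S} r i h _) (there q) (here ≡.refl) e ≡.refl l =
    ℕ.s≤s⁻¹ (ℕ.≤-trans (index<count r q e) (count-≤ (S (class i)) (size i)))
  index-mono (byCopy r i h _) (there q) (there q′) e e′ l = index-mono r q q′ e e′ l

  classAt : ℕ → ℕ → List Placed → List Placed
  classAt j t = filter (λ p → class (job p) ℕ.≟ j ×-dec activeAt? t (job p))

  -- The load tested on arrival includes the job itself, and later placements can only add to the
  -- sum, so the failed test remains failed in the final history.
  copy-load : ∀ {S H} → Run S H → ∀ {p j} → p ∈ H → copyOf (origin p) ≡ just j →
    ¬ weight (classAt j (start (job p)) H) ≤ threshold V j
  copy-load (firstFit r i h _) (here ≡.refl) ()
  copy-load (firstFit {H = H} r i h _) {p} {j} (there q) e le = copy-load r q e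
    (≤-trans (≤-trans (x≤y+x (*-nonNegative (0≤[] (P? new)) (0≤size i))) (≤-reflexive (sym (weight-cons P? new H)))) le)
    where
    new = placed i nothing (firstFitMachine H i)
    P? : ∀ p′ → Dec (class (job p′) ≡ j × Alive (start (job p)) p′)
    P? p′ = class (job p′) ℕ.≟ j ×-dec activeAt? (start (job p)) (job p′)
  copy-load (byCopy {S} {H} r i h _) {p} {j} (there q) e le = copy-load r q e
    (≤-trans (≤-trans (x≤y+x (*-nonNegative (0≤[] (P? new)) (0≤size i))) (≤-reflexive (sym (weight-cons P? new H)))) le)
    where
    o = just (class i , proj₂ (pack (S (class i)) (size i)))
    new = placed i o (binMachine H i o)
    P? : ∀ p′ → Dec (class (job p′) ≡ j × Alive (start (job p)) p′)
    P? p′ = class (job p′) ℕ.≟ j ×-dec activeAt? (start (job p)) (job p′)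
  copy-load (byCopy {S} {H} r i h n) (here ≡.refl) ≡.refl le = n (≤-trans (≤-trans
      (+-mono-≤ (≤-reflexive (total-filter-filter (λ p → class (job p) ℕ.≟ class i) (activeAt? (start i) ∘ job) (size ∘ job) H)) ≤-refl)
      (≤-reflexive (trans (+-comm _ _) (sym (trans (weight-cons P? new H)
        (+-congʳ (trans (*-congʳ ([]-yes (≡.refl , ℕ.≤-refl , start<end i) (P? new))) (*-identityˡ _)))))))) le)
    where
    o = just (class i , proj₂ (pack (S (class i)) (size i)))
    new = placed i o (binMachine H i o)
    P? : ∀ p′ → Dec (class (job p′) ≡ class i × Alive (start i) p′)
    P? p′ = class (job p′) ℕ.≟ class i ×-dec activeAt? (start i) (job p′)

  appendIf : ∀ {P : Set} → Dec P → Fin n → List (Fin n) → List (Fin n)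
  appendIf (yes _) i xs = xs ++ (i ∷ [])
  appendIf (no _)  i xs = xs

  -- In arrival order, as the static algorithm sees the items, whereas the history has the most
  -- recent job first.
  copyJobs : ℕ → List Placed → List (Fin n)
  copyJobs j []      = []
  copyJobs j (p ∷ H) = appendIf (Maybe.≡-dec ℕ._≟_ (copyOf (origin p)) (just j)) (job p) (copyJobs j H)

  static-run : ∀ {S H} → Run S H → ∀ j → S j ≡ run init (map size (copyJobs j H))
  static-run empty j = ≡.refl
  static-run (firstFit r i h _) j = static-run r j
  static-run (byCopy {S} {H} r i h _) j with class i ℕ.≟ j | Maybe.≡-dec ℕ._≟_ (just (class i)) (just j)
  ... | yes ≡.refl | no n = contradiction ≡.refl n
  ... | no n | yes e = contradiction (Maybe.just-injective e) n
  ... | no n | no _ = ≡.trans (update-other S λ e → n (≡.sym e)) (static-run r j)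
  ... | yes ≡.refl | yes _ = ≡.trans (update-same S (class i)) (≡.trans (≡.cong (λ s → proj₁ (pack s (size i))) (static-run r (class i)))
        (≡.sym (≡.trans (≡.cong (run init) (List.map-++ size (copyJobs (class i) H) (i ∷ [])))
          (List.foldl-++ _ init (map size (copyJobs (class i) H)) (size i ∷ [])))))

  copyJobs≤ : ∀ {S H} → Run S H → ∀ j {g : Fin n → Carrier} → (∀ i → 0# ≤ g i) →
    total g (copyJobs j H) ≤ total (g ∘ job) (filter (λ p → class (job p) ℕ.≟ j) H)
  copyJobs≤ {H = H} r j {g} n = go H λ q → copy-class r q
    where
    go : ∀ H → (∀ {p j} → p ∈ H → copyOf (origin p) ≡ just j → class (job p) ≡ j) →
      total g (copyJobs j H) ≤ total (g ∘ job) (filter (λ p → class (job p) ℕ.≟ j) H)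
    go [] _ = ≤-refl
    go (p ∷ H) h = ≤-trans (step′ (Maybe.≡-dec ℕ._≟_ (copyOf (origin p)) (just j)))
        (≤-reflexive (sym (trans (total-filter (λ p → class (job p) ℕ.≟ j) (g ∘ job) (p ∷ H))
           (+-congˡ (sym (total-filter (λ p → class (job p) ℕ.≟ j) (g ∘ job) H))))))
      where
      rest = go H (h ∘ there)
      step′ : (d : Dec (copyOf (origin p) ≡ just j)) → total g (appendIf d (job p) (copyJobs j H)) ≤
        [ class (job p) ℕ.≟ j ] * g (job p) + total (g ∘ job) (filter (λ p → class (job p) ℕ.≟ j) H)
      step′ (no _) = ≤-trans rest (x≤y+x (*-nonNegative (0≤[] (class (job p) ℕ.≟ j)) (n (job p))))
      step′ (yes e) = ≤-trans (≤-reflexive (trans (total-++ g (copyJobs j H) (job p ∷ [])) (trans (+-congˡ (+-identityʳ _)) (+-comm _ _))))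
        (+-mono-≤ (≤-reflexive (sym (trans (*-congʳ ([]-yes (h (here ≡.refl) e) (class (job p) ℕ.≟ j))) (*-identityˡ _)))) rest)

  copyJobs-∈ : ∀ j H {i} → i ∈ copyJobs j H → ∃[ p ] (p ∈ H × copyOf (origin p) ≡ just j × job p ≡ i)
  copyJobs-∈ j (p ∷ H) i∈ with Maybe.≡-dec ℕ._≟_ (copyOf (origin p)) (just j)
  ... | no _ = let p′ , p∈ , e = copyJobs-∈ j H i∈ in p′ , there p∈ , e
  ... | yes c with ∈-++⁻ (copyJobs j H) i∈
  ... | inj₁ q = let p′ , p∈ , e = copyJobs-∈ j H q in p′ , there p∈ , e
  ... | inj₂ (here ≡.refl) = p , here ≡.refl , c , ≡.refl

  inCopy? : ∀ j t p → Dec (copyOf (origin p) ≡ just j × Alive t p)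
  inCopy? j t p = Maybe.≡-dec ℕ._≟_ (copyOf (origin p)) (just j) ×-dec activeAt? t (job p)

  onSlot? : ∀ j c t m p → Dec (slotOf (origin p) ≡ just (j , c) × machine p ≡ m × Alive t p)
  onSlot? j c t m p = Maybe.≡-dec (Product.≡-dec ℕ._≟_ ℕ._≟_) (slotOf (origin p)) (just (j , c)) ×-dec
    (machine p ℕ.≟ m ×-dec activeAt? t (job p))

  slotBy? : ∀ j c t p → Dec (slotOf (origin p) ≡ just (j , c) × start (job p) ℕ.≤ t)
  slotBy? j c t p = Maybe.≡-dec (Product.≡-dec ℕ._≟_ ℕ._≟_) (slotOf (origin p)) (just (j , c)) ×-dec start (job p) ℕ.≤? t

  -- The bins of a slot are numbered in order of opening, so the largest number
  -- in use tells how many have been opened by time t.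
  openedBy : List Placed → ℕ → ℕ → ℕ → ℕ
  openedBy H j c t = foldr (λ p m → suc (indexOf (origin p)) ℕ.⊔ m) 0 (filter (slotBy? j c t) H)

  openedBy-upper : ∀ {H j c t p} → p ∈ H → slotOf (origin p) ≡ just (j , c) → start (job p) ℕ.≤ t → indexOf (origin p) ℕ.< openedBy H j c t
  openedBy-upper {H} {j} {c} {t} p∈ e s≤t = go (∈-filter⁺ (slotBy? j c t) p∈ (e , s≤t))
    where
    top : List Placed → ℕ
    top = foldr (λ p m → suc (indexOf (origin p)) ℕ.⊔ m) 0
    go : ∀ {p xs} → p ∈ xs → indexOf (origin p) ℕ.< top xs
    go {p} {.p ∷ xs} (here ≡.refl) = ℕ.m≤m⊔n (suc (indexOf (origin p))) (top xs)
    go {p} {x ∷ xs} (there q) = ℕ.≤-trans (go q) (ℕ.m≤n⊔m (suc (indexOf (origin x))) (top xs))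

  openedBy-least : ∀ {H j c t B} → (∀ {p} → p ∈ H → slotOf (origin p) ≡ just (j , c) → start (job p) ℕ.≤ t → indexOf (origin p) ℕ.< B) →
    openedBy H j c t ℕ.≤ B
  openedBy-least {H} {j} {c} {t} {B} h = go (filter (slotBy? j c t) H) λ q →
      let q′ , e , s = ∈-filter⁻ (slotBy? j c t) {xs = H} q in h q′ e s
    where
    go : ∀ xs → (∀ {p} → p ∈ xs → indexOf (origin p) ℕ.< B) → foldr (λ p m → suc (indexOf (origin p)) ℕ.⊔ m) 0 xs ℕ.≤ B
    go [] _ = ℕ.z≤n
    go (x ∷ xs) h = ℕ.⊔-lub (h (here ≡.refl)) (go xs (h ∘ there))

  openedBy-mono : ∀ {H j c t t′} → t ℕ.≤ t′ → openedBy H j c t ℕ.≤ openedBy H j c t′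
  openedBy-mono {H} {j} {c} {t} {t′} l = openedBy-least {H} {j} {c} {t} λ p∈ e s → openedBy-upper p∈ e (ℕ.≤-trans s l)

  -- The bins with an active job are among those opened in the last b steps,
  -- and the last one opened before.
  slot-machines : ∀ {S H} → Run S H → ∀ ms → Unique ms → ∀ j c b t → (∀ i → class i ≡ j → len i ℕ.≤ b) →
    total (λ m → [ Any.any? (onSlot? j c t m) H ]) ms + fromℕ (openedBy H j c (t ∸ b))
      ≤ fromℕ (openedBy H j c t) + [ Any.any? (inCopy? j t) H ]
  slot-machines {S} {H} r ms ums j c b t short with Any.any? (inCopy? j t) H
  ... | no none = begin
      total (λ m → [ Any.any? (onSlot? j c t m) H ]) ms + β′ ≈⟨ +-congʳ (trans (total-cong ms λ {m} _ →
          []-no (unused m) (Any.any? (onSlot? j c t m) H)) (total-0 ms)) ⟩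
      0# + β′   ≈⟨ +-comm _ _ ⟩
      β′ + 0#   ≤⟨ +-mono-≤ (fromℕ-mono (openedBy-mono {H} {j} {c} (ℕ.m∸n≤m t b))) ≤-refl ⟩
      fromℕ (openedBy H j c t) + 0# ∎
    where
    open ≤R
    β′ = fromℕ (openedBy H j c (t ∸ b))
    unused : ∀ m → ¬ Any (λ p → slotOf (origin p) ≡ just (j , c) × machine p ≡ m × Alive t p) H
    unused m any = let p , p∈ , e , _ , a = find any in none (lose p∈ (slotOf⇒copyOf (origin p) e , a))
  ... | yes _ = begin
      total (λ m → [ Any.any? (onSlot? j c t m) H ]) ms + fromℕ β′ ≈⟨ +-congʳ (sym (length-filter (λ m → Any.any? (onSlot? j c t m) H) ms)) ⟩
      fromℕ (length ms′) + fromℕ β′  ≈⟨ sym (fromℕ-+ (length ms′) β′) ⟩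
      fromℕ (length ms′ ℕ.+ β′)      ≤⟨ fromℕ-mono count≤ ⟩
      fromℕ (β ℕ.+ 1)                ≈⟨ trans (fromℕ-+ β 1) (+-congˡ (+-identityʳ 1#)) ⟩
      fromℕ β + 1# ∎
    where
    open ≤R
    β  = openedBy H j c t
    β′ = openedBy H j c (t ∸ b)
    ms′ = filter (λ m → Any.any? (onSlot? j c t m) H) ms
    OnIndex : ℕ → ℕ → Set
    OnIndex m u = ∃[ p ] (p ∈ H × slotOf (origin p) ≡ just (j , c) × machine p ≡ m × Alive t p × indexOf (origin p) ≡ u)
    -- A job active at t started after t ∸ b, so every job started by then precedes it and
    -- `index-mono` applies.
    recent : ∀ {p p′} → p ∈ H → p′ ∈ H → slotOf (origin p) ≡ just (j , c) → Alive t p → start (job p′) ℕ.≤ t ∸ b → job p′ Fin.≤ job p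
    recent {p} {p′} p∈ p′∈ e (_ , t<e) s′ with ℕ.≤-total (toℕ (job p′)) (toℕ (job p))
    ... | inj₁ l = l
    ... | inj₂ l = contradiction (ℕ.≤-trans (start-mono l) s′) (late (ℕ.≤-total b t))
      where
      t<s+b : t ℕ.< start (job p) ℕ.+ b
      t<s+b = ℕ.<-≤-trans t<e (ℕ.≤-trans (ℕ.≤-reflexive (≡.sym (ℕ.m+[n∸m]≡n (ℕ.<⇒≤ (start<end (job p))))))
        (ℕ.+-monoʳ-≤ (start (job p)) (short (job p) (copy-class r p∈ (slotOf⇒copyOf (origin p) e)))))
      late : b ℕ.≤ t ⊎ t ℕ.≤ b → ¬ start (job p) ℕ.≤ t ∸ b
      late (inj₁ b≤t) s≤ = ℕ.<⇒≱ t<s+b (ℕ.≤-trans (ℕ.+-monoˡ-≤ b s≤) (ℕ.≤-reflexive (ℕ.m∸n+n≡m b≤t)))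
      -- Truncated subtraction yields 0 here, and no job starts before step 1.
      late (inj₂ t≤b) s≤ = ℕ.<⇒≱ (1≤start (job p)) (ℕ.≤-trans s≤ (ℕ.≤-reflexive (ℕ.m≤n⇒m∸n≡0 t≤b)))
    β′≤suc : ∀ {p} → p ∈ H → slotOf (origin p) ≡ just (j , c) → Alive t p → β′ ℕ.≤ suc (indexOf (origin p))
    β′≤suc p∈ e a = openedBy-least {H} {j} {c} λ p′∈ e′ s′ → ℕ.s≤s (index-mono r p′∈ p∈ e′ e (recent p∈ p′∈ e a s′))
    -- β′ ∸ 1 is the number of the last bin opened by time t ∸ b, the only one of those bins that
    -- can still hold a job active at t. It accounts for the extra machine in the bound.
    in-range : ∀ {u} → (β′ ∸ 1) ℕ.≤ u → u ℕ.< β → u ∈ applyUpTo ((β′ ∸ 1) ℕ.+_) (β ∸ (β′ ∸ 1))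
    in-range {u} lo hi = ≡.subst (_∈ _) (ℕ.m+[n∸m]≡n lo) (∈-applyUpTo⁺ ((β′ ∸ 1) ℕ.+_) (ℕ.∸-monoˡ-< hi lo))
    length≤ : length ms′ ℕ.≤ β ∸ (β′ ∸ 1)
    length≤ = ≡.subst (length ms′ ℕ.≤_) (List.length-applyUpTo _ (β ∸ (β′ ∸ 1)))
      (length-injective OnIndex (applyUpTo ((β′ ∸ 1) ℕ.+_) (β ∸ (β′ ∸ 1))) (Unique.filter⁺ (λ m → Any.any? (onSlot? j c t m) H) ums)
        (λ m∈ → let p , p∈ , e , em , a = find (proj₂ (∈-filter⁻ (λ m → Any.any? (onSlot? j c t m) H) {xs = ms} m∈)) in
          indexOf (origin p) , in-range (ℕ.∸-monoˡ-≤ 1 (β′≤suc p∈ e a)) (openedBy-upper p∈ e (proj₁ a)) , p , p∈ , e , em , a , ≡.refl)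
        λ { _ _ (p , p∈ , e , ≡.refl , a , eu) (p′ , p′∈ , e′ , ≡.refl , a′ , eu′) →
          same p∈ p′∈ e (slot-index-injective {origin p′} {origin p} e′ e (≡.trans eu′ (≡.sym eu))) a a′ })
      where
      same : ∀ {p p′} → p ∈ H → p′ ∈ H → slotOf (origin p) ≡ just (j , c) → origin p′ ≡ origin p → Alive t p → Alive t p′ → machine p ≡ machine p′
      same {p} p∈ p′∈ e eo a a′ with origin p in eq
      ... | just x = same-bin⇒same-machine r p∈ p′∈ eq eo a a′
    count≤ : length ms′ ℕ.+ β′ ℕ.≤ β ℕ.+ 1
    count≤ = arith β′ (openedBy-mono {H} {j} {c} (ℕ.m∸n≤m t b)) length≤
      where
      arith : ∀ x → x ℕ.≤ β → length ms′ ℕ.≤ β ∸ (x ∸ 1) → length ms′ ℕ.+ x ℕ.≤ β ℕ.+ 1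
      arith zero _ l = ℕ.+-mono-≤ l ℕ.z≤n
      arith (suc x) x<β l = ℕ.≤-trans (ℕ.≤-reflexive (≡.trans (ℕ.+-suc _ x) (ℕ.+-comm 1 _)))
        (ℕ.+-monoˡ-≤ 1 (ℕ.≤-trans (ℕ.+-monoˡ-≤ x l) (ℕ.≤-reflexive (ℕ.m∸n+n≡m (ℕ.<⇒≤ x<β)))))

-- Sums over time, cost and volume

module Timeline (ℝ : CompleteOrderedField) (I : BinPacking.Instance ℝ) where

  open HarmonicStatic ℝ
  open Instance I

  total-steps : ∀ f → total f steps ≡ ∑< T (f ∘ suc)
  total-steps f = ≡.trans (total-map f suc (upTo T)) (total-applyUpTo (f ∘ suc) id T)

  length-steps : length steps ≡ T
  length-steps = ≡.trans (List.length-map suc (upTo T)) (List.length-upTo T)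

  steps-unique : Unique steps
  steps-unique = Unique.map⁺ ℕ.suc-injective (Unique.upTo⁺ T)

  ∈-steps : ∀ {t} → 1 ℕ.≤ t → t ℕ.≤ T → t ∈ steps
  ∈-steps (ℕ.s≤s _) t≤T = ∈-map⁺ suc (∈-upTo⁺ t≤T)

  -- Shifting the argument by one step lowers the sum by at most its last term, which is at most M,
  -- and b shifts are made.
  telescope : ∀ (β : ℕ → ℕ) M b → (∀ t → β t ℕ.≤ M) →
    total (fromℕ ∘ β) steps ≤ total (λ t → fromℕ (β (t ∸ b))) steps + fromℕ b * fromℕ M
  telescope β M zero h = ≤-reflexive (sym (trans (+-congˡ (zeroˡ _)) (+-identityʳ _)))
  telescope β M (suc b) h = begin
    total (fromℕ ∘ β) steps                       ≤⟨ telescope β M b h ⟩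
    total γ steps + fromℕ b * fromℕ M             ≤⟨ +-mono-≤ shift ≤-refl ⟩
    total (λ t → fromℕ (β (t ∸ suc b))) steps + fromℕ M + fromℕ b * fromℕ M
      ≈⟨ solve 3 (λ s M b → s :+ M :+ b :* M := s :+ (con 1 :+ b) :* M) refl _ (fromℕ M) (fromℕ b) ⟩
    total (λ t → fromℕ (β (t ∸ suc b))) steps + fromℕ (suc b) * fromℕ M ∎
    where
    open ≤R
    γ : ℕ → Carrier
    γ t = fromℕ (β (t ∸ b))
    shift : total γ steps ≤ total (λ t → fromℕ (β (t ∸ suc b))) steps + fromℕ M
    shift = begin
      total γ steps         ≡⟨ total-steps γ ⟩
      ∑< T (γ ∘ suc)        ≤⟨ x≤y+x (0≤fromℕ (β (0 ∸ b))) ⟩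
      ∑< (suc T) γ          ≈⟨ ∑<-last T γ ⟩
      ∑< T γ + γ T          ≤⟨ +-monoʳ-≤ _ (fromℕ-mono (h (T ∸ b))) ⟩
      ∑< T γ + fromℕ M      ≡⟨ ≡.cong (_+ fromℕ M) (≡.sym (total-steps (λ t → fromℕ (β (t ∸ suc b))))) ⟩
      total (λ t → fromℕ (β (t ∸ suc b))) steps + fromℕ M ∎

  window≤ : ∀ s w → total (λ t → [ s ℕ.≤? t ×-dec t ℕ.<? s ℕ.+ w ]) steps ≤ fromℕ w
  window≤ s w = ≤-trans (≤-reflexive (sym (length-filter W? steps)))
    (fromℕ-mono (≡.subst (length (filter W? steps) ℕ.≤_) (List.length-applyUpTo (s ℕ.+_) w)
      (length-⊆ (Unique.filter⁺ W? steps-unique) λ t∈ → inside (proj₂ (∈-filter⁻ W? {xs = steps} t∈)))))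
    where
    W? : ∀ t → Dec (s ℕ.≤ t × t ℕ.< s ℕ.+ w)
    W? t = s ℕ.≤? t ×-dec t ℕ.<? s ℕ.+ w
    inside : ∀ {t} → s ℕ.≤ t × t ℕ.< s ℕ.+ w → t ∈ applyUpTo (s ℕ.+_) w
    inside {t} (l , u) = ≡.subst (_∈ _) (ℕ.m+[n∸m]≡n l) (∈-applyUpTo⁺ (s ℕ.+_)
      (≡.subst (t ∸ s ℕ.<_) (ℕ.m+n∸m≡n s w) (ℕ.∸-monoˡ-< u l)))

  len≤active : ∀ i → fromℕ (len i) ≤ total (λ t → [ activeAt? t i ]) steps
  len≤active i = ≤-trans (fromℕ-mono (≡.subst (ℕ._≤ length (filter (λ t → activeAt? t i) steps)) (List.length-applyUpTo (start i ℕ.+_) (len i))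
      (length-⊆ (Unique.applyUpTo⁺₁ (start i ℕ.+_) (len i) λ i<j _ e → ℕ.<⇒≢ i<j (ℕ.+-cancelˡ-≡ (start i) _ _ e)) inside)))
    (≤-reflexive (length-filter (λ t → activeAt? t i) steps))
    where
    inside : ∀ {t} → t ∈ applyUpTo (start i ℕ.+_) (len i) → t ∈ filter (λ t → activeAt? t i) steps
    inside t∈ with ∈-applyUpTo⁻ (start i ℕ.+_) t∈
    ... | r , r< , ≡.refl = ∈-filter⁺ (λ t → activeAt? t i) (∈-steps (ℕ.≤-trans (1≤start i) (ℕ.m≤m+n _ r)) (ℕ.s≤s⁻¹ (ℕ.<-≤-trans t<e (end≤1+T i))))
           (ℕ.m≤m+n _ r , t<e)
      where
      t<e : start i ℕ.+ r ℕ.< end i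
      t<e = ℕ.<-≤-trans (ℕ.+-monoʳ-< (start i) r<) (ℕ.≤-reflexive (ℕ.m+[n∸m]≡n (ℕ.<⇒≤ (start<end i))))

  len≤T : ∀ i → len i ℕ.≤ T
  len≤T i = ℕ.≤-trans (ℕ.∸-mono (end≤1+T i) (1≤start i)) ℕ.≤-refl

  busyAt? : ∀ (S : Schedule) t m → Dec (Any (λ p → proj₂ p ≡ m × ActiveAt t (proj₁ p)) S)
  busyAt? S t m = Any.any? (λ p → proj₂ p ℕ.≟ m ×-dec activeAt? t (proj₁ p)) S

  machines : Schedule → List ℕ
  machines S = deduplicate ℕ._≟_ (map proj₂ S)

  cost-total : ∀ S → fromℕ (cost S) ≈ total (λ t → total (λ m → [ busyAt? S t m ]) (machines S)) steps
  cost-total S = trans (fromℕ-sum (activeTime S) (machines S))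
    (trans (total-cong (machines S) λ {m} _ → length-filter (λ t → busyAt? S t m) steps)
      (total-swap (λ m t → [ busyAt? S t m ]) (machines S) steps))

  volume : Carrier
  volume = total load steps

  volume-jobs : volume ≈ total (λ i → total (λ t → [ activeAt? t i ] * size i) steps) (allFin n)
  volume-jobs = trans (total-cong steps λ {t} _ → total-filter (activeAt? t) size (allFin n))
    (total-swap (λ t i → [ activeAt? t i ] * size i) steps (allFin n))

  len*size≤volume : total (λ i → fromℕ (len i) * size i) (allFin n) ≤ volume
  len*size≤volume = ≤-trans (total-mono (allFin n) λ {i} _ → ≤-trans (*-monoʳ-≤ (proj₁ (0<size i)) (len≤active i))
      (≤-reflexive (trans (*-comm _ _) (trans (sym (total-* (size i) _ steps)) (total-cong steps λ _ → *-comm _ _)))))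
    (≤-reflexive (sym volume-jobs))

-- The cost of the Combined Algorithm in terms of bins and loads

module CostBound (ℝ : CompleteOrderedField) (A : BinPacking.StaticAlgorithm ℝ) (bs : HarmonicStatic.BoundedSpace ℝ A)
  (I : BinPacking.Instance ℝ) (V : CompleteOrderedField.Carrier ℝ) (class : Fin (BinPacking.Instance.n I) → ℕ) where

  open HarmonicStatic ℝ
  open Copies ℝ A bs I V class public
  open Timeline ℝ I public
  open StaticAlgorithm A
  open BoundedSpace bs
  open Combined A I V class
  open Configuration

  H : List Placed
  H = history final

  S : ℕ → State
  S = static final

  jobs : ℕ → List (Fin n)
  jobs j = copyJobs j H

  used : ℕ → Carrier
  used j = fromℕ (nonempty (map size (jobs j)))

  classWeight : ℕ → Carrier
  classWeight j = weight (filter (λ p → class (job p) ℕ.≟ j) H)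

  activeSteps : ℕ → Carrier
  activeSteps j = total (λ t → [ Any.any? (inCopy? j t) H ]) steps

  binCount : ℕ → Carrier
  binCount j = total (λ c → fromℕ (count (S j) c)) slots

  0≤weight-filter : ∀ {P : Placed → Set} (P? : ∀ p → Dec (P p)) → 0# ≤ weight (filter P? H)
  0≤weight-filter P? = total-nonNegative (filter P? H) λ {p} _ → 0≤size (job p)

  activeSteps≤T : ∀ j → activeSteps j ≤ fromℕ T
  activeSteps≤T j = ≤-trans (total-mono steps λ {t} _ → []≤1 (Any.any? (inCopy? j t) H))
    (≤-reflexive (trans (total-1 steps) (reflexive (≡.cong fromℕ length-steps))))

  -- `slot-machines` bounds the machines at time t by the bins opened in the last b steps and one
  -- more. Summed over time, `telescope` counts each bin for at most b steps, and the extra machine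
  -- is counted while the copy is active.
  slot-cost : ∀ ms → Unique ms → ∀ j c b → (∀ i → class i ≡ j → len i ℕ.≤ b) →
    total (λ t → total (λ m → [ Any.any? (onSlot? j c t m) H ]) ms) steps ≤ activeSteps j + fromℕ b * fromℕ (count (S j) c)
  slot-cost ms ums j c b short = +-cancelʳ-≤ B′ (begin
    total N steps + B′              ≈⟨ sym (total-+ N (λ t → fromℕ (β (t ∸ b))) steps) ⟩
    total (λ t → N t + fromℕ (β (t ∸ b))) steps ≤⟨ total-mono steps (λ {t} _ → slot-machines run-final ms ums j c b t short) ⟩
    total (λ t → fromℕ (β t) + [ Any.any? (inCopy? j t) H ]) steps ≈⟨ total-+ (fromℕ ∘ β) _ steps ⟩
    total (fromℕ ∘ β) steps + activeSteps j ≤⟨ +-mono-≤ (telescope β (count (S j) c) b λ t → openedBy-least {H} {j} {c} {t} λ p∈ e _ → index<count run-final p∈ e) ≤-refl ⟩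
    B′ + fromℕ b * fromℕ (count (S j) c) + activeSteps j ≈⟨ solve 3 (λ a b c → a :+ b :+ c := c :+ b :+ a) refl B′ _ (activeSteps j) ⟩
    activeSteps j + fromℕ b * fromℕ (count (S j) c) + B′ ∎)
    where
    open ≤R
    N : ℕ → Carrier
    N t = total (λ m → [ Any.any? (onSlot? j c t m) H ]) ms
    β : ℕ → ℕ
    β = openedBy H j c
    B′ = total (λ t → fromℕ (β (t ∸ b))) steps

  totalCost≤ : ¬ V ≤ 0# → ∀ J → (∀ i → class i ∈ classes J) → (b : ℕ → ℕ) → (∀ i → len i ℕ.≤ b (class i)) →
    fromℕ totalCost ≤ fromℕ T * (1# + 4# * ∑< J (λ j → threshold V (suc j)))
      + total (λ j → fromℕ (length slots) * activeSteps j + fromℕ (b j) * binCount j) (classes J)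
  totalCost≤ V≰0 J c∈ b short = begin
    fromℕ totalCost                                              ≈⟨ cost-total result ⟩
    total (λ t → total (λ m → [ busyAt? result t m ]) ms) steps  ≤⟨ total-mono steps (λ {t} _ → ≤-trans (total-mono ms λ {m} _ → split t m)
                                                                      (≤-reflexive (total-+ (λ m → [ Any.any? (onFirstFit? t m) H ]) (copies t) ms))) ⟩
    total (λ t → total (λ m → [ Any.any? (onFirstFit? t m) H ]) ms + total (copies t) ms) steps ≈⟨ total-+ _ (λ t → total (copies t) ms) steps ⟩
    total (λ t → total (λ m → [ Any.any? (onFirstFit? t m) H ]) ms) steps + total (λ t → total (copies t) ms) steps
      ≤⟨ +-mono-≤ (≤-trans (total-mono steps λ {t} _ → firstFit-machines V≰0 J run-final c∈ ms ums t)
           (≤-reflexive (trans (total-const F steps) (*-congʳ (reflexive (≡.cong fromℕ length-steps)))))) copies≤ ⟩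
    fromℕ T * F + total (λ j → fromℕ (length slots) * activeSteps j + fromℕ (b j) * binCount j) (classes J) ∎
    where
    open ≤R
    F = 1# + 4# * ∑< J (λ j → threshold V (suc j))
    ms = machines result
    ums : Unique ms
    ums = UniqueDec.deduplicate-! ℕ._≟_ (map proj₂ result)
    on : ℕ → ℕ → ℕ → ℕ → Carrier
    on t m j c = [ Any.any? (onSlot? j c t m) H ]
    copies : ℕ → ℕ → Carrier
    copies t m = total (λ j → total (on t m j) slots) (classes J)
    0≤on : ∀ t m j c → 0# ≤ on t m j c
    0≤on t m j c = 0≤[] (Any.any? (onSlot? j c t m) H)
    0≤copies : ∀ t m → 0# ≤ copies t m
    0≤copies t m = total-nonNegative (classes J) λ {j} _ → total-nonNegative slots λ {c} _ → 0≤on t m j c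
    split : ∀ t m → [ busyAt? result t m ] ≤ [ Any.any? (onFirstFit? t m) H ] + copies t m
    split t m = []≤ (busyAt? result t m) (λ any → let p , p∈ , e , a = find (Any.map⁻ any) in located p p∈ e a (origin p) ≡.refl)
        (+-nonNegative (0≤[] (Any.any? (onFirstFit? t m) H)) (0≤copies t m))
      where
      located : ∀ p → p ∈ H → machine p ≡ m → Alive t p → ∀ o → origin p ≡ o → 1# ≤ [ Any.any? (onFirstFit? t m) H ] + copies t m
      located p p∈ e a nothing eo = ≤-trans (≤-reflexive (sym ([]-yes (lose p∈ (eo , e , a)) (Any.any? (onFirstFit? t m) H)))) (x≤x+y (0≤copies t m))
      located p p∈ e a (just (j , bin)) eo = ≤-trans (≤-trans
          (≤-trans (≤-reflexive (sym ([]-yes (lose p∈ (es , e , a)) (Any.any? (onSlot? j (slot bin) t m) H))))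
            (∈-≤total {f = on t m j} (λ {c} _ → 0≤on t m j c) (slot-listed run-final p∈ es)))
          (∈-≤total {f = λ j → total (on t m j) slots} (λ {j} _ → total-nonNegative slots λ {c} _ → 0≤on t m j c) j∈))
          (x≤y+x (0≤[] (Any.any? (onFirstFit? t m) H)))
        where
        es : slotOf (origin p) ≡ just (j , slot bin)
        es = ≡.cong slotOf eo
        j∈ : j ∈ classes J
        j∈ = ≡.subst (_∈ classes J) (copy-class run-final p∈ (≡.cong copyOf eo)) (c∈ (job p))
    copies≤ : total (λ t → total (copies t) ms) steps ≤ total (λ j → fromℕ (length slots) * activeSteps j + fromℕ (b j) * binCount j) (classes J)
    copies≤ = begin
      total (λ t → total (copies t) ms) steps
        ≈⟨ total-cong steps (λ {t} _ → total-swap (λ m j → total (on t m j) slots) ms (classes J)) ⟩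
      total (λ t → total (λ j → total (λ m → total (on t m j) slots) ms) (classes J)) steps
        ≈⟨ total-swap (λ t j → total (λ m → total (on t m j) slots) ms) steps (classes J) ⟩
      total (λ j → total (λ t → total (λ m → total (on t m j) slots) ms) steps) (classes J) ≤⟨ total-mono (classes J) (λ {j} _ → begin
        total (λ t → total (λ m → total (on t m j) slots) ms) steps ≈⟨ total-cong steps (λ {t} _ → total-swap (λ m c → on t m j c) ms slots) ⟩
        total (λ t → total (λ c → total (λ m → on t m j c) ms) slots) steps ≈⟨ total-swap (λ t c → total (λ m → on t m j c) ms) steps slots ⟩
        total (λ c → total (λ t → total (λ m → on t m j c) ms) steps) slots
          ≤⟨ total-mono slots (λ {c} _ → slot-cost ms ums j c (b j) λ i e → ≡.subst (λ j → len i ℕ.≤ b j) e (short i)) ⟩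
        total (λ c → activeSteps j + fromℕ (b j) * fromℕ (count (S j) c)) slots
          ≈⟨ trans (total-+ (λ _ → activeSteps j) _ slots) (+-cong (total-const (activeSteps j) slots) (total-* (fromℕ (b j)) _ slots)) ⟩
        fromℕ (length slots) * activeSteps j + fromℕ (b j) * binCount j ∎) ⟩
      total (λ j → fromℕ (length slots) * activeSteps j + fromℕ (b j) * binCount j) (classes J) ∎

  private
    inClass? : ∀ j p → Dec (class (job p) ≡ j)
    inClass? j p = class (job p) ℕ.≟ j

  -- A step at which copy j is active is charged to the class-j jobs that were
  -- active when the witnessing job arrived, all within 2b of their start.
  threshold*activeSteps≤ : ∀ j b → 0# ≤ threshold V j → (∀ i → class i ≡ j → len i ℕ.≤ b) →
    threshold V j * activeSteps j ≤ 2# * fromℕ b * classWeight j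
  threshold*activeSteps≤ j b 0≤q short = begin
    threshold V j * activeSteps j ≈⟨ sym (total-* (threshold V j) _ steps) ⟩
    total (λ t → threshold V j * [ Any.any? (inCopy? j t) H ]) steps ≤⟨ total-mono steps (λ {t} _ → ≤-trans (≤-reflexive (*-comm _ _))
        ([]*≤ (Any.any? (inCopy? j t) H) (charge t) (total-nonNegative Hj λ {p} _ → *-nonNegative (0≤[] (W? p t)) (0≤size (job p))))) ⟩
    total (λ t → total (λ p → [ W? p t ] * size (job p)) Hj) steps ≈⟨ total-swap (λ t p → [ W? p t ] * size (job p)) steps Hj ⟩
    total (λ p → total (λ t → [ W? p t ] * size (job p)) steps) Hj ≤⟨ total-mono Hj (λ {p} _ → begin
      total (λ t → [ W? p t ] * size (job p)) steps ≈⟨ trans (total-cong steps λ _ → *-comm _ _) (total-* (size (job p)) _ steps) ⟩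
      size (job p) * total (λ t → [ W? p t ]) steps ≤⟨ *-monoˡ-≤ (0≤size (job p)) (window≤ (start (job p)) (b ℕ.+ b)) ⟩
      size (job p) * fromℕ (b ℕ.+ b)               ≈⟨ trans (*-congˡ (fromℕ-+ b b)) (solve 2 (λ s b → s :* (b :+ b) := con 2 :* b :* s) refl (size (job p)) (fromℕ b)) ⟩
      2# * fromℕ b * size (job p) ∎) ⟩
    total (λ p → 2# * fromℕ b * size (job p)) Hj ≈⟨ total-* (2# * fromℕ b) (size ∘ job) Hj ⟩
    2# * fromℕ b * classWeight j ∎
    where
    open ≤R
    Hj = filter (inClass? j) H
    W? : ∀ p t → Dec (start (job p) ℕ.≤ t × t ℕ.< start (job p) ℕ.+ (b ℕ.+ b))
    W? p t = start (job p) ℕ.≤? t ×-dec t ℕ.<? start (job p) ℕ.+ (b ℕ.+ b)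
    end≤ : ∀ i → class i ≡ j → end i ℕ.≤ start i ℕ.+ b
    end≤ i e = ℕ.≤-trans (ℕ.≤-reflexive (≡.sym (ℕ.m+[n∸m]≡n (ℕ.<⇒≤ (start<end i))))) (ℕ.+-monoʳ-≤ (start i) (short i e))
    charge : ∀ t → Any (λ p → copyOf (origin p) ≡ just j × Alive t p) H → threshold V j ≤ total (λ p → [ W? p t ] * size (job p)) Hj
    charge t any with find any
    ... | p , p∈ , e , (s≤t , t<e) = begin
      threshold V j                                     ≤⟨ ≰⇒≥ (copy-load run-final p∈ e) ⟩
      -- On the one hand t < start p + b. On the other, p′ is active at start p, so start p ≤ start
      -- p′ + b; hence the window of length 2b.
      weight (classAt j (start (job p)) H)              ≤⟨ weight-filter-mono _ (λ p′ → W? p′ t ×-dec inClass? j p′) H (λ {p′} _ (e′ , s≤ , s<) →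
           (ℕ.≤-trans s≤ s≤t , ℕ.<-≤-trans t<e (ℕ.≤-trans (end≤ (job p) (copy-class run-final p∈ e))
             (ℕ.≤-trans (ℕ.+-monoˡ-≤ b (ℕ.≤-trans (ℕ.<⇒≤ s<) (end≤ (job p′) e′))) (ℕ.≤-reflexive (ℕ.+-assoc (start (job p′)) b b))))) , e′) ⟩
      weight (filter (λ p′ → W? p′ t ×-dec inClass? j p′) H) ≈⟨ sym (total-filter-filter (λ p′ → W? p′ t) (inClass? j) (size ∘ job) H) ⟩
      weight (filter (λ p′ → W? p′ t) Hj)               ≈⟨ total-filter (λ p′ → W? p′ t) (size ∘ job) Hj ⟩
      total (λ p → [ W? p t ] * size (job p)) Hj ∎

  private
    jobs-case : ∀ j → (used j ≈ 0#) ⊎ (used j ≈ 1# × ∃[ p ] (p ∈ H × copyOf (origin p) ≡ just j))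
    jobs-case j with jobs j in eq
    ... | [] = inj₁ refl
    ... | i ∷ _ = let p , p∈ , e , _ = copyJobs-∈ j H (≡.subst (i ∈_) (≡.sym eq) (here ≡.refl)) in inj₂ (+-identityʳ 1# , p , p∈ , e)

  -- A copy that receives any item has seen its class load above the threshold at that arrival, and
  -- the class as a whole weighs at least as much.
  threshold*used≤ : ∀ j → threshold V j * used j ≤ classWeight j
  threshold*used≤ j with jobs-case j
  ... | inj₁ e = ≤-trans (≤-reflexive (trans (*-congˡ e) (zeroʳ _))) (0≤weight-filter (inClass? j))
  ... | inj₂ (e , p , p∈ , c) = ≤-trans (≤-reflexive (trans (*-congˡ e) (*-identityʳ _))) (≤-trans (≰⇒≥ (copy-load run-final p∈ c))
        (weight-filter-mono _ (inClass? j) H λ _ → proj₁))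

  a*used≤T : (a : ℕ → ℕ) → (∀ i → a (class i) ℕ.≤ len i) → ∀ j → fromℕ (a j) * used j ≤ fromℕ T
  a*used≤T a short j with jobs-case j
  ... | inj₁ e = ≤-trans (≤-reflexive (trans (*-congˡ e) (zeroʳ _))) (0≤fromℕ T)
  ... | inj₂ (e , p , p∈ , c) = ≤-trans (≤-reflexive (trans (*-congˡ e) (*-identityʳ _)))
        (fromℕ-mono (ℕ.≤-trans (≡.subst (λ j → a j ℕ.≤ len (job p)) (copy-class run-final p∈ c) (short (job p))) (len≤T (job p))))

  a*classWeight≤volume : (a : ℕ → ℕ) → (∀ i → a (class i) ℕ.≤ len i) → ∀ J → total (λ j → fromℕ (a j) * classWeight j) (classes J) ≤ volume
  a*classWeight≤volume a short J = begin
    total (λ j → fromℕ (a j) * classWeight j) (classes J) ≤⟨ total-mono (classes J) (λ {j} _ → begin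
      fromℕ (a j) * classWeight j                                   ≈⟨ sym (total-* (fromℕ (a j)) (size ∘ job) (filter (inClass? j) H)) ⟩
      total (λ p → fromℕ (a j) * size (job p)) (filter (inClass? j) H) ≤⟨ total-mono (filter (inClass? j) H) (λ {p} p∈ →
           *-monoʳ-≤ (0≤size (job p)) (fromℕ-mono (≡.subst (λ j → a j ℕ.≤ len (job p)) (proj₂ (∈-filter⁻ (inClass? j) {xs = H} p∈)) (short (job p))))) ⟩
      total (λ p → fromℕ (len (job p)) * size (job p)) (filter (inClass? j) H) ∎) ⟩
    total (λ j → total (λ p → fromℕ (len (job p)) * size (job p)) (filter (inClass? j) H)) (classes J)
      ≤⟨ total-fibres ℕ._≟_ (class ∘ job) (classes J) H (Unique.applyUpTo⁺₁ suc J λ i<j _ e → ℕ.<⇒≢ i<j (ℕ.suc-injective e))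
           (λ {p} _ → *-nonNegative (0≤fromℕ (len (job p))) (0≤size (job p))) ⟩
    total (λ p → fromℕ (len (job p)) * size (job p)) H ≈⟨ total-history (λ i → fromℕ (len i) * size i) ⟩
    total (λ i → fromℕ (len i) * size i) (allFin n) ≤⟨ len*size≤volume ⟩
    volume ∎
    where open ≤R

  sizes-jobs≤ : ∀ j → sizes (map size (jobs j)) ≤ classWeight j
  sizes-jobs≤ j = ≤-trans (≤-reflexive (reflexive (total-map (λ w → w) size (jobs j)))) (copyJobs≤ run-final j 0≤size)

-- A feasible schedule as a static packing

module Offline (ℝ : CompleteOrderedField) (I : BinPacking.Instance ℝ) (f : Fin (BinPacking.Instance.n I) → ℕ)
  (feasible : BinPacking.Instance.Feasible I f) where

  open HarmonicStatic ℝ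
  open Instance I
  open Timeline ℝ I

  private
    on? : ∀ t m i → Dec (f i ≡ m × ActiveAt t i)
    on? t m i = f i ℕ.≟ m ×-dec activeAt? t i

    0≤size : ∀ i → 0# ≤ size i
    0≤size i = proj₁ (0<size i)

  f∈machines : ∀ i → f i ∈ machines (schedule f)
  f∈machines i = ∈-deduplicate⁺ ℕ._≟_ (∈-map⁺ proj₂ (∈-map⁺ (λ i → i , f i) (∈-allFin i)))

  busy⁺ : ∀ {t i} → ActiveAt t i → Any (λ p → proj₂ p ≡ f i × ActiveAt t (proj₁ p)) (schedule f)
  busy⁺ {t} {i} a = lose (∈-map⁺ (λ i → i , f i) (∈-allFin i)) (≡.refl , a)

  volume≤cost : volume ≤ fromℕ (cost (schedule f))
  volume≤cost = begin
    total load steps ≤⟨ total-mono steps (λ {t} _ → begin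
      load t ≤⟨ total-cover ℕ._≟_ f {size} ms (filter (activeAt? t) (allFin n)) (λ {i} _ → 0≤size i) (λ {i} _ → f∈machines i) ⟩
      total (λ m → total size (filter (λ i → f i ℕ.≟ m) (filter (activeAt? t) (allFin n)))) ms
        ≤⟨ total-mono ms (λ {m} _ → ≤-trans (≤-reflexive (filter-filter t m)) (level≤ t m (busyAt? (schedule f) t m))) ⟩
      total (λ m → [ busyAt? (schedule f) t m ]) ms ∎) ⟩
    total (λ t → total (λ m → [ busyAt? (schedule f) t m ]) ms) steps ≈⟨ sym (cost-total (schedule f)) ⟩
    fromℕ (cost (schedule f)) ∎
    where
    open ≤R
    ms = machines (schedule f)
    filter-filter : ∀ t m → total size (filter (λ i → f i ℕ.≟ m) (filter (activeAt? t) (allFin n))) ≈ total size (filter (on? t m) (allFin n))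
    filter-filter t m = trans (total-filter (λ i → f i ℕ.≟ m) size (filter (activeAt? t) (allFin n)))
      (trans (total-filter (activeAt? t) _ (allFin n))
        (trans (total-cong (allFin n) λ {i} _ → both (f i ℕ.≟ m) (activeAt? t i) (size i)) (sym (total-filter (on? t m) size (allFin n)))))
      where
      both : ∀ {P Q : Set} (p : Dec P) (q : Dec Q) x → [ q ] * ([ p ] * x) ≈ [ p ×-dec q ] * x
      both (yes _) (yes _) x = *-identityˡ _
      both (yes _) (no _) x = trans (zeroˡ _) (sym (zeroˡ _))
      both (no _) (yes _) x = *-identityˡ _
      both (no _) (no _) x = trans (zeroˡ _) (sym (zeroˡ _))
    level≤ : ∀ t m → (d : Dec (Any (λ p → proj₂ p ≡ m × ActiveAt t (proj₁ p)) (schedule f))) → total size (filter (on? t m) (allFin n)) ≤ [ d ]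
    level≤ t m (yes _) = feasible t m
    level≤ t m (no idle) = ≤-reflexive (trans (total-filter (on? t m) size (allFin n))
      (trans (total-cong (allFin n) λ {i} _ → trans (*-congʳ ([]-no (λ { (≡.refl , a) → idle (busy⁺ a) }) (on? t m i))) (zeroˡ _)) (total-0 (allFin n))))

  -- Offering each item of copy j for a(j) consecutive steps of its interval,
  -- N times over: the bin (ν, t, m) holds what machine m holds at time t.
  module Offer (A : StaticAlgorithm) (bs : BoundedSpace A) (V : Carrier) (class : Fin n → ℕ)
               (a : ℕ → ℕ) (short : ∀ i → a (class i) ℕ.≤ len i) where

    open CostBound ℝ A bs I V class using (H; jobs; copyJobs≤; copyJobs-∈; copy-class; run-final; classes; job; total-history)

    Item Label : Set
    Item  = (ℕ × ℕ) × Fin n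
    Label = ℕ × (ℕ × ℕ)

    _≟ˡ_ : DecidableEquality Label
    _≟ˡ_ = Product.≡-dec ℕ._≟_ (Product.≡-dec ℕ._≟_ ℕ._≟_)

    label : Item → Label
    label ((ν , r) , i) = ν , (start i ℕ.+ r , f i)

    copiesOf : ℕ → ℕ → List (ℕ × ℕ)
    copiesOf N j = cartesianProduct (upTo N) (upTo (a j))

    itemsOf : ℕ → ℕ → List Item
    itemsOf N j = concatMap (λ x → map (x ,_) (jobs j)) (copiesOf N j)

    items : ℕ → List ℕ → List Item
    items N js = concatMap (itemsOf N) js

    -- One entry for every unit of cost of the schedule, which is why `length-labels` finds the cost
    -- in each of the N repetitions.
    busyPairs : List (ℕ × ℕ)
    busyPairs = concatMap (λ m → map (_, m) (filter (λ t → busyAt? (schedule f) t m) steps)) (machines (schedule f))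

    length-copiesOf : ∀ N j → length (copiesOf N j) ≡ N ℕ.* a j
    length-copiesOf N j = ≡.trans (length-cartesianProduct (upTo N) (upTo (a j))) (≡.cong₂ ℕ._*_ (List.length-upTo N) (List.length-upTo (a j)))

    map-items : ∀ k N js → map (size ∘ proj₂) (items N js) ≡ concat (blocks k N a (λ j → map size (jobs j)) js)
    map-items k N js = ≡.trans (map-concatMap (size ∘ proj₂) (itemsOf N) js)
      (≡.trans (List.concatMap-cong (λ j → ≡.trans (map-pairs size (copiesOf N j) (jobs j))
          (≡.cong (λ m → concat (replicate m (map size (jobs j)))) (length-copiesOf N j))) js)
        (≡.sym (concat-concatMap (λ j → replicate (N ℕ.* a j) (map size (jobs j))) js)))

    length-labels : ∀ N → length (cartesianProduct (upTo N) busyPairs) ≡ N ℕ.* cost (schedule f)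
    length-labels N = ≡.trans (length-cartesianProduct (upTo N) busyPairs) (≡.cong₂ ℕ._*_ (List.length-upTo N)
      (≡.trans (length-concatMap (λ m → map (_, m) (filter (λ t → busyAt? (schedule f) t m) steps)) (machines (schedule f)))
        (≡.cong ℕ.sum (List.map-cong (λ m → List.length-map (_, m) (filter (λ t → busyAt? (schedule f) t m) steps)) (machines (schedule f))))))

    class-jobs : ∀ {i} j → i ∈ jobs j → class i ≡ j
    class-jobs j i∈ with copyJobs-∈ j H i∈
    ... | p , p∈ , e , ≡.refl = copy-class run-final p∈ e

    offered-active : ∀ {i r} j → i ∈ jobs j → r ∈ upTo (a j) → ActiveAt (start i ℕ.+ r) i
    offered-active {i} {r} j i∈ r∈ = ℕ.m≤m+n _ r , ℕ.<-≤-trans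
      (ℕ.+-monoʳ-< (start i) (ℕ.<-≤-trans (∈-upTo⁻ r∈) (≡.subst (λ j → a j ℕ.≤ len i) (class-jobs j i∈) (short i))))
      (ℕ.≤-reflexive (ℕ.m+[n∸m]≡n (ℕ.<⇒≤ (start<end i))))

    label-listed : ∀ N js {x} → x ∈ items N js → label x ∈ cartesianProduct (upTo N) busyPairs
    label-listed N js x∈ with find (∈-concatMap⁻ (itemsOf N) {xs = js} x∈)
    ... | j , _ , y∈ with find (∈-concatMap⁻ (λ x → map (x ,_) (jobs j)) {xs = copiesOf N j} y∈)
    ... | (ν , r) , νr∈ , z∈ with ∈-map⁻ ((ν , r) ,_) z∈ | ∈-cartesianProduct⁻ (upTo N) (upTo (a j)) νr∈
    ... | i , i∈ , ≡.refl | ν∈ , r∈ = ∈-cartesianProduct⁺ ν∈ (∈-concatMap⁺ (λ m → map (_, m) (filter (λ t → busyAt? (schedule f) t m) steps))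
        (lose (f∈machines i) (∈-map⁺ (_, f i) (∈-filter⁺ (λ t → busyAt? (schedule f) t (f i)) t∈ (busy⁺ act)))))
      where
      act = offered-active j i∈ r∈
      t∈ : start i ℕ.+ r ∈ steps
      t∈ = ∈-steps (ℕ.≤-trans (1≤start i) (proj₁ act)) (ℕ.s≤s⁻¹ (ℕ.≤-trans (proj₂ act) (end≤1+T i)))

    fits : ∀ N J l → total (size ∘ proj₂) (filter (λ x → label x ≟ˡ l) (items N (classes J))) ≤ 1#
    fits N J l@(ν , (t , m)) = begin
      total (size ∘ proj₂) (filter (λ x → label x ≟ˡ l) (items N js)) ≈⟨ total-filter (λ x → label x ≟ˡ l) (size ∘ proj₂) (items N js) ⟩
      total w (items N js) ≈⟨ total-concatMap w (itemsOf N) js ⟩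
      total (λ j → total w (itemsOf N j)) js ≤⟨ total-mono js (λ {j} _ → begin
        total w (itemsOf N j) ≈⟨ total-concatMap w (λ x → map (x ,_) (jobs j)) (copiesOf N j) ⟩
        total (λ x → total w (map (x ,_) (jobs j))) (copiesOf N j) ≈⟨ total-cong (copiesOf N j) (λ {x} _ → reflexive (total-map w (x ,_) (jobs j))) ⟩
        total (λ x → total (λ i → w (x , i)) (jobs j)) (copiesOf N j) ≈⟨ total-swap (λ x i → w (x , i)) (copiesOf N j) (jobs j) ⟩
        total (λ i → total (λ x → w (x , i)) (copiesOf N j)) (jobs j) ≤⟨ total-mono (jobs j) (λ {i} i∈ → begin
          total (λ x → w (x , i)) (copiesOf N j) ≈⟨ trans (total-cong (copiesOf N j) λ _ → *-comm _ _) (total-* (size i) _ (copiesOf N j)) ⟩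
          size i * total (λ x → [ label (x , i) ≟ˡ l ]) (copiesOf N j) ≤⟨ *-monoˡ-≤ (0≤size i) (once j i∈ (on? t m i)) ⟩
          size i * [ on? t m i ] ≈⟨ *-comm _ _ ⟩
          g i ∎) ⟩
        total g (jobs j) ≤⟨ copyJobs≤ run-final j (λ i → *-nonNegative (0≤[] (on? t m i)) (0≤size i)) ⟩
        total (g ∘ job) (filter (λ p → class (job p) ℕ.≟ j) H) ∎) ⟩
      total (λ j → total (g ∘ job) (filter (λ p → class (job p) ℕ.≟ j) H)) js
        ≤⟨ total-fibres ℕ._≟_ (class ∘ job) js H (Unique.applyUpTo⁺₁ suc J λ i<j _ e → ℕ.<⇒≢ i<j (ℕ.suc-injective e))
             (λ {p} _ → *-nonNegative (0≤[] (on? t m (job p))) (0≤size (job p))) ⟩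
      total (g ∘ job) H ≈⟨ total-history g ⟩
      total g (allFin n) ≈⟨ sym (total-filter (on? t m) size (allFin n)) ⟩
      total size (filter (on? t m) (allFin n)) ≤⟨ feasible t m ⟩
      1# ∎
      where
      open ≤R
      js = classes J
      w : Item → Carrier
      w x = [ label x ≟ˡ l ] * size (proj₂ x)
      g : Fin n → Carrier
      g i = [ on? t m i ] * size i
      -- For a fixed job the label determines ν, and its time determines r. It is attained only if
      -- the job is on m and active at t, so each bin receives no more than the feasible content of
      -- m at t.
      once : ∀ {i} j → i ∈ jobs j → (d : Dec (f i ≡ m × ActiveAt t i)) → total (λ x → [ label (x , i) ≟ˡ l ]) (copiesOf N j) ≤ [ d ]
      once {i} j i∈ (yes _) = total-unique-≤1 (λ x → label (x , i) ≟ˡ l) (copiesOf N j) (Unique.cartesianProduct⁺ (Unique.upTo⁺ N) (Unique.upTo⁺ (a j)))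
        λ { {ν , r} {ν′ , r′} e e′ → let e″ = ≡.trans e (≡.sym e′) in
             ≡.cong₂ _,_ (≡.cong proj₁ e″) (ℕ.+-cancelˡ-≡ (start i) r r′ (≡.cong (proj₁ ∘ proj₂) e″)) }
      once {i} j i∈ (no ¬on) = ≤-reflexive (trans (total-cong (copiesOf N j) λ {x} x∈ →
          []-no (λ e → ¬on (≡.cong (proj₂ ∘ proj₂) e , ≡.subst (λ t → ActiveAt t i) (≡.cong (proj₁ ∘ proj₂) e)
            (offered-active j i∈ (proj₂ (∈-cartesianProduct⁻ (upTo N) (upTo (a j)) x∈))))) (label (x , i) ≟ˡ l)) (total-0 (copiesOf N j)))

    offer-packable : ∀ k N J → Packable (concat (blocks k N a (λ j → map size (jobs j)) (classes J))) (N ℕ.* cost (schedule f))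
    offer-packable k N J = ≡.subst₂ Packable (map-items k N (classes J)) (length-labels N)
      (packable-labelled _≟ˡ_ (size ∘ proj₂) label (items N (classes J)) (cartesianProduct (upTo N) busyPairs)
        (λ {x} _ → 0≤size (proj₂ x)) (λ x∈ → label-listed N (classes J) x∈) (fits N J))

-- Classes under predicted lengths, and the sum over all classes

module Assembly (ℝ : CompleteOrderedField) where

  open HarmonicStatic ℝ

  module Prediction (I : Instance) (2≤μ : 2 ℕ.≤ Instance.μ I) {δ α lam : Carrier} (0≤δ : 0# ≤ δ) (0≤α : 0# ≤ α) (0≤lam : 0# ≤ lam)
                    (V : Carrier) (ℓ′ : Fin (Instance.n I) → Carrier) (pred : Predicted I δ α lam V ℓ′)
                    (class : Fin (Instance.n I) → ℕ) (classified : ∀ i → InClass V (ℓ′ i) (class i)) where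

    open Instance I
    open Timeline ℝ I
    open Predicted pred
    open ≤R

    private
      D = 1# + δ
      1≤D : 1# ≤ D
      1≤D = 1≤1+ 0≤δ
      D≰0 : ¬ D ≤ 0#
      D≰0 = ≥1⇒≰0 1≤D
      A = 1# + α
      B = 1# + lam
      1≤A : 1# ≤ A
      1≤A = 1≤1+ 0≤α
      1≤B : 1# ≤ B
      1≤B = 1≤1+ 0≤lam
      0≤A = ≤-trans 0≤1 1≤A
      0≤B = ≤-trans 0≤1 1≤B

    R m P : Carrier
    R = A * B
    m = fromℕ μ
    P = R ⊓ m

    B≤R : B ≤ R
    B≤R = ≤-trans (≤-reflexive (sym (*-identityˡ B))) (*-monoʳ-≤ 0≤B 1≤A)

    2≤m : 2# ≤ m
    2≤m = ≤-trans (≤-reflexive (+-congˡ (sym (+-identityʳ 1#)))) (fromℕ-mono 2≤μ)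

    1≤m : 1# ≤ m
    1≤m = ≤-trans (x≤x+y 0≤1) 2≤m

    1≤P : 1# ≤ P
    1≤P = ⊓-glb (≤-trans 1≤B B≤R) 1≤m

    0≤P : 0# ≤ P
    0≤P = ≤-trans 0≤1 1≤P

    0≤R : 0# ≤ R
    0≤R = *-nonNegative 0≤A 0≤B

    P≤R : P ≤ R
    P≤R = ⊓≤ˡ R m

    private
      someJob : Fin n
      someJob = proj₁ minLength

      widest = argmaxℕ class someJob (allFin n)

    K : ℕ
    K = class (proj₁ widest) ∸ 1

    class≤ : ∀ i → class i ℕ.≤ suc K
    class≤ i = ≡.subst (class i ℕ.≤_) (≡.sym (ℕ.m+[n∸m]≡n (proj₁ (classified (proj₁ widest))))) (proj₂ (proj₂ widest) (there (∈-allFin i)))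

    class-∈ : ∀ i → class i ∈ applyUpTo suc (suc K)
    class-∈ i with class i | proj₁ (classified i) | class≤ i
    ... | suc j | _ | j≤ = ∈-applyUpTo⁺ suc j≤

    1≤len : ∀ i → 1 ℕ.≤ len i
    1≤len i = ℕ.m<n⇒0<n∸m (start<end i)

    len≤μ : ∀ i → len i ℕ.≤ μ
    len≤μ i = All.lookup (Extrema.xs≤max 0 (map len (allFin n))) (∈-map⁺ len (∈-allFin i))

    -- Raising a prediction below 1 to 1 is harmless here because true lengths are at least 1.
    predicted≤ : ∀ i → 1# ⊔ ℓ′ i ≤ fromℕ (len i) * B
    predicted≤ i = ⊔-lub (≤-trans (≤-reflexive (sym (*-identityˡ 1#))) (*-mono-≤ 0≤1 (1≤fromℕ (1≤len i)) 0≤1 1≤B)) (ℓ-upper i)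

    exp≤ : exp (εSum V K) ≤ m * B
    exp≤ = ≤-trans (proj₁ (proj₂ (classified (proj₁ widest)))) (≤-trans (predicted≤ (proj₁ widest)) (*-monoʳ-≤ 0≤B (fromℕ-mono (len≤μ (proj₁ widest)))))

    1≤T : 1 ℕ.≤ T
    1≤T = ℕ.≤-trans (1≤len someJob) (len≤T someJob)

    T≰0 : ¬ fromℕ T ≤ 0#
    T≰0 = 1≤⇒≰0 1≤T

    T*vAvg : fromℕ T * vAvg ≈ total (λ t → ⌈ load t ⌉) steps
    T*vAvg = trans (*-comm _ _) (/-* _ T≰0)

    volume≤ : volume ≤ fromℕ T * vAvg
    volume≤ = ≤-trans (total-mono steps λ {t} _ → x≤⌈x⌉ (load t)) (≤-reflexive (sym T*vAvg))

    load≰0 : ∀ {t} → t ∈ steps → ¬ load t ≤ 0#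
    load≰0 {t} t∈ le with ∈-map⁻ suc t∈
    ... | t′ , t′∈ , ≡.refl with busy (suc t′) (ℕ.s≤s ℕ.z≤n) (∈-upTo⁻ t′∈)
    ... | i , a = <⇒≱ (0<size i) (≤-trans (∈-≤total {f = size} (λ {i} _ → proj₁ (0<size i)) (∈-filter⁺ (activeAt? (suc t′)) (∈-allFin i) a)) le)

    -- Some interval is active at each step, so the load is positive and its ceiling at least 1.
    -- This is what makes Y at least 1 and lets constants disappear in it.
    1≤vAvg : 1# ≤ vAvg
    1≤vAvg = *-cancelˡ-≤ T≰0 (begin
      fromℕ T * 1#                      ≡⟨ ≡.cong (λ k → fromℕ k * 1#) (≡.sym length-steps) ⟩
      fromℕ (length steps) * 1#         ≈⟨ sym (total-const 1# steps) ⟩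
      total (λ _ → 1#) steps            ≤⟨ total-mono steps (λ t∈ → 1≤⌈x⌉ (load≰0 t∈)) ⟩
      total (λ t → ⌈ load t ⌉) steps    ≈⟨ sym T*vAvg ⟩
      fromℕ T * vAvg ∎)

    open LowerOrder {V} {vAvg} {D} {K} 1≤D 1≤vAvg (≤-trans (/≤⁻ D≰0 V-lower) (≤-reflexive (*-comm V D)))
      (≤-trans V-upper (≤-reflexive (*-comm vAvg D))) public

    X : Carrier
    X = sqrt (D * vAvg * log m)

    P*Y≤4RX : P * Y ≤ 4# * (R * X)
    P*Y≤4RX = P*Y≤ 2≤m 1≤B B≤R 0≤P (⊓≤ʳ R m) P≤R exp≤

    private
      ofClass : ℕ → List ℕ
      ofClass j = map len (filter (λ i → class i ℕ.≟ j) (allFin n))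

      ∈-ofClass : ∀ i → len i ∈ ofClass (class i)
      ∈-ofClass i = ∈-map⁺ len (∈-filter⁺ (λ i′ → class i′ ℕ.≟ class i) (∈-allFin i) ≡.refl)

      ofClass⁻ : ∀ {j l} → l ∈ ofClass j → ∃[ i ] (class i ≡ j × l ≡ len i)
      ofClass⁻ {j} l∈ = let i , i∈ , e = ∈-map⁻ len l∈ in i , proj₂ (∈-filter⁻ (λ i → class i ℕ.≟ j) {xs = allFin n} i∈) , e

    -- The defaults μ and 0 make `longest≤` hold for empty classes too. As every length lies between
    -- them, they do not alter the extrema of a nonempty class.
    shortest longest : ℕ → ℕ
    shortest j = Extrema.min μ (ofClass j)
    longest j  = Extrema.max 0 (ofClass j)

    shortest≤ : ∀ i → shortest (class i) ℕ.≤ len i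
    shortest≤ i = All.lookup (Extrema.min≤xs μ (ofClass (class i))) (∈-ofClass i)

    ≤longest : ∀ i → len i ℕ.≤ longest (class i)
    ≤longest i = All.lookup (Extrema.xs≤max 0 (ofClass (class i))) (∈-ofClass i)

    stretch : ℕ → Carrier
    stretch j = 1# + 3# * rate V j

    1≤stretch : ∀ j → 1# ≤ stretch j
    1≤stretch j = 1≤1+ (*-nonNegative 0≤3 (rate-nonNegative V≰0 j))

    -- If P is μ, it suffices that lengths lie between 1 and μ. If P is R, a true length is at most
    -- 1 + α times its prediction, the predictions within a class differ by at most the factor
    -- `stretch`, and a prediction is at most 1 + λ times the true length.
    lengths-comparable : ∀ i i′ → class i ≡ class i′ → fromℕ (len i) ≤ P * (stretch (class i) * fromℕ (len i′))
    lengths-comparable i i′ e with ≤-total R m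
    ... | inj₂ _ = begin
      fromℕ (len i)   ≤⟨ fromℕ-mono (len≤μ i) ⟩
      m               ≈⟨ sym (trans (*-congˡ (*-identityˡ 1#)) (*-identityʳ m)) ⟩
      m * (1# * 1#)   ≤⟨ *-monoˡ-≤ (≤-trans 0≤1 1≤m) (*-mono-≤ 0≤1 (1≤stretch (class i)) 0≤1 (1≤fromℕ (1≤len i′))) ⟩
      m * (stretch (class i) * fromℕ (len i′)) ∎
    ... | inj₁ _ = begin
      fromℕ (len i)             ≤⟨ /≤⁻ (≥1⇒≰0 1≤A) (ℓ-lower i) ⟩
      ℓ′ i * A                  ≤⟨ *-monoʳ-≤ 0≤A (≤-trans (≤⊔ʳ 1# (ℓ′ i)) (proj₁ (proj₂ (proj₂ (classified i))))) ⟩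
      exp (εSum V j) * A        ≤⟨ *-monoʳ-≤ 0≤A (grow j (proj₁ (classified i))) ⟩
      exp (εSum V (j ∸ 1)) * stretch j * A ≤⟨ *-monoʳ-≤ 0≤A (*-monoʳ-≤ (≤-trans 0≤1 (1≤stretch j))
          (≤-trans (≡.subst (λ k → exp (εSum V (k ∸ 1)) ≤ 1# ⊔ ℓ′ i′) (≡.sym e) (proj₁ (proj₂ (classified i′)))) (predicted≤ i′))) ⟩
      fromℕ (len i′) * B * stretch j * A   ≈⟨ solve 4 (λ l B s A → l :* B :* s :* A := A :* B :* (s :* l)) refl (fromℕ (len i′)) B (stretch j) A ⟩
      R * (stretch j * fromℕ (len i′)) ∎
      where
      j = class i
      grow : ∀ j → 1 ℕ.≤ j → exp (εSum V j) ≤ exp (εSum V (j ∸ 1)) * stretch j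
      grow (suc k) _ = ≤-trans (exp-mono (εSum-nonNegative V≰0 (suc k)) (≤-reflexive (εSum-last V k)))
        (exp-+-upper (εSum-nonNegative V≰0 k) (rate-nonNegative V≰0 (suc k)) (⊓≤ˡ 1# (fromℕ (suc k) / V)))

    longest≤ : ∀ j → fromℕ (longest j) ≤ P * (stretch j * fromℕ (shortest j))
    longest≤ j with Extrema.argmax-sel id 0 (ofClass j)
    ... | inj₁ e = ≤-trans (≤-reflexive (reflexive (≡.cong fromℕ e)))
          (*-nonNegative 0≤P (*-nonNegative (≤-trans 0≤1 (1≤stretch j)) (0≤fromℕ (shortest j))))
    ... | inj₂ l∈ with ofClass⁻ l∈ | Extrema.argmin-sel id μ (ofClass j)
    ... | i , ≡.refl , e | inj₂ s∈ = let i′ , c , e′ = ofClass⁻ s∈ in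
          ≤-trans (≤-reflexive (reflexive (≡.cong fromℕ e))) (≤-trans (lengths-comparable i i′ (≡.sym c))
            (≤-reflexive (*-congˡ (*-congˡ (reflexive (≡.cong fromℕ (≡.sym e′)))))))
    ... | i , ≡.refl , e | inj₁ e′ = begin
          fromℕ (longest j) ≡⟨ ≡.cong fromℕ e ⟩
          fromℕ (len i)     ≤⟨ fromℕ-mono (len≤μ i) ⟩
          m                 ≈⟨ sym (trans (*-identityˡ _) (*-identityˡ m)) ⟩
          1# * (1# * m)     ≤⟨ *-mono-≤ 0≤1 1≤P (*-nonNegative 0≤1 (≤-trans 0≤1 1≤m)) (*-monoʳ-≤ (≤-trans 0≤1 1≤m) (1≤stretch j)) ⟩
          P * (stretch j * m) ≡⟨ ≡.cong (λ x → P * (stretch j * fromℕ x)) (≡.sym e′) ⟩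
          P * (stretch j * fromℕ (shortest j)) ∎

    rate-mono : ∀ {j j′} → j ℕ.≤ j′ → rate V j ≤ rate V j′
    rate-mono {j} {j′} l = ⊓-glb (⊓≤ˡ 1# (fromℕ j / V)) (≤-trans (⊓≤ʳ 1# (fromℕ j / V)) (*-monoʳ-≤ (⁻¹-nonNegative V≰0) (fromℕ-mono l)))

    module Conclusion (Alg : StaticAlgorithm) (bs : BoundedSpace Alg) {k : ℕ} (1≤k : 1 ℕ.≤ k)
                      (slots≡k : length (BoundedSpace.slots bs) ≡ k) {ρ : Carrier} (0≤ρ : 0# ≤ ρ) {OPT : ℕ} where

      open CostBound ℝ Alg bs I V class using (binCount; classWeight; used; activeSteps; totalCost≤; activeSteps≤T; threshold*activeSteps≤;
        threshold*used≤; a*used≤T; a*classWeight≤volume; 0≤weight-filter; classes; H; job; jobs; S; inCopy?)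

      private
        J = suc K
        js = classes J
        a b : ℕ → Carrier
        a j = fromℕ (shortest j)
        b j = fromℕ (longest j)
        v = vAvg
        k# = fromℕ k
        τ = fromℕ T
        U W Act : Carrier
        U = total (λ j → a j * used j) js
        W = total (λ j → a j * classWeight j) js
        Act = total activeSteps js
        ΣaB = total (λ j → a j * binCount j) js

        0≤k# : 0# ≤ k#
        0≤k# = 0≤fromℕ k
        0≤τ : 0# ≤ τ
        0≤τ = 0≤fromℕ T
        0≤W : ∀ j → 0# ≤ classWeight j
        0≤W j = 0≤weight-filter (λ p → class (job p) ℕ.≟ j)
        0≤used : ∀ j → 0# ≤ used j
        0≤used j = 0≤fromℕ (nonempty (map size (jobs j)))
        0≤B# : ∀ j → 0# ≤ binCount j
        0≤B# j = total-nonNegative (BoundedSpace.slots bs) λ {c} _ → 0≤fromℕ (BoundedSpace.count bs (S j) c)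
        0≤PY = *-nonNegative 0≤P 0≤Y
        v≰0 = ≥1⇒≰0 1≤vAvg

        W≤ : W ≤ τ * v
        W≤ = ≤-trans (a*classWeight≤volume shortest shortest≤ J) volume≤

        stretch≤4 : ∀ j → stretch j ≤ 4#
        stretch≤4 j = ≤-trans (+-monoʳ-≤ 1# (*-monoˡ-≤ 0≤3 (⊓≤ˡ 1# (fromℕ j / V)))) (≤-reflexive (solve 0 (con 1 :+ con 3 :* con 1 := con 4) refl))

        count : ∀ {f : ℕ → Carrier} → (∀ j → f j ≤ τ) → total f js ≤ τ * fromℕ J
        count h = ≤-trans (total-mono js λ {j} _ → h j) (≤-trans (≤-reflexive (trans (total-const τ js)
          (*-congʳ (reflexive (≡.cong fromℕ (List.length-applyUpTo suc J)))))) (≤-reflexive (*-comm _ _)))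

        listed : ∀ {j} → j ∈ js → ∃[ i ] (i ℕ.< J × j ≡ suc i)
        listed = ∈-applyUpTo⁻ suc

        -- With large thresholds, v ≤ q_j Y and q_j ≤ `classWeight j` for a used class turn v U into
        -- at most Y W. As W is at most T v, the factor v cancels.
        U≤ : U ≤ τ * Y
        U≤ with few-classes⊎large-thresholds
        ... | inj₁ J≤Y = ≤-trans (count (a*used≤T shortest shortest≤)) (*-monoˡ-≤ 0≤τ J≤Y)
        ... | inj₂ v≤ = *-cancelˡ-≤ v≰0 (begin
          v * U                               ≈⟨ sym (total-* v _ js) ⟩
          total (λ j → v * (a j * used j)) js ≤⟨ total-mono js (λ j∈ → one (listed j∈)) ⟩
          total (λ j → Y * (a j * classWeight j)) js ≈⟨ total-* Y _ js ⟩
          Y * W                               ≤⟨ *-monoˡ-≤ 0≤Y W≤ ⟩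
          Y * (τ * v)                         ≈⟨ solve 3 (λ Y t v → Y :* (t :* v) := v :* (t :* Y)) refl Y τ v ⟩
          v * (τ * Y) ∎)
          where
          one : ∀ {j} → ∃[ i ] (i ℕ.< J × j ≡ suc i) → v * (a j * used j) ≤ Y * (a j * classWeight j)
          one {j} (i , i<J , ≡.refl) = begin
            v * (a j * used j)                   ≤⟨ *-monoʳ-≤ (*-nonNegative (0≤fromℕ (shortest j)) (0≤used j)) (v≤ i i<J) ⟩
            threshold V j * Y * (a j * used j)   ≈⟨ solve 4 (λ q Y a u → q :* Y :* (a :* u) := Y :* (a :* (q :* u))) refl (threshold V j) Y (a j) (used j) ⟩
            Y * (a j * (threshold V j * used j)) ≤⟨ *-monoˡ-≤ 0≤Y (*-monoˡ-≤ (0≤fromℕ (shortest j)) (threshold*used≤ j)) ⟩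
            Y * (a j * classWeight j) ∎

        -- Parallel to `U≤`. The 8 is 2 · 4: the window in `threshold*activeSteps≤` has length 2
        -- b(j), and b(j) ≤ 4 P a(j).
        Act≤ : Act ≤ 8# * (τ * (P * Y))
        Act≤ with few-classes⊎large-thresholds
        ... | inj₁ J≤Y = begin
          Act              ≤⟨ count activeSteps≤T ⟩
          τ * fromℕ J      ≤⟨ *-monoˡ-≤ 0≤τ (≤-trans J≤Y (≤-trans (≤-reflexive (sym (*-identityˡ Y))) (*-monoʳ-≤ 0≤Y 1≤P))) ⟩
          τ * (P * Y)      ≈⟨ sym (*-identityˡ _) ⟩
          1# * (τ * (P * Y)) ≤⟨ *-monoʳ-≤ (*-nonNegative 0≤τ 0≤PY) (≤-trans (x≤y+x (+-nonNegative 0≤6 0≤1)) ≤-refl) ⟩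
          8# * (τ * (P * Y)) ∎
        ... | inj₂ v≤ = *-cancelˡ-≤ v≰0 (begin
          v * Act                                ≈⟨ sym (total-* v activeSteps js) ⟩
          total (λ j → v * activeSteps j) js     ≤⟨ total-mono js (λ j∈ → one (listed j∈)) ⟩
          total (λ j → 8# * (P * Y) * (a j * classWeight j)) js ≈⟨ total-* (8# * (P * Y)) _ js ⟩
          8# * (P * Y) * W                       ≤⟨ *-monoˡ-≤ (*-nonNegative 0≤8 0≤PY) W≤ ⟩
          8# * (P * Y) * (τ * v)                 ≈⟨ solve 4 (λ P Y t v → con 8 :* (P :* Y) :* (t :* v) := v :* (con 8 :* (t :* (P :* Y)))) refl P Y τ v ⟩
          v * (8# * (τ * (P * Y))) ∎)
          where
          one : ∀ {j} → ∃[ i ] (i ℕ.< J × j ≡ suc i) → v * activeSteps j ≤ 8# * (P * Y) * (a j * classWeight j)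
          one {j} (i , i<J , ≡.refl) = begin
            v * activeSteps j                        ≤⟨ *-monoʳ-≤ (total-nonNegative steps λ {t} _ → 0≤[] (Any.any? (inCopy? j t) H)) (v≤ i i<J) ⟩
            threshold V j * Y * activeSteps j        ≈⟨ solve 3 (λ q Y x → q :* Y :* x := Y :* (q :* x)) refl (threshold V j) Y (activeSteps j) ⟩
            Y * (threshold V j * activeSteps j)      ≤⟨ *-monoˡ-≤ 0≤Y (threshold*activeSteps≤ j (longest j) (threshold-nonNegative V≰0 i)
                                                          λ i e → ≡.subst (λ j → len i ℕ.≤ longest j) e (≤longest i)) ⟩
            Y * (2# * b j * classWeight j)           ≤⟨ *-monoˡ-≤ 0≤Y (*-monoʳ-≤ (0≤W j) (*-monoˡ-≤ 0≤2 (≤-trans (longest≤ j)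
                                                          (*-monoˡ-≤ 0≤P (*-monoʳ-≤ (0≤fromℕ (shortest j)) (stretch≤4 j)))))) ⟩
            Y * (2# * (P * (4# * a j)) * classWeight j) ≈⟨ solve 4 (λ Y P a W → Y :* (con 2 :* (P :* (con 4 :* a)) :* W) := con 8 :* (P :* Y) :* (a :* W)) refl Y P (a j) (classWeight j) ⟩
            8# * (P * Y) * (a j * classWeight j) ∎

      -- The two hypotheses are the only facts about the static algorithm in which the uniform and
      -- the non-uniform case differ: a crude count for each copy, to be multiplied by the widening,
      -- and the sharp weighted count, which meets OPT.
      combined-cost : (∀ j → binCount j ≤ 2# * classWeight j + k# * used j) → ΣaB ≤ ρ * fromℕ OPT + k# * U →
        fromℕ (Combined.totalCost Alg I V class) ≤ R * (ρ * fromℕ OPT + τ * (k# * (fromℕ 108 * X)))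
      combined-cost binCount≤ ΣaB≤ = begin
        fromℕ (Combined.totalCost Alg I V class) ≤⟨ totalCost≤ V≰0 J class-∈ longest ≤longest ⟩
        τ * (1# + 4# * ∑< J (λ j → threshold V (suc j))) + total (λ j → fromℕ (length (BoundedSpace.slots bs)) * activeSteps j + b j * binCount j) js
          ≤⟨ +-mono-≤ (*-monoˡ-≤ 0≤τ (+-mono-≤ 1≤Y (*-monoˡ-≤ 0≤4 ∑threshold≤2Y))) (≤-trans
               (≤-reflexive (trans (total-+ _ (λ j → b j * binCount j) js) (+-congʳ (trans (total-* _ activeSteps js) (*-congʳ (reflexive (≡.cong fromℕ slots≡k)))))))
               (+-mono-≤ (*-monoˡ-≤ 0≤k# Act≤) bB≤)) ⟩
        τ * (Y + 4# * (2# * Y)) + (k# * (8# * (τ * (P * Y))) + (P * (ρ * fromℕ OPT + k# * (τ * Y)) + 6# * (P * (τ * Y)) + 3# * (P * (k# * (τ * Y)))))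
          ≤⟨ +-mono-≤ (≤-trans (≤-reflexive (solve 2 (λ t Y → t :* (Y :+ con 4 :* (con 2 :* Y)) := con 9 :* (con 1 :* (t :* (con 1 :* Y)))) refl τ Y))
                 (*-monoˡ-≤ 0≤9 (*-mono-≤ 0≤1 1≤k# (*-nonNegative 0≤τ (*-nonNegative 0≤1 0≤Y)) (*-monoˡ-≤ 0≤τ (*-monoʳ-≤ 0≤Y 1≤P)))))
               (+-mono-≤ ≤-refl (+-mono-≤ (+-mono-≤ ≤-refl (≤-trans (≤-reflexive (solve 3 (λ P t Y → con 6 :* (P :* (t :* Y)) := con 6 :* (con 1 :* (t :* (P :* Y)))) refl P τ Y))
                   (*-monoˡ-≤ 0≤6 (*-monoʳ-≤ (*-nonNegative 0≤τ 0≤PY) 1≤k#)))) ≤-refl)) ⟩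
        9# * (k# * (τ * (P * Y))) + (k# * (8# * (τ * (P * Y))) + (P * (ρ * fromℕ OPT + k# * (τ * Y)) + 6# * (k# * (τ * (P * Y))) + 3# * (P * (k# * (τ * Y)))))
          ≈⟨ solve 5 (λ k t P Y r → con 9 :* (k :* (t :* (P :* Y))) :+ (k :* (con 8 :* (t :* (P :* Y))) :+ (P :* (r :+ k :* (t :* Y)) :+ con 6 :* (k :* (t :* (P :* Y))) :+ con 3 :* (P :* (k :* (t :* Y)))))
               := P :* r :+ t :* (k :* (con 27 :* (P :* Y)))) refl k# τ P Y (ρ * fromℕ OPT) ⟩
        -- 27 = 9 + 8 + 1 + 6 + 3. First-Fit gives 1 + 4 · 2, the active bins of the copies give 8,
        -- and the block losses in the sharp count give 1; the widening contributes 6 through the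
        -- volume and 3 through the bins counted by `used`. With the 4 of `P*Y≤4RX` this makes 108.
        P * (ρ * fromℕ OPT) + τ * (k# * (27# * (P * Y)))
          ≤⟨ +-mono-≤ (*-monoʳ-≤ (*-nonNegative 0≤ρ (0≤fromℕ OPT)) P≤R) (*-monoˡ-≤ 0≤τ (*-monoˡ-≤ 0≤k# (*-monoˡ-≤ 0≤27 P*Y≤4RX))) ⟩
        R * (ρ * fromℕ OPT) + τ * (k# * (27# * (4# * (R * X))))
          ≈⟨ solve 5 (λ R r t k X → R :* r :+ t :* (k :* (con 27 :* (con 4 :* (R :* X)))) := R :* (r :+ t :* (k :* (con 108 :* X)))) refl R (ρ * fromℕ OPT) τ k# X ⟩
        R * (ρ * fromℕ OPT + τ * (k# * (108# * X))) ≈⟨ *-congˡ (+-congˡ (*-congˡ (*-congˡ (*-congʳ (sym (×ᵤ≈× 108 1#)))))) ⟩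
        R * (ρ * fromℕ OPT + τ * (k# * (fromℕ 108 * X))) ∎
        where
        open MultTCO (CommutativeRing.+-monoid commutativeRing) using (×ᵤ≈×) renaming (_×_ to _×′_)
        9# 27# 108# : Carrier
        9# = 9 ×′ 1#
        27# = 27 ×′ 1#
        108# = 108 ×′ 1#
        0≤9 : 0# ≤ 9#
        0≤9 = ≤-trans (0≤fromℕ 9) (≤-reflexive (×ᵤ≈× 9 1#))
        0≤27 : 0# ≤ 27#
        0≤27 = ≤-trans (0≤fromℕ 27) (≤-reflexive (×ᵤ≈× 27 1#))
        1≤k# : 1# ≤ k#
        1≤k# = 1≤fromℕ 1≤k
        -- The factor 1 + 3 ε_j is split: the 1 keeps the exact count for comparison with OPT, and 3
        -- ε_j meets the crude count. There ε_j is replaced by ε_J in front of the volume and by 1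
        -- in front of `used`.
        bB-one : ∀ j → j ℕ.≤ J → b j * binCount j ≤ P * (a j * binCount j) + (6# * (P * rate V J) * (a j * classWeight j) + 3# * (P * k#) * (a j * used j))
        bB-one j j≤J = begin
          b j * binCount j                               ≤⟨ *-monoʳ-≤ (0≤B# j) (longest≤ j) ⟩
          P * ((1# + 3# * rate V j) * a j) * binCount j  ≈⟨ solve 4 (λ P e a B → P :* ((con 1 :+ con 3 :* e) :* a) :* B := P :* (a :* B) :+ con 3 :* (P :* (e :* (a :* B)))) refl P (rate V j) (a j) (binCount j) ⟩
          P * (a j * binCount j) + 3# * (P * (rate V j * (a j * binCount j))) ≤⟨ +-monoʳ-≤ _ (*-monoˡ-≤ 0≤3 (*-monoˡ-≤ 0≤P (*-monoˡ-≤ 0≤e (*-monoˡ-≤ 0≤a (binCount≤ j))))) ⟩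
          P * (a j * binCount j) + 3# * (P * (rate V j * (a j * (2# * classWeight j + k# * used j))))
            ≈⟨ solve 7 (λ P x e a W k u → x :+ con 3 :* (P :* (e :* (a :* (con 2 :* W :+ k :* u)))) := x :+ (con 6 :* (P :* e) :* (a :* W) :+ con 3 :* (P :* (e :* k)) :* (a :* u))) refl P (P * (a j * binCount j)) (rate V j) (a j) (classWeight j) k# (used j) ⟩
          P * (a j * binCount j) + (6# * (P * rate V j) * (a j * classWeight j) + 3# * (P * (rate V j * k#)) * (a j * used j))
            ≤⟨ +-monoʳ-≤ _ (+-mono-≤ (*-monoʳ-≤ (*-nonNegative 0≤a (0≤W j)) (*-monoˡ-≤ 0≤6 (*-monoˡ-≤ 0≤P (rate-mono j≤J))))
                 (*-monoʳ-≤ (*-nonNegative 0≤a (0≤used j)) (*-monoˡ-≤ 0≤3 (*-monoˡ-≤ 0≤P (≤-trans (*-monoʳ-≤ 0≤k# (⊓≤ˡ 1# (fromℕ j / V))) (≤-reflexive (*-identityˡ k#))))))) ⟩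
          P * (a j * binCount j) + (6# * (P * rate V J) * (a j * classWeight j) + 3# * (P * k#) * (a j * used j)) ∎
          where
          0≤a = 0≤fromℕ (shortest j)
          0≤e = rate-nonNegative V≰0 j
        bB≤ : total (λ j → b j * binCount j) js ≤ P * (ρ * fromℕ OPT + k# * (τ * Y)) + 6# * (P * (τ * Y)) + 3# * (P * (k# * (τ * Y)))
        bB≤ = begin
          total (λ j → b j * binCount j) js ≤⟨ total-mono js (λ j∈ → let i , i<J , e = listed j∈ in bB-one _ (≡.subst (ℕ._≤ J) (≡.sym e) i<J)) ⟩
          total (λ j → P * (a j * binCount j) + (6# * (P * rate V J) * (a j * classWeight j) + 3# * (P * k#) * (a j * used j))) js
            ≈⟨ trans (total-+ _ _ js) (+-cong (total-* P _ js) (trans (total-+ _ _ js) (+-cong (total-* _ _ js) (total-* _ _ js)))) ⟩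
          P * ΣaB + (6# * (P * rate V J) * W + 3# * (P * k#) * U)
            ≤⟨ +-mono-≤ (*-monoˡ-≤ 0≤P (≤-trans ΣaB≤ (+-monoʳ-≤ _ (*-monoˡ-≤ 0≤k# U≤))))
                 (+-mono-≤ (≤-trans (*-monoˡ-≤ (*-nonNegative 0≤6 (*-nonNegative 0≤P (rate-nonNegative V≰0 J))) W≤)
                     (≤-trans (≤-reflexive (solve 4 (λ P e t v → con 6 :* (P :* e) :* (t :* v) := con 6 :* (P :* (t :* (e :* v)))) refl P (rate V J) τ v))
                       (*-monoˡ-≤ 0≤6 (*-monoˡ-≤ 0≤P (*-monoˡ-≤ 0≤τ rate*v≤Y)))))
                   (*-monoˡ-≤ (*-nonNegative 0≤3 (*-nonNegative 0≤P 0≤k#)) U≤)) ⟩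
          P * (ρ * fromℕ OPT + k# * (τ * Y)) + (6# * (P * (τ * Y)) + 3# * (P * k#) * (τ * Y))
            ≈⟨ solve 4 (λ x y P z → x :+ (y :+ con 3 :* P :* z) := x :+ y :+ con 3 :* P :* z) refl _ _ (P * k#) (τ * Y) ⟩
          P * (ρ * fromℕ OPT + k# * (τ * Y)) + 6# * (P * (τ * Y)) + 3# * (P * k#) * (τ * Y)
            ≈⟨ +-congˡ (trans (*-assoc _ _ _) (*-congˡ (*-assoc _ _ _))) ⟩
          P * (ρ * fromℕ OPT + k# * (τ * Y)) + 6# * (P * (τ * Y)) + 3# * (P * (k# * (τ * Y))) ∎

-- Uniform sizes with Next-Fit and arbitrary sizes with Harmonic

module Theorem (ℝ : CompleteOrderedField) where

  open HarmonicStatic ℝ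
  open Assembly ℝ

  module _ (I : Instance) (2≤μ : 2 ℕ.≤ Instance.μ I) {δ α lam : Carrier} (0≤δ : 0# ≤ δ) (0≤α : 0# ≤ α) (0≤lam : 0# ≤ lam)
           (V : Carrier) (ℓ′ : Fin (Instance.n I) → Carrier) (predicted : Predicted I δ α lam V ℓ′)
           (class : Fin (Instance.n I) → ℕ) (classified : ∀ i → InClass V (ℓ′ i) (class i))
           {OPT : ℕ} (opt : Instance.IsOPT I OPT) where

    open Instance I
    open Prediction I 2≤μ 0≤δ 0≤α 0≤lam V ℓ′ predicted class classified
    open ≤R

    private
      f = proj₁ (proj₁ opt)
      feasible = proj₁ (proj₂ (proj₁ opt))
      cost≡OPT = proj₂ (proj₂ (proj₁ opt))
      open Offline ℝ I f feasible

    nextFit-cost : ∀ g → 1 ℕ.≤ g → (∀ i → size i ≈ 1# / fromℕ g) →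
      fromℕ (Combined.totalCost NextFit I V class) ≤ R * (fromℕ OPT + fromℕ T * (fromℕ 108 * X))
    nextFit-cost g 1≤g uniform = ≤-trans (combined-cost binCount≤2 (begin
        total (λ j → a j * binCount j) js                        ≤⟨ total-mono js (λ {j} _ → ≤-trans (*-monoˡ-≤ (0≤fromℕ (shortest j)) (binCount≤ j)) (≤-reflexive (distribˡ _ _ _))) ⟩
        total (λ j → a j * classWeight j + a j * used j) js      ≈⟨ total-+ _ _ js ⟩
        total (λ j → a j * classWeight j) js + U                 ≤⟨ +-mono-≤ (≤-trans (a*classWeight≤volume shortest shortest≤ (suc K)) (≤-trans volume≤cost (≤-reflexive (reflexive (≡.cong fromℕ cost≡OPT))))) ≤-refl ⟩
        fromℕ OPT + U                                            ≈⟨ solve 2 (λ o u → o :+ u := con 1 :* o :+ (con 1 :+ con 0) :* u) refl (fromℕ OPT) U ⟩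
        1# * fromℕ OPT + fromℕ 1 * U ∎))
      (≤-reflexive (*-congˡ (+-cong (*-identityˡ _) (*-congˡ (trans (*-congʳ (+-identityʳ 1#)) (*-identityˡ _))))))
      where
      open CostBound ℝ NextFit nextFit-boundedSpace I V class using (binCount; classWeight; used; a*classWeight≤volume; 0≤weight-filter; jobs; job; static-run; run-final; sizes-jobs≤; classes)
      open Conclusion NextFit nextFit-boundedSpace (ℕ.s≤s ℕ.z≤n) ≡.refl 0≤1 {OPT} using (combined-cost)
      js = classes (suc K)
      a : ℕ → Carrier
      a j = fromℕ (shortest j)
      U = total (λ j → a j * used j) js
      binCount≤ : ∀ j → binCount j ≤ classWeight j + used j
      binCount≤ j = begin
        binCount j                                                ≈⟨ +-identityʳ _ ⟩
        fromℕ (opened (CostBound.S ℝ NextFit nextFit-boundedSpace I V class j)) ≡⟨ ≡.cong (fromℕ ∘ opened) (static-run run-final j) ⟩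
        fromℕ (opened (nfRun nothing (map size (jobs j))))        ≤⟨ opened≤size 1≤g (map size (jobs j)) (All.map⁺ (All.tabulate λ {i} _ → uniform i)) ⟩
        sizes (map size (jobs j)) + used j                        ≤⟨ +-mono-≤ (sizes-jobs≤ j) ≤-refl ⟩
        classWeight j + used j ∎
      binCount≤2 : ∀ j → binCount j ≤ 2# * classWeight j + fromℕ 1 * used j
      binCount≤2 j = ≤-trans (binCount≤ j) (≤-trans (x≤y+x (0≤weight-filter (λ p → class (job p) ℕ.≟ j)))
        (≤-reflexive (solve 2 (λ w u → w :+ (w :+ u) := con 2 :* w :+ (con 1 :+ con 0) :* u) refl (classWeight j) (used j))))

    harmonic-cost : ∀ k → 1 ℕ.≤ k →
      fromℕ (Combined.totalCost (Harmonic k) I V class) ≤ R * (Π k * fromℕ OPT + fromℕ T * (fromℕ k * (fromℕ 108 * X)))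
    harmonic-cost k 1≤k = combined-cost
        (λ j → begin
          binCount j                                ≈⟨ binCount≈ j ⟩
          opened∑ k (map size (jobs j))             ≤⟨ harmonic-opened≤ k (map size (jobs j)) (itemSizes j) ⟩
          2# * sizes (map size (jobs j)) + fromℕ k * used j ≤⟨ +-mono-≤ (*-monoˡ-≤ 0≤2 (sizes-jobs≤ j)) ≤-refl ⟩
          2# * classWeight j + fromℕ k * used j ∎)
        (≤-trans (≤-reflexive (total-cong js λ {j} _ → *-congˡ (binCount≈ j)))
          (harmonic-amortized k 1≤k js shortest (λ j → map size (jobs j)) OPT (λ {j} _ → itemSizes j)
            (≡.subst (λ c → ∀ N → Packable (concat (blocks k N shortest (λ j → map size (jobs j)) js)) (N ℕ.* c)) cost≡OPT
              λ N → Offer.offer-packable (Harmonic k) bs V class shortest shortest≤ k N (suc K))))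
      where
      bs = harmonic-boundedSpace 1≤k
      open CostBound ℝ (Harmonic k) bs I V class using (binCount; classWeight; used; jobs; static-run; run-final; sizes-jobs≤; classes)
      open Conclusion (Harmonic k) bs 1≤k (List.length-applyUpTo suc k) (0≤Π k 1≤k) {OPT} using (combined-cost)
      js = classes (suc K)
      itemSizes : ∀ j → Sizes (map size (jobs j))
      itemSizes j = All.map⁺ (All.tabulate λ {i} _ → 0<size i , size≤1 i)
      binCount≈ : ∀ j → binCount j ≈ opened∑ k (map size (jobs j))
      binCount≈ j = total-cong (slotsOf k) λ {c} _ → reflexive (≡.cong (fromℕ ∘ opened)
        (≡.trans (≡.cong (λ σ → σ c) (static-run run-final j)) (harmonic-run k (λ _ → nothing) (map size (jobs j)) c)))

theorem4p10 : (Σ ℕ λ K →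
    (ℝ : CompleteOrderedField) → let open BinPacking ℝ in
    (I : Instance) → let open Instance I in
    2 ℕ.≤ μ →
    (g : ℕ) → 1 ℕ.≤ g → (∀ i → size i ≈ 1# / fromℕ g) →
    (δ α lam : Carrier) → 0# ≤ δ → 0# ≤ α → 0# ≤ lam →
    (V : Carrier) (ℓ′ : Fin n → Carrier) → Predicted I δ α lam V ℓ′ →
    (class : Fin n → ℕ) → (∀ i → InClass V (ℓ′ i) (class i)) →
    (OPT : ℕ) → IsOPT OPT →
    fromℕ (Combined.totalCost NextFit I V class)
    ≤ (1# + α) * (1# + lam)
    * (fromℕ OPT + fromℕ T * (fromℕ K * sqrt ((1# + δ) * vAvg * log (fromℕ μ)))))
    ×
    (Σ ℕ λ K →
    (ℝ : CompleteOrderedField) → let open BinPacking ℝ in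
    (I : Instance) → let open Instance I in
    2 ℕ.≤ μ →
    (k : ℕ) → 1 ℕ.≤ k →
    (δ α lam : Carrier) → 0# ≤ δ → 0# ≤ α → 0# ≤ lam →
    (V : Carrier) (ℓ′ : Fin n → Carrier) → Predicted I δ α lam V ℓ′ →
    (class : Fin n → ℕ) → (∀ i → InClass V (ℓ′ i) (class i)) →
    (OPT : ℕ) → IsOPT OPT →
    fromℕ (Combined.totalCost (Harmonic k) I V class)
    ≤ (1# + α) * (1# + lam)
    * (Π k * fromℕ OPT
    + fromℕ T * (fromℕ k * (fromℕ K * sqrt ((1# + δ) * vAvg * log (fromℕ μ))))))
theorem4p10 =
  (108 , λ ℝ I 2≤μ g 1≤g uniform δ α lam 0≤δ 0≤α 0≤lam V ℓ′ predicted class inClass OPT opt →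
    Theorem.nextFit-cost ℝ I 2≤μ 0≤δ 0≤α 0≤lam V ℓ′ predicted class inClass opt g 1≤g uniform) ,
  (108 , λ ℝ I 2≤μ k 1≤k δ α lam 0≤δ 0≤α 0≤lam V ℓ′ predicted class inClass OPT opt →
    Theorem.harmonic-cost ℝ I 2≤μ 0≤δ 0≤α 0≤lam V ℓ′ predicted class inClass opt k 1≤k)
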